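{- Let $q$ be a prime power and let $\ell, m$ be positive integers with $\ell < m < q$. Let $(\bm{A}, \bm{B}, \pi)$ be the output of $\mathsf{GenPKP}^\star(q,\ell,m,1)$, i.e.\ $\pi$ is uniformly random in $\mathbb{S}_m$, $\bm{B}$ is uniformly random in $\mathbb{F}_q^{\star m \times 1, 1}$ (independent of $\pi$), and, given $(\pi,\bm{B})$, $\bm{A}$ is uniformly random among the matrices in $\mathbb{F}_q^{\ell \times m, \ell}$ satisfying $\bm{A}\bm{\pi}\bm{B} = \bm{0}$. Then \[ \mathbb{E}[N_{\mathsf{sol}}(\bm{A}, \bm{B})] = \frac{m!(q^{m - \ell} - q)}{q^m - q} + \frac{q^m - q^{m-\ell}}{(q^m - q)\binom{q-1}{m}} \sum_{d \mid \gcd(q - 1, m)} \varphi(d) \binom{(q-1)/d}{m/d}. \]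
   Context: $\mathbb{F}_q$ is the finite field with $q$ elements. $\mathbb{F}_q^{a \times b, r}$ denotes the set of $a\times b$ matrices over $\mathbb{F}_q$ of rank exactly $r$, and $\mathbb{F}_q^{\star a \times b, r}$ the subset of those whose $a$ rows are nonzero and pairwise distinct (so $\mathbb{F}_q^{\star m\times 1,1}$ is the set of column vectors of length $m$ with pairwise distinct nonzero entries). $\mathbb{S}_m$ is the symmetric group on $\{1,\dots,m\}$; for $\pi\in\mathbb{S}_m$, $\bm{\pi}$ is the $m\times m$ permutation matrix with $(i,j)$ entry $\delta_{\pi(i),j}$. $N_{\mathsf{sol}}(\bm{A},\bm{B})$ is the number of $\rho\in\mathbb{S}_m$ with $\bm{A}\bm{\rho}\bm{B}=\bm{0}$. $\varphi$ is Euler's totient function and the sum runs over positive divisors $d$ of $\gcd(q-1,m)$. -}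

module Defs where

open import Data.Bool using (Bool; true; false; if_then_else_; _∧_; not)
open import Data.Nat as ℕ using (ℕ; zero; suc; _^_; _≤_)
open import Data.Nat.Primality using (Prime)
open import Data.Nat.GCD using (gcd)
open import Data.Nat.Divisibility using (_∣?_)
open import Data.Nat.Combinatorics using (_C_)
open import Data.Fin as Fin using (Fin)
open import Data.Fin.Properties using () renaming (_≟_ to _≟ᶠ_)
open import Data.List using (List; []; _∷_; [_]; map; concatMap; filter; length; foldr; allFin; upTo)
open import Data.Integer using (+_)
open import Data.Rational as ℚ using (ℚ; 0ℚ; _÷_; ≢-nonZero)
open import Data.Rational.Properties using () renaming (_≟_ to _≟ℚ_)
open import Data.Product using (Σ; ∃; _×_)
open import Relation.Nullary using (¬_; yes; no; ⌊_⌋)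
open import Relation.Binary.PropositionalEquality using (_≡_)
open import Algebra.Structures using (IsCommutativeRing)

IsPrimePower : ℕ → Set
IsPrimePower q = Σ ℕ λ p → Σ ℕ λ k → Prime p × (1 ≤ k) × (q ≡ p ^ k)

-- A finite field with q elements, with carrier (an enumeration) Fin q.
-- Every finite field with q elements is isomorphic to such a structure.

record FiniteField (q : ℕ) : Set where
  field
    _+_ _*_ : Fin q → Fin q → Fin q
    -_      : Fin q → Fin q
    0# 1#   : Fin q
    isCommutativeRing : IsCommutativeRing _≡_ _+_ _*_ -_ 0# 1#
    0≢1     : ¬ (0# ≡ 1#)
    inverse : ∀ x → ¬ (x ≡ 0#) → ∃ λ y → x * y ≡ 1#

all : ∀ {A : Set} → (A → Bool) → List A → Bool
all p = foldr (λ x b → p x ∧ b) true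

allFuns : ∀ {A : Set} (n : ℕ) → List A → List (Fin n → A)
allFuns zero    xs = [ (λ ()) ]
allFuns (suc n) xs =
  concatMap (λ x → map (λ f → λ { Fin.zero → x ; (Fin.suc i) → f i })
                       (allFuns n xs)) xs

isInjective : ∀ {m} → (Fin m → Fin m) → Bool
isInjective {m} σ =
  all (λ i → all (λ j → not ⌊ σ i ≟ᶠ σ j ⌋ Data.Bool.∨ ⌊ i ≟ᶠ j ⌋) (allFin m)) (allFin m)
  where import Data.Bool

Sym : (m : ℕ) → List (Fin m → Fin m)
Sym m = filter (λ σ → isInjective σ Data.Bool.≟ true) (allFuns m (allFin m))
  where import Data.Bool

module MatrixOps {q : ℕ} (F : FiniteField q) where
  open FiniteField F

  Matrix : ℕ → ℕ → Set
  Matrix a b = Fin a → Fin b → Fin q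

  allMatrices : (a b : ℕ) → List (Matrix a b)
  allMatrices a b = allFuns a (allFuns b (allFin q))

  sumF : (n : ℕ) → (Fin n → Fin q) → Fin q
  sumF zero    f = 0#
  sumF (suc n) f = f Fin.zero + sumF n (λ i → f (Fin.suc i))

  _·_ : ∀ {a b c} → Matrix a b → Matrix b c → Matrix a c
  _·_ {b = b} M N i k = sumF b (λ j → M i j * N j k)

  permMatrix : ∀ {m} → (Fin m → Fin m) → Matrix m m
  permMatrix π i j = if ⌊ π i ≟ᶠ j ⌋ then 1# else 0#

  isZero : Fin q → Bool
  isZero x = ⌊ x ≟ᶠ 0# ⌋

  isZeroMatrix : ∀ {a b} → Matrix a b → Bool
  isZeroMatrix {a} {b} M = all (λ i → all (λ j → isZero (M i j)) (allFin b)) (allFin a)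

  -- an a × b matrix has rank exactly a iff its a rows are linearly
  -- independent: every coefficient row vector c with c·M = 0 is zero
  hasFullRowRank : ∀ {a b} → Matrix a b → Bool
  hasFullRowRank {a} {b} M =
    all (λ c → not (isZeroMatrix (c · M)) Data.Bool.∨ isZeroMatrix c)
        (allMatrices 1 a)
    where import Data.Bool

  isStarColumn : ∀ {m} → Matrix m 1 → Bool
  isStarColumn {m} B =
    all (λ i → not (isZero (B i Fin.zero))) (allFin m) ∧
    all (λ i → all (λ j → not ⌊ B i Fin.zero ≟ᶠ B j Fin.zero ⌋ Data.Bool.∨ ⌊ i ≟ᶠ j ⌋)
                   (allFin m)) (allFin m)
    where import Data.Bool

  starColumns : (m : ℕ) → List (Matrix m 1)
  starColumns m = filter (λ B → isStarColumn B Data.Bool.≟ true) (allMatrices m 1)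
    where import Data.Bool

  Nsol : ∀ {ℓ m} → Matrix ℓ m → Matrix m 1 → ℕ
  Nsol {ℓ} {m} A B =
    length (filter (λ ρ → isZeroMatrix ((A · permMatrix ρ) · B) Data.Bool.≟ true) (Sym m))
    where import Data.Bool

  admissibleA : (ℓ m : ℕ) → (Fin m → Fin m) → Matrix m 1 → List (Matrix ℓ m)
  admissibleA ℓ m π B =
    filter (λ A → (hasFullRowRank A ∧ isZeroMatrix ((A · permMatrix π) · B)) Data.Bool.≟ true)
           (allMatrices ℓ m)
    where import Data.Bool

ℕtoℚ : ℕ → ℚ
ℕtoℚ n = + n ℚ./ 1

-- total division: p ÷' r = p / r if r ≠ 0, and 0 otherwise
-- (only ever applied to nonzero denominators in the statement)
_÷'_ : ℚ → ℚ → ℚ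
p ÷' r with r ≟ℚ 0ℚ
... | yes _  = 0ℚ
... | no r≢0 = _÷_ p r {{≢-nonZero r≢0}}

sumℚ : List ℚ → ℚ
sumℚ = foldr ℚ._+_ 0ℚ

average : ∀ {A : Set} → List A → (A → ℚ) → ℚ
average xs f = sumℚ (map f xs) ÷' ℕtoℚ (length xs)

expectedNsol : ∀ {q} → FiniteField q → (ℓ m : ℕ) → ℚ
expectedNsol F ℓ m =
  average (Sym m) λ π →
  average (starColumns m) λ B →
  average (admissibleA ℓ m π B) λ A →
  ℕtoℚ (Nsol A B)
  where open MatrixOps F

-- natural-number division, with n div 0 = 0 (only used for exact divisors)
_div_ : ℕ → ℕ → ℕ
n div zero    = 0
n div (suc k) = n ℕ./ suc k

divisors : ℕ → List ℕ
divisors n = filter (λ d → d ∣? n) (map suc (upTo n))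

totient : ℕ → ℕ
totient d = length (filter (λ k → gcd k d ℕ.≟ 1) (map suc (upTo d)))

rhs : (q ℓ m : ℕ) → ℚ
rhs q ℓ m =
  (ℕtoℚ (m ℕ.!) ℚ.* (ℕtoℚ (q ^ (m ℕ.∸ ℓ)) ℚ.- ℕtoℚ q)) ÷' (ℕtoℚ (q ^ m) ℚ.- ℕtoℚ q)
  ℚ.+
  ((ℕtoℚ (q ^ m) ℚ.- ℕtoℚ (q ^ (m ℕ.∸ ℓ)))
     ÷' ((ℕtoℚ (q ^ m) ℚ.- ℕtoℚ q) ℚ.* ℕtoℚ ((q ℕ.∸ 1) C m)))
  ℚ.* sumℚ (map (λ d → ℕtoℚ (totient d ℕ.* (((q ℕ.∸ 1) div d) C (m div d))))
                (divisors (gcd (q ℕ.∸ 1) m)))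

{-# OPTIONS --safe #-}
-- Fix π and B, put x = πB, and for each permutation ρ put y = ρB. If y is a multiple of x,
-- every admissible A kills y; otherwise the rows of A range over the independent ℓ-tuples
-- in {x,y}^⊥ rather than in x^⊥, and the quotient of the two counts ∏(q^(m−2) − q^i) and
-- ∏(q^(m−1) − q^i), i < ℓ, telescopes to (q^(m−ℓ) − q)/(q^m − q). Hence only the expected
-- number of ρ with ρB ∈ F*·πB matters. For λ ∈ F* a ρ with ρB = λπB exists, and is then
-- unique, iff the m-subset of entries of B is invariant under λ, and every m-subset comes
-- from m! columns. Since F* is cyclic of order n = q − 1, an element λ of order d leaves
-- invariant the unions of cosets of ⟨λ⟩, so C(n/d, m/d) subsets of size m if d ∣ m and none
-- otherwise; there are φ(d) such λ. Cyclicity follows from counting: at most φ(d) elements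
-- have order d, because x^d = 1 has at most d roots, while ∑_{d∣n} φ(d) = n.

module Submission where

open import Defs
open import Level using (0ℓ)
open import Algebra.Bundles using (CommutativeRing)
import Algebra.Properties.CommutativeMonoid.Sum
import Algebra.Properties.CommutativeSemigroup
import Algebra.Properties.CommutativeSemiring.Exp
import Algebra.Properties.Ring
open import Data.Bool as Bool using (Bool; true; false; not; _∨_; _∧_; if_then_else_)
open import Data.Fin as Fin using (Fin; toℕ)
open import Data.Fin.Permutation using (Permutation; permutation)
import Data.Fin.Properties as Finₚ
import Data.Integer as ℤ
import Data.Integer.Properties as ℤₚ
open import Data.List using (List; []; _∷_; _++_; map; concatMap; filter; length; allFin; upTo; tabulate; applyUpTo; replicate)
open import Data.List.Membership.Propositional using (_∈_)
open import Data.List.Membership.Propositional.Properties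
  using (∈-allFin; ∈-upTo⁺; ∈-upTo⁻; ∈-map⁺; ∈-map⁻; ∈-filter⁺; ∈-filter⁻)
open import Data.List.Properties using (map-tabulate; length-tabulate; length-map; length-upTo; length-replicate)
open import Data.List.Relation.Unary.Any using (here; there)
open import Data.Nat as ℕ using (ℕ; zero; suc; _+_; _*_; _^_; _∸_; _≤_; _<_; z≤n; s≤s; _!; NonZero)
open import Data.Nat.Combinatorics using (_C_; nCk+nC[k+1]≡[n+1]C[k+1]; nCk≡n!/k![n-k]!; k![n∸k]!∣n!)
open import Data.Nat.Divisibility
  using (_∣_; _∣?_; divides; ∣⇒≤; ∣-trans; ∣-refl; 0∣⇒≡0; ∣1⇒≡1; m%n≡0⇒n∣m)
open import Data.Nat.DivMod
  using (_%_; _/_; _mod_; m≡m%n+[m/n]*n; m%n<n; m<n⇒m%n≡m; [m+kn]%n≡m%n; m/n*n≡m; m*n/n≡m)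
open import Data.Nat.GCD using (gcd; gcd[m,n]∣m; gcd[m,n]∣n; gcd-greatest; c*gcd[m,n]≡gcd[cm,cn]; gcd-GCD; module Bézout)
open import Data.Nat.Induction using (<-rec)
open import Data.Nat.Properties
import Data.Nat.Solver
open import Data.Product using (∃; _×_; _,_; proj₁; proj₂)
open import Data.Rational as ℚ using (ℚ; 0ℚ; 1ℚ)
import Data.Rational.Properties as ℚₚ
import Data.Rational.Solver
import Data.Rational.Unnormalised as ℚᵘ
import Data.Rational.Unnormalised.Properties as ℚᵘₚ
open import Data.Sum using (inj₁; inj₂)
open import Data.Unit using (⊤; tt)
open import Data.Vec.Functional using () renaming (_∷_ to _◂_)
open import Function using (_∘_; mk⇔; Injective; id; const; case_of_)
open import Relation.Binary using (IsDecEquivalence)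
open import Relation.Binary.Definitions using (tri<; tri≈; tri>)
open import Relation.Binary.PropositionalEquality hiding (isDecEquivalence)
open import Relation.Nullary using (¬_; Dec; yes; no; does; ⌊_⌋; contradiction)
open import Relation.Nullary.Decidable using (_×-dec_; _→-dec_; ¬?; does-⇔; dec-true; dec-false; map′)

open Algebra.Properties.CommutativeSemigroup *-commutativeSemigroup
  using () renaming (x∙yz≈y∙xz to *-swapˡ)
open Algebra.Properties.CommutativeSemigroup +-commutativeSemigroup
  using () renaming (interchange to +-interchange)
open Bézout using (+-; -+)

-- The two summands come from one interpolation. Put D = q^m - q, U = q^(m-ℓ) - q and R = D - U =
-- q^m - q^(m-ℓ). A permutation ρ is a solution with probability 1 = (U + R)/D if ρB is proportional
-- to πB, and U/D otherwise. So for fixed π and B the expected count is m! U/D + (R/D) P, where P is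
-- the number of proportional ρ. Averaging P over the m! C(q-1, m) columns cancels the m! and leaves
-- the divisor sum divided by C(q-1, m), the same value for every π.
--
-- All counting is done with sums of 0/1 weights in ℕ, and proportions stay cross-multiplied until
-- the averages are taken. Bijections are replaced by double counting, and "injective between sets
-- of equal size, hence onto" becomes the principle that termwise ≤ with no smaller total forces
-- termwise equality. Linear algebra is done by counting as well: no basis of a subspace is ever
-- chosen, only the number of its elements and the size q^ℓ of the span of ℓ independent rows enter.

private variable
  A B : Set
  P Q : Set

-- Iverson brackets

opaque
  -- Kept opaque so that conversion checking compares brackets by their arguments and does not run
  -- the decision procedures inside them.
  ⟦_⟧ : Dec P → ℕ
  ⟦ p? ⟧ = if does p? then 1 else 0

  ⟦⟧-cong : (p? : Dec P) (q? : Dec Q) → (P → Q) → (Q → P) → ⟦ p? ⟧ ≡ ⟦ q? ⟧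
  ⟦⟧-cong p? q? f g = cong (if_then 1 else 0) (does-⇔ (mk⇔ f g) p? q?)

  ⟦⟧-yes : (p? : Dec P) → P → ⟦ p? ⟧ ≡ 1
  ⟦⟧-yes p? p = cong (if_then 1 else 0) (dec-true p? p)

  ⟦⟧-no : (p? : Dec P) → ¬ P → ⟦ p? ⟧ ≡ 0
  ⟦⟧-no p? ¬p = cong (if_then 1 else 0) (dec-false p? ¬p)

  ⟦⟧-× : (p? : Dec P) (q? : Dec Q) → ⟦ p? ×-dec q? ⟧ ≡ ⟦ p? ⟧ * ⟦ q? ⟧
  ⟦⟧-× (yes _) (yes _) = refl
  ⟦⟧-× (yes _) (no _)  = refl
  ⟦⟧-× (no _)  _       = refl

  ⟦⟧≢0 : (p? : Dec P) → ⟦ p? ⟧ ≢ 0 → P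
  ⟦⟧≢0 (yes p) _  = p
  ⟦⟧≢0 (no _)  ≢0 = contradiction refl ≢0

  -- Lets an equality that holds only under P be used inside a sum weighted by the bracket of P.
  ⟦⟧*-cong : (p? : Dec P) {a b : ℕ} → (P → a ≡ b) → ⟦ p? ⟧ * a ≡ ⟦ p? ⟧ * b
  ⟦⟧*-cong (yes p) a≡b = cong (1 *_) (a≡b p)
  ⟦⟧*-cong (no _)  _   = refl

  ⟦⟧-≤ : (p? : Dec P) (q? : Dec Q) → (P → Q) → ⟦ p? ⟧ ≤ ⟦ q? ⟧
  ⟦⟧-≤ (no _)  q? f = z≤n
  ⟦⟧-≤ (yes p) q? f = ≤-reflexive (sym (⟦⟧-yes q? (f p)))

-- Sums over lists

∑ : List A → (A → ℕ) → ℕ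
∑ []       f = 0
∑ (x ∷ xs) f = f x + ∑ xs f

∑-cong-∈ : ∀ (xs : List A) {f g} → (∀ {x} → x ∈ xs → f x ≡ g x) → ∑ xs f ≡ ∑ xs g
∑-cong-∈ []       f≡g = refl
∑-cong-∈ (x ∷ xs) f≡g = cong₂ _+_ (f≡g (here refl)) (∑-cong-∈ xs (f≡g ∘ there))

∑-cong : ∀ (xs : List A) {f g} → (∀ x → f x ≡ g x) → ∑ xs f ≡ ∑ xs g
∑-cong xs f≡g = ∑-cong-∈ xs (λ {x} _ → f≡g x)

∑-+ : ∀ (xs : List A) f g → ∑ xs (λ x → f x + g x) ≡ ∑ xs f + ∑ xs g
∑-+ []       f g = refl
∑-+ (x ∷ xs) f g = trans (cong (f x + g x +_) (∑-+ xs f g))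
                         (+-interchange (f x) (g x) (∑ xs f) (∑ xs g))

∑-*ˡ : ∀ (xs : List A) c f → ∑ xs (λ x → c * f x) ≡ c * ∑ xs f
∑-*ˡ []       c f = sym (*-zeroʳ c)
∑-*ˡ (x ∷ xs) c f = trans (cong (c * f x +_) (∑-*ˡ xs c f)) (sym (*-distribˡ-+ c (f x) (∑ xs f)))

∑-*ʳ : ∀ (xs : List A) c f → ∑ xs (λ x → f x * c) ≡ ∑ xs f * c
∑-*ʳ xs c f = trans (∑-cong xs (λ x → *-comm (f x) c)) (trans (∑-*ˡ xs c f) (*-comm c (∑ xs f)))

∑-const : ∀ (xs : List A) c → ∑ xs (const c) ≡ length xs * c
∑-const []       c = refl
∑-const (x ∷ xs) c = cong (c +_) (∑-const xs c)

∑-zero : ∀ (xs : List A) → ∑ xs (const 0) ≡ 0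
∑-zero xs = trans (∑-const xs 0) (*-zeroʳ (length xs))

∑-yes : ∀ (xs : List A) {P : A → Set} (P? : ∀ x → Dec (P x)) → (∀ x → P x) →
        ∑ xs (λ x → ⟦ P? x ⟧) ≡ length xs
∑-yes xs P? p = trans (∑-cong xs (λ x → ⟦⟧-yes (P? x) (p x)))
                      (trans (∑-const xs 1) (*-identityʳ (length xs)))

∑-no : ∀ (xs : List A) {P : A → Set} (P? : ∀ x → Dec (P x)) → (∀ x → ¬ P x) →
       ∑ xs (λ x → ⟦ P? x ⟧) ≡ 0
∑-no xs P? ¬p = trans (∑-cong xs (λ x → ⟦⟧-no (P? x) (¬p x))) (∑-zero xs)

∑-swap : ∀ (xs : List A) (ys : List B) (f : A → B → ℕ) →
         ∑ xs (λ x → ∑ ys (f x)) ≡ ∑ ys (λ y → ∑ xs (λ x → f x y))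
∑-swap []       ys f = sym (∑-zero ys)
∑-swap (x ∷ xs) ys f = trans (cong (∑ ys (f x) +_) (∑-swap xs ys f)) (sym (∑-+ ys (f x) _))

∑-mono-∈ : ∀ (xs : List A) {f g} → (∀ {x} → x ∈ xs → f x ≤ g x) → ∑ xs f ≤ ∑ xs g
∑-mono-∈ []       f≤g = z≤n
∑-mono-∈ (x ∷ xs) f≤g = +-mono-≤ (f≤g (here refl)) (∑-mono-∈ xs (f≤g ∘ there))

∑-mono : ∀ (xs : List A) {f g} → (∀ x → f x ≤ g x) → ∑ xs f ≤ ∑ xs g
∑-mono xs f≤g = ∑-mono-∈ xs (λ {x} _ → f≤g x)

-- A strict inequality at one place would make the totals strictly ordered. This is the rigidity
-- behind all later arguments by cardinality: surjectivity of injections, exhaustion of the roots of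
-- unity, and the exact number of elements of each order.
∑-≤-≡ : ∀ (xs : List A) {f g} → (∀ {x} → x ∈ xs → f x ≤ g x) → ∑ xs g ≤ ∑ xs f →
        ∀ {x} → x ∈ xs → f x ≡ g x
∑-≤-≡ (x ∷ xs) {f} {g} f≤g g≤f (here refl) = ≤-antisym (f≤g (here refl))
  (+-cancelʳ-≤ (∑ xs f) (g x) (f x) (≤-trans (+-monoʳ-≤ (g x) (∑-mono-∈ xs (f≤g ∘ there))) g≤f))
∑-≤-≡ (y ∷ xs) {f} {g} f≤g g≤f (there x∈xs) = ∑-≤-≡ xs (f≤g ∘ there)
  (+-cancelˡ-≤ (f y) _ _ (≤-trans (+-monoˡ-≤ (∑ xs g) (f≤g (here refl))) g≤f)) x∈xs

∑-++ : ∀ (xs ys : List A) f → ∑ (xs ++ ys) f ≡ ∑ xs f + ∑ ys f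
∑-++ []       ys f = refl
∑-++ (x ∷ xs) ys f = trans (cong (f x +_) (∑-++ xs ys f)) (sym (+-assoc (f x) _ _))

∑-map : ∀ (h : A → B) xs f → ∑ (map h xs) f ≡ ∑ xs (f ∘ h)
∑-map h []       f = refl
∑-map h (x ∷ xs) f = cong (f (h x) +_) (∑-map h xs f)

∑-concatMap : ∀ (h : A → List B) xs f → ∑ (concatMap h xs) f ≡ ∑ xs (λ x → ∑ (h x) f)
∑-concatMap h []       f = refl
∑-concatMap h (x ∷ xs) f =
  trans (∑-++ (h x) (concatMap h xs) f) (cong (∑ (h x) f +_) (∑-concatMap h xs f))

opaque
  unfolding ⟦_⟧

  ∑-filter : ∀ {P : A → Set} (P? : ∀ x → Dec (P x)) xs f →
             ∑ (filter P? xs) f ≡ ∑ xs (λ x → ⟦ P? x ⟧ * f x)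
  ∑-filter P? []       f = refl
  ∑-filter P? (x ∷ xs) f with P? x
  ... | yes _ = cong₂ _+_ (sym (*-identityˡ (f x))) (∑-filter P? xs f)
  ... | no _  = ∑-filter P? xs f

  length-filter-∑ : ∀ {P : A → Set} (P? : ∀ x → Dec (P x)) xs →
                    length (filter P? xs) ≡ ∑ xs (λ x → ⟦ P? x ⟧)
  length-filter-∑ P? []       = refl
  length-filter-∑ P? (x ∷ xs) with P? x
  ... | yes _ = cong suc (length-filter-∑ P? xs)
  ... | no _  = length-filter-∑ P? xs

∑≢0⇒∃ : ∀ (xs : List A) f → ∑ xs f ≢ 0 → ∃ λ x → x ∈ xs × f x ≢ 0
∑≢0⇒∃ []       f ≢0 = contradiction refl ≢0
∑≢0⇒∃ (x ∷ xs) f ≢0 with f x ℕ.≟ 0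
... | no fx≢0 = x , here refl , fx≢0
... | yes fx≡0 with ∑≢0⇒∃ xs f (λ s≡0 → ≢0 (cong₂ _+_ fx≡0 s≡0))
...   | y , y∈xs , fy≢0 = y , there y∈xs , fy≢0

-- A relation R under which every element carrying weight has exactly one
-- partner, of the same weight, identifies the two weighted sums.
double-counting : ∀ (xs : List A) (ys : List B) {R : A → B → Set}
  (R? : ∀ x y → Dec (R x y)) (h : A → ℕ) (k : B → ℕ) →
  (∀ {x} → x ∈ xs → h x ≢ 0 → ∑ ys (λ y → ⟦ R? x y ⟧) ≡ 1) →
  (∀ {y} → y ∈ ys → k y ≢ 0 → ∑ xs (λ x → ⟦ R? x y ⟧) ≡ 1) →
  (∀ {x y} → R x y → h x ≡ k y) →
  ∑ xs h ≡ ∑ ys k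
double-counting xs ys R? h k uniqueʳ uniqueˡ h≡k = begin
  ∑ xs h                                       ≡⟨ ∑-cong-∈ xs (λ {x} x∈ → sym (absorb (h x) (uniqueʳ x∈))) ⟩
  ∑ xs (λ x → h x * ∑ ys (λ y → ⟦ R? x y ⟧))   ≡⟨ ∑-cong xs (λ x → sym (∑-*ˡ ys (h x) _)) ⟩
  ∑ xs (λ x → ∑ ys (λ y → h x * ⟦ R? x y ⟧))   ≡⟨ ∑-swap xs ys _ ⟩
  ∑ ys (λ y → ∑ xs (λ x → h x * ⟦ R? x y ⟧))   ≡⟨ ∑-cong ys (λ y → ∑-cong xs (λ x → weights x y)) ⟩
  ∑ ys (λ y → ∑ xs (λ x → k y * ⟦ R? x y ⟧))   ≡⟨ ∑-cong ys (λ y → ∑-*ˡ xs (k y) _) ⟩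
  ∑ ys (λ y → k y * ∑ xs (λ x → ⟦ R? x y ⟧))   ≡⟨ ∑-cong-∈ ys (λ {y} y∈ → absorb (k y) (uniqueˡ y∈)) ⟩
  ∑ ys k                                       ∎
  where
  open ≡-Reasoning
  absorb : ∀ a {s} → (a ≢ 0 → s ≡ 1) → a * s ≡ a
  absorb zero    _   = refl
  absorb (suc a) s≡1 = trans (cong (suc a *_) (s≡1 (λ ()))) (*-identityʳ (suc a))
  weights : ∀ x y → h x * ⟦ R? x y ⟧ ≡ k y * ⟦ R? x y ⟧
  weights x y = trans (*-comm (h x) _) (trans (⟦⟧*-cong (R? x y) h≡k) (*-comm _ (k y)))

-- Finite enumerations up to an equivalence

-- Without function extensionality, functions can only be enumerated up to a
-- coarser equality than ≡, namely the pointwise one.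
record Enumeration (A : Set) : Set₁ where
  infix 4 _≈_
  field
    elements         : List A
    _≈_              : A → A → Set
    isDecEquivalence : IsDecEquivalence _≈_
  open IsDecEquivalence isDecEquivalence public
    renaming (refl to ≈-refl; sym to ≈-sym; trans to ≈-trans; _≟_ to _≈?_)
    using ()
  field
    occursOnce       : ∀ a → ∑ elements (λ x → ⟦ a ≈? x ⟧) ≡ 1

  complete : ∀ a → ∃ λ x → x ∈ elements × a ≈ x
  complete a with ∑≢0⇒∃ elements (λ x → ⟦ a ≈? x ⟧) (λ s≡0 → 1+n≢0 (trans (sym (occursOnce a)) s≡0))
  ... | x , x∈ , ≢0 = x , x∈ , ⟦⟧≢0 (a ≈? x) ≢0

  Respects : (A → Set) → Set
  Respects P = ∀ {x y} → x ≈ y → P x → P y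

  -- The list meets every ≈-class, so a predicate that respects ≈ has a witness exactly when its
  -- count over the list is nonzero.
  ∃? : ∀ {P : A → Set} → Respects P → (∀ x → Dec (P x)) → Dec (∃ P)
  ∃? {P} resp P? with ∑ elements (λ x → ⟦ P? x ⟧) ℕ.≟ 0
  ... | no ≢0  = let x , _ , x≢0 = ∑≢0⇒∃ elements _ ≢0 in yes (x , ⟦⟧≢0 (P? x) x≢0)
  ... | yes ≡0 = no λ (a , pa) → let x , x∈ , a≈x = complete a in
    1+n≢0 (trans (sym (⟦⟧-yes (P? x) (resp a≈x pa))) (zeros elements ≡0 x∈))
    where
    zeros : ∀ xs → ∑ xs (λ x → ⟦ P? x ⟧) ≡ 0 → ∀ {x} → x ∈ xs → ⟦ P? x ⟧ ≡ 0
    zeros (y ∷ ys) s≡0 (here refl)  = m+n≡0⇒m≡0 _ s≡0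
    zeros (y ∷ ys) s≡0 (there x∈ys) = zeros ys (m+n≡0⇒n≡0 ⟦ P? y ⟧ s≡0) x∈ys

  -- The usual way to supply the unique-partner hypotheses of `double-counting`.
  ∑-unique : ∀ {P : A → Set} (P? : ∀ x → Dec (P x)) → Respects P →
             ∀ a → P a → (∀ x → P x → a ≈ x) → ∑ elements (λ x → ⟦ P? x ⟧) ≡ 1
  ∑-unique P? resp a pa unique = trans
    (∑-cong elements (λ x → ⟦⟧-cong (P? x) (a ≈? x) (unique x) (λ a≈x → resp a≈x pa)))
    (occursOnce a)

open Enumeration using (elements)

∑ᴱ : Enumeration A → (A → ℕ) → ℕ
∑ᴱ E = ∑ (elements E)

∑-tabulate : ∀ {n} (g : Fin n → A) f → ∑ (tabulate g) f ≡ ∑ (allFin n) (f ∘ g)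
∑-tabulate {n = n} g f =
  trans (cong (λ xs → ∑ xs f) (sym (map-tabulate id g))) (∑-map g (allFin n) f)

∑-allFin-suc : ∀ n (f : Fin (suc n) → ℕ) →
               ∑ (allFin (suc n)) f ≡ f Fin.zero + ∑ (allFin n) (f ∘ Fin.suc)
∑-allFin-suc n f = cong (f Fin.zero +_) (∑-tabulate Fin.suc f)

length-allFin : ∀ n → length (allFin n) ≡ n
length-allFin n = length-tabulate id

finOccursOnce : ∀ n (i : Fin n) → ∑ (allFin n) (λ j → ⟦ i Finₚ.≟ j ⟧) ≡ 1
finOccursOnce (suc n) Fin.zero    = trans (∑-allFin-suc n (λ j → ⟦ Fin.zero Finₚ.≟ j ⟧))
  (cong₂ _+_ (⟦⟧-yes (Fin.zero {n} Finₚ.≟ Fin.zero) refl)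
    (trans (∑-cong (allFin n) (λ j → ⟦⟧-no (Fin.zero Finₚ.≟ Fin.suc j) λ ())) (∑-zero (allFin n))))
finOccursOnce (suc n) (Fin.suc i) = trans (∑-allFin-suc n (λ j → ⟦ Fin.suc i Finₚ.≟ j ⟧))
  (trans (cong₂ _+_ (⟦⟧-no (Fin.suc i Finₚ.≟ Fin.zero) λ ()) refl) (trans (∑-cong (allFin n) (λ j → ⟦⟧-cong (Fin.suc i Finₚ.≟ Fin.suc j) (i Finₚ.≟ j) Finₚ.suc-injective (cong Fin.suc)))
         (finOccursOnce n i)))

finEnum : ∀ n → Enumeration (Fin n)
finEnum n = record
  { elements = allFin n ; _≈_ = _≡_
  ; isDecEquivalence = record { isEquivalence = isEquivalence ; _≟_ = Finₚ._≟_ }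
  ; occursOnce = finOccursOnce n }

boolEnum : Enumeration Bool
boolEnum = record
  { elements = true ∷ false ∷ [] ; _≈_ = _≡_
  ; isDecEquivalence = record { isEquivalence = isEquivalence ; _≟_ = Bool._≟_ }
  ; occursOnce = λ
    { true  → cong₂ _+_ (⟦⟧-yes (true Bool.≟ true) refl) (cong (_+ 0) (⟦⟧-no (true Bool.≟ false) λ ()))
    ; false → cong₂ _+_ (⟦⟧-no (false Bool.≟ true) λ ()) (cong (_+ 0) (⟦⟧-yes (false Bool.≟ false) refl)) } }

-- `allFuns` extends a function by an anonymous pattern-matching function, which agrees with `x ◂ f`
-- only pointwise; hence the demand that the summand respect pointwise equality.
∑-allFuns-suc : ∀ (E : Enumeration A) n (h : (Fin (suc n) → A) → ℕ) →
  (∀ f g → (∀ i → Enumeration._≈_ E (f i) (g i)) → h f ≡ h g) →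
  ∑ (allFuns (suc n) (elements E)) h
    ≡ ∑ᴱ E (λ x → ∑ (allFuns n (elements E)) (λ f → h (x ◂ f)))
∑-allFuns-suc E n h resp =
  trans (∑-concatMap _ (elements E) h) (∑-cong (elements E) (λ x →
    trans (∑-map _ (allFuns n (elements E)) h)
          (∑-cong (allFuns n (elements E)) (λ f →
            resp _ _ (λ { Fin.zero → E.≈-refl ; (Fin.suc i) → E.≈-refl })))))
  where module E = Enumeration E

funEnum : ∀ n → Enumeration A → Enumeration (Fin n → A)
funEnum {A = A} n E = record
  { elements = allFuns n E.elements
  ; _≈_ = Pointwise
  ; isDecEquivalence = record
    { isEquivalence = record
      { refl = λ _ → E.≈-refl ; sym = λ p i → E.≈-sym (p i) ; trans = λ p q i → E.≈-trans (p i) (q i) }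
    ; _≟_ = pointwise? }
  ; occursOnce = once n }
  where
  module E = Enumeration E
  Pointwise : ∀ {n} → (Fin n → A) → (Fin n → A) → Set
  Pointwise f g = ∀ i → f i E.≈ g i
  pointwise? : ∀ {n} (f g : Fin n → A) → Dec (Pointwise f g)
  pointwise? f g = Finₚ.all? (λ i → f i E.≈? g i)
  once : ∀ n (f : Fin n → A) → ∑ (allFuns n E.elements) (λ g → ⟦ pointwise? f g ⟧) ≡ 1
  once zero    f = cong (_+ 0) (⟦⟧-yes (pointwise? f _) (λ ()))
  once (suc n) f = begin
    ∑ (allFuns (suc n) E.elements) (λ g → ⟦ pointwise? f g ⟧)
      ≡⟨ ∑-allFuns-suc E n _ (λ g h g≈h → ⟦⟧-cong (pointwise? f g) (pointwise? f h)
           (λ p i → E.≈-trans (p i) (g≈h i)) (λ p i → E.≈-trans (p i) (E.≈-sym (g≈h i)))) ⟩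
    ∑ E.elements (λ x → ∑ L (λ g → ⟦ pointwise? f (x ◂ g) ⟧))
      ≡⟨ ∑-cong E.elements (λ x → ∑-cong L (λ g → trans
           (⟦⟧-cong (pointwise? f (x ◂ g)) ((f Fin.zero E.≈? x) ×-dec pointwise? (f ∘ Fin.suc) g)
             (λ p → p Fin.zero , p ∘ Fin.suc) (λ { (p , _) Fin.zero → p ; (_ , p) (Fin.suc i) → p i }))
           (⟦⟧-× (f Fin.zero E.≈? x) (pointwise? (f ∘ Fin.suc) g)))) ⟩
    ∑ E.elements (λ x → ∑ L (λ g → ⟦ f Fin.zero E.≈? x ⟧ * ⟦ pointwise? (f ∘ Fin.suc) g ⟧))
      ≡⟨ ∑-cong E.elements (λ x → trans (∑-*ˡ L ⟦ f Fin.zero E.≈? x ⟧ _)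
           (trans (cong (⟦ f Fin.zero E.≈? x ⟧ *_) (once n (f ∘ Fin.suc))) (*-identityʳ _))) ⟩
    ∑ E.elements (λ x → ⟦ f Fin.zero E.≈? x ⟧)
      ≡⟨ E.occursOnce (f Fin.zero) ⟩
    1 ∎
    where
    open ≡-Reasoning
    L = allFuns n E.elements

length-allFuns : ∀ (E : Enumeration A) n → length (allFuns n (elements E)) ≡ length (elements E) ^ n
length-allFuns E zero    = refl
length-allFuns E (suc n) = begin
  length (allFuns (suc n) L)                  ≡⟨ sym (*-identityʳ _) ⟩
  length (allFuns (suc n) L) * 1              ≡⟨ sym (∑-const (allFuns (suc n) L) 1) ⟩
  ∑ (allFuns (suc n) L) (const 1)             ≡⟨ ∑-allFuns-suc E n (const 1) (λ _ _ _ → refl) ⟩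
  ∑ L (λ _ → ∑ (allFuns n L) (const 1))       ≡⟨ ∑-const L _ ⟩
  length L * ∑ (allFuns n L) (const 1)        ≡⟨ cong (length L *_) (trans (∑-const (allFuns n L) 1) (*-identityʳ _)) ⟩
  length L * length (allFuns n L)             ≡⟨ cong (length L *_) (length-allFuns E n) ⟩
  length L * length L ^ n                     ∎
  where
  open ≡-Reasoning
  L = elements E

-- Boolean predicates

all-true⁺ : ∀ {p : A → Bool} (xs : List A) → (∀ {x} → x ∈ xs → p x ≡ true) → all p xs ≡ true
all-true⁺ []       _  = refl
all-true⁺ {p = p} (x ∷ xs) ps = cong₂ _∧_ (ps (here refl)) (all-true⁺ {p = p} xs (ps ∘ there))

all-true⁻ : ∀ {p : A → Bool} (xs : List A) → all p xs ≡ true → ∀ {x} → x ∈ xs → p x ≡ true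
all-true⁻ {p = p} (x ∷ xs) eq x∈ with p x in px
all-true⁻ (x ∷ xs) eq (here refl) | true  = px
all-true⁻ {p = p} (x ∷ xs) eq (there x∈) | true  = all-true⁻ {p = p} xs eq x∈

⌊⌋-true⁺ : (p? : Dec P) → P → ⌊ p? ⌋ ≡ true
⌊⌋-true⁺ (yes _) _ = refl
⌊⌋-true⁺ (no ¬p) p = contradiction p ¬p

⌊⌋-true⁻ : (p? : Dec P) → ⌊ p? ⌋ ≡ true → P
⌊⌋-true⁻ (yes p) _ = p

implies-true⁺ : ∀ b c → (b ≡ true → c ≡ true) → not b ∨ c ≡ true
implies-true⁺ true  c f = f refl
implies-true⁺ false c f = refl

implies-true⁻ : ∀ b c → not b ∨ c ≡ true → b ≡ true → c ≡ true
implies-true⁻ true c eq _ = eq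

∧-true⁻ : ∀ b c → b ∧ c ≡ true → b ≡ true × c ≡ true
∧-true⁻ true c eq = refl , eq

⌊implies⌋-true⁺ : (p? : Dec P) (q? : Dec Q) → (P → Q) → not ⌊ p? ⌋ ∨ ⌊ q? ⌋ ≡ true
⌊implies⌋-true⁺ p? q? f =
  implies-true⁺ ⌊ p? ⌋ ⌊ q? ⌋ (λ eq → ⌊⌋-true⁺ q? (f (⌊⌋-true⁻ p? eq)))

⌊implies⌋-true⁻ : (p? : Dec P) (q? : Dec Q) → not ⌊ p? ⌋ ∨ ⌊ q? ⌋ ≡ true → P → Q
⌊implies⌋-true⁻ p? q? eq p = ⌊⌋-true⁻ q? (implies-true⁻ ⌊ p? ⌋ ⌊ q? ⌋ eq (⌊⌋-true⁺ p? p))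

isInjective⁺ : ∀ {m} {σ : Fin m → Fin m} → Injective _≡_ _≡_ σ → isInjective σ ≡ true
isInjective⁺ {m} {σ} inj = all-true⁺ (allFin m) λ {i} _ → all-true⁺ (allFin m) λ {j} _ →
  ⌊implies⌋-true⁺ (σ i Finₚ.≟ σ j) (i Finₚ.≟ j) inj

isInjective⁻ : ∀ {m} {σ : Fin m → Fin m} → isInjective σ ≡ true → Injective _≡_ _≡_ σ
isInjective⁻ {m} {σ} eq {i} {j} = ⌊implies⌋-true⁻ (σ i Finₚ.≟ σ j) (i Finₚ.≟ j)
  (all-true⁻ (allFin m) (all-true⁻ (allFin m) eq (∈-allFin i)) (∈-allFin j))

-- Injections and subsets

Inj : ∀ {m N} → (Fin m → Fin N) → Set
Inj f = ∀ i j → f i ≡ f j → i ≡ j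

inj? : ∀ {m N} (f : Fin m → Fin N) → Dec (Inj f)
inj? f = Finₚ.all? λ i → Finₚ.all? λ j → (f i Finₚ.≟ f j) →-dec (i Finₚ.≟ j)

Inj-resp : ∀ {m N} {f g : Fin m → Fin N} → f ≗ g → Inj f → Inj g
Inj-resp f≗g inj i j eq = inj i j (trans (f≗g i) (trans eq (sym (f≗g j))))

-- The falling factorial s(s-1)⋯(s-m+1); truncation produces a zero factor once m exceeds s.
falling : ℕ → ℕ → ℕ
falling s zero    = 1
falling s (suc m) = s * falling (s ∸ 1) m

falling-n-n : ∀ n → falling n n ≡ n !
falling-n-n zero    = refl
falling-n-n (suc n) = cong (suc n *_) (falling-n-n n)

falling*! : ∀ {n m} → m ≤ n → falling n m * (n ∸ m) ! ≡ n !
falling*! {n} z≤n = +-identityʳ (n !)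
falling*! {suc n} {suc m} (s≤s m≤n) =
  trans (*-assoc (suc n) (falling n m) _) (cong (suc n *_) (falling*! m≤n))

falling≡!*C : ∀ {n m} → m ≤ n → falling n m ≡ m ! * (n C m)
falling≡!*C {n} {m} m≤n = *-cancelʳ-≡ _ _ ((n ∸ m) !) (begin
  falling n m * (n ∸ m) !                    ≡⟨ falling*! m≤n ⟩
  n !                                        ≡⟨ sym (m/n*n≡m (k![n∸k]!∣n! m≤n)) ⟩
  (n ! ℕ./ (m ! * (n ∸ m) !)) * (m ! * (n ∸ m) !)
                                             ≡⟨ cong (_* (m ! * (n ∸ m) !)) (sym (nCk≡n!/k![n-k]! m≤n)) ⟩
  (n C m) * (m ! * (n ∸ m) !)                ≡⟨ sym (*-assoc (n C m) _ _) ⟩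
  (n C m) * m ! * (n ∸ m) !                  ≡⟨ cong (_* (n ∸ m) !) (*-comm (n C m) _) ⟩
  m ! * (n C m) * (n ∸ m) !                  ∎)
  where
  open ≡-Reasoning
  instance
    _ = (n ∸ m) !≢0
    _ = m !* (n ∸ m) !≢0

falling≢0 : ∀ {n m} → m ≤ n → falling n m ≢ 0
falling≢0 {n} {m} m≤n ≡0 = ℕ.≢-nonZero⁻¹ (n !) {{n !≢0}}
  (trans (sym (falling*! m≤n)) (cong (_* (n ∸ m) !) ≡0))

-- Once the first value x is chosen in S, the remaining ones form an injection into S without x. The
-- target must therefore be an arbitrary decidable predicate for the induction to go through.
∑-injections : ∀ {N} m {S : Fin N → Set} (S? : ∀ j → Dec (S j)) →
  ∑ (allFuns m (allFin N)) (λ f → ⟦ inj? f ×-dec Finₚ.all? (λ i → S? (f i)) ⟧)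
    ≡ falling (∑ (allFin N) (λ j → ⟦ S? j ⟧)) m
∑-injections {N} zero S? = ∑-yes (allFuns 0 (allFin N))
  (λ f → inj? f ×-dec Finₚ.all? (λ i → S? (f i))) (λ _ → (λ ()) , λ ())
∑-injections {N} (suc m) {S} S? = begin
  ∑ (allFuns (suc m) (allFin N)) (λ f → ⟦ into? S? f ⟧)
    ≡⟨ ∑-allFuns-suc (finEnum N) m _ (λ f g f≗g → ⟦⟧-cong (into? S? f) (into? S? g)
         (λ { (inj , s) → Inj-resp f≗g inj , λ i → subst S (f≗g i) (s i) })
         (λ { (inj , s) → Inj-resp (sym ∘ f≗g) inj , λ i → subst S (sym (f≗g i)) (s i) })) ⟩
  ∑ (allFin N) (λ x → ∑ L (λ f → ⟦ into? S? (x ◂ f) ⟧))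
    ≡⟨ ∑-cong (allFin N) (λ x → ∑-cong L (λ f → trans
         (⟦⟧-cong (into? S? (x ◂ f)) (S? x ×-dec into? (S∖? x) f) (split x f) (unsplit x f))
         (⟦⟧-× (S? x) (into? (S∖? x) f)))) ⟩
  ∑ (allFin N) (λ x → ∑ L (λ f → ⟦ S? x ⟧ * ⟦ into? (S∖? x) f ⟧))
    ≡⟨ ∑-cong (allFin N) (λ x → trans (∑-*ˡ L ⟦ S? x ⟧ _) (trans
         (cong (⟦ S? x ⟧ *_) (∑-injections m (S∖? x)))
         (⟦⟧*-cong (S? x) (λ Sx → cong (λ s → falling s m) (card-∖ x Sx))))) ⟩
  ∑ (allFin N) (λ x → ⟦ S? x ⟧ * falling (card ∸ 1) m)
    ≡⟨ ∑-*ʳ (allFin N) (falling (card ∸ 1) m) _ ⟩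
  card * falling (card ∸ 1) m ∎
  where
  open ≡-Reasoning
  L    = allFuns m (allFin N)
  card = ∑ (allFin N) (λ j → ⟦ S? j ⟧)
  into? : ∀ {m} {S : Fin N → Set} (S? : ∀ j → Dec (S j)) (f : Fin m → Fin N) →
          Dec (Inj f × ∀ i → S (f i))
  into? S? f = inj? f ×-dec Finₚ.all? (λ i → S? (f i))
  S∖? : ∀ x j → Dec (S j × x ≢ j)
  S∖? x j = S? j ×-dec ¬? (x Finₚ.≟ j)
  split : ∀ x f → Inj (x ◂ f) × (∀ i → S ((x ◂ f) i)) → S x × Inj f × (∀ i → S (f i) × x ≢ f i)
  split x f (inj , s) = s Fin.zero
    , (λ i j eq → Finₚ.suc-injective (inj (Fin.suc i) (Fin.suc j) eq))
    , (λ i → s (Fin.suc i) , λ eq → Finₚ.0≢1+n (inj Fin.zero (Fin.suc i) eq))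
  unsplit : ∀ x f → S x × Inj f × (∀ i → S (f i) × x ≢ f i) → Inj (x ◂ f) × (∀ i → S ((x ◂ f) i))
  unsplit x f (sx , inj , s) = inj′ , λ { Fin.zero → sx ; (Fin.suc i) → proj₁ (s i) }
    where
    inj′ : Inj (x ◂ f)
    inj′ Fin.zero    Fin.zero    _  = refl
    inj′ Fin.zero    (Fin.suc j) eq = contradiction eq (proj₂ (s j))
    inj′ (Fin.suc i) Fin.zero    eq = contradiction (sym eq) (proj₂ (s i))
    inj′ (Fin.suc i) (Fin.suc j) eq = cong Fin.suc (inj i j eq)
  card-∖ : ∀ x → S x → ∑ (allFin N) (λ j → ⟦ S∖? x j ⟧) ≡ card ∸ 1
  card-∖ x Sx = sym (begin
    card ∸ 1
      ≡⟨ cong (_∸ 1) (∑-cong (allFin N) pointwise) ⟩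
    ∑ (allFin N) (λ j → ⟦ S∖? x j ⟧ + ⟦ x Finₚ.≟ j ⟧) ∸ 1
      ≡⟨ cong (_∸ 1) (trans (∑-+ (allFin N) _ _) (cong (c +_) (finOccursOnce N x))) ⟩
    c + 1 ∸ 1
      ≡⟨ m+n∸n≡m c 1 ⟩
    c ∎)
    where
    c = ∑ (allFin N) (λ j → ⟦ S∖? x j ⟧)
    pointwise : ∀ j → ⟦ S? j ⟧ ≡ ⟦ S∖? x j ⟧ + ⟦ x Finₚ.≟ j ⟧
    pointwise j with x Finₚ.≟ j in eq
    ... | yes refl = trans (⟦⟧-yes (S? j) Sx) (sym (cong₂ _+_
      (⟦⟧-no (S? x ×-dec ¬? (yes refl)) (λ (_ , x≢x) → x≢x refl)) (⟦⟧-yes (yes refl) refl)))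
    ... | no x≢j = trans (⟦⟧-cong (S? j) (S? j ×-dec ¬? (no x≢j)) (_, x≢j) proj₁)
      (trans (sym (+-identityʳ _)) (cong (⟦ S? j ×-dec ¬? (no x≢j) ⟧ +_) (sym (⟦⟧-no (no x≢j) x≢j))))

image? : ∀ {m N} (f : Fin m → Fin N) (j : Fin N) → Dec (∃ λ i → f i ≡ j)
image? f j = Finₚ.any? (λ i → f i Finₚ.≟ j)

∑-fibre : ∀ {m N} {f : Fin m → Fin N} → Inj f → ∀ j →
          ∑ (allFin m) (λ i → ⟦ f i Finₚ.≟ j ⟧) ≡ ⟦ image? f j ⟧
∑-fibre {m} {f = f} inj j with image? f j
... | yes (i , fi≡j) = trans (Enumeration.∑-unique (finEnum m) (λ i → f i Finₚ.≟ j)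
  (λ { refl eq → eq }) i fi≡j (λ i′ fi′≡j → inj i i′ (trans fi≡j (sym fi′≡j)))) (sym (⟦⟧-yes (yes (i , fi≡j)) (i , fi≡j)))
... | no ∄i = trans (∑-cong (allFin m) (λ i → ⟦⟧-no (f i Finₚ.≟ j) (λ eq → ∄i (i , eq))))
  (trans (∑-zero (allFin m)) (sym (⟦⟧-no (no ∄i) ∄i)))

∑-image : ∀ {m N} {f : Fin m → Fin N} → Inj f → ∑ (allFin N) (λ j → ⟦ image? f j ⟧) ≡ m
∑-image {m} {N} {f} inj = begin
  ∑ (allFin N) (λ j → ⟦ image? f j ⟧)                          ≡⟨ ∑-cong (allFin N) (sym ∘ ∑-fibre inj) ⟩
  ∑ (allFin N) (λ j → ∑ (allFin m) (λ i → ⟦ f i Finₚ.≟ j ⟧))   ≡⟨ ∑-swap (allFin N) (allFin m) _ ⟩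
  ∑ (allFin m) (λ i → ∑ (allFin N) (λ j → ⟦ f i Finₚ.≟ j ⟧))   ≡⟨ ∑-cong (allFin m) (λ i → finOccursOnce N (f i)) ⟩
  ∑ (allFin m) (const 1)                                       ≡⟨ ∑-const (allFin m) 1 ⟩
  length (allFin m) * 1                                        ≡⟨ trans (*-identityʳ _) (length-allFin m) ⟩
  m                                                            ∎
  where open ≡-Reasoning

-- The image lies inside S and already has m elements, so S has no room for anything else.
onto-by-cardinality : ∀ {m N} {f : Fin m → Fin N} → Inj f → {S : Fin N → Set} (S? : ∀ j → Dec (S j)) →
  (∀ i → S (f i)) → ∑ (allFin N) (λ j → ⟦ S? j ⟧) ≤ m → ∀ j → S j → ∃ λ i → f i ≡ j
onto-by-cardinality {m} {N} {f} inj {S} S? into card≤m j Sj =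
  ⟦⟧≢0 (image? f j) λ ≡0 → 1+n≢0 (trans (sym (⟦⟧-yes (S? j) Sj)) (trans (sym equal) ≡0))
  where
  equal : ⟦ image? f j ⟧ ≡ ⟦ S? j ⟧
  equal = ∑-≤-≡ (allFin N) {g = λ j → ⟦ S? j ⟧}
    (λ {j} _ → ⟦⟧-≤ (image? f j) (S? j) λ { (i , refl) → into i })
    (≤-trans card≤m (≤-reflexive (sym (∑-image inj)))) (∈-allFin j)

injective⇒surjective : ∀ {m} {σ : Fin m → Fin m} → Inj σ → ∀ j → ∃ λ i → σ i ≡ j
injective⇒surjective {m} inj j = onto-by-cardinality inj all⊤? (λ _ → tt)
  (≤-reflexive (trans (∑-yes (allFin m) all⊤? (λ _ → tt)) (length-allFin m))) j tt
  where
  all⊤? : Fin m → Dec ⊤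
  all⊤? _ = yes tt

-- Subsets of a finite set

Subset : ℕ → Set
Subset N = Fin N → Bool

subsets : ∀ N → Enumeration (Subset N)
subsets N = funEnum N boolEnum

∣_∣ : ∀ {N} → Subset N → ℕ
∣_∣ {N} S = ∑ (allFin N) (λ j → ⟦ S j Bool.≟ true ⟧)

∣∣-cong : ∀ {N} {S T : Subset N} → S ≗ T → ∣ S ∣ ≡ ∣ T ∣
∣∣-cong {N} S≗T = ∑-cong (allFin N) (λ j → cong (λ b → ⟦ b Bool.≟ true ⟧) (S≗T j))

image : ∀ {m N} → (Fin m → Fin N) → Subset N
image f j = does (image? f j)

image⁺ : ∀ {m N} (f : Fin m → Fin N) i → image f (f i) ≡ true
image⁺ f i = dec-true (image? f (f i)) (i , refl)

image⁻ : ∀ {m N} (f : Fin m → Fin N) j → image f j ≡ true → ∃ λ i → f i ≡ j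
image⁻ f j eq with image? f j
... | yes p = p

∣image∣ : ∀ {m N} {f : Fin m → Fin N} → Inj f → ∣ image f ∣ ≡ m
∣image∣ {N = N} {f} inj = trans
  (∑-cong (allFin N) (λ j → ⟦⟧-cong (image f j Bool.≟ true) (image? f j) (image⁻ f j) (dec-true (image? f j))))
  (∑-image inj)

-- Every m-subset is the image of exactly m! injections.
∑-injections-by-image : ∀ {m N} {𝒫 : Subset N → Set} (𝒫? : ∀ S → Dec (𝒫 S)) →
  (∀ {S T} → S ≗ T → 𝒫 S → 𝒫 T) →
  ∑ (allFuns m (allFin N)) (λ f → ⟦ inj? f ×-dec 𝒫? (image f) ⟧)
    ≡ m ! * ∑ᴱ (subsets N) (λ S → ⟦ (∣ S ∣ ℕ.≟ m) ×-dec 𝒫? S ⟧)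
∑-injections-by-image {m} {N} {𝒫} 𝒫? resp = begin
  ∑ L (λ f → ⟦ inj? f ×-dec 𝒫? (image f) ⟧)
    -- Each f is charged to the one listed S that agrees with its image.
    ≡⟨ ∑-cong L (λ f → sym (trans (cong (⟦ inj? f ×-dec 𝒫? (image f) ⟧ *_) (E.occursOnce (image f))) (*-identityʳ _))) ⟩
  ∑ L (λ f → ⟦ inj? f ×-dec 𝒫? (image f) ⟧ * ∑ᴱ (subsets N) (λ S → ⟦ image f E.≈? S ⟧))
    ≡⟨ ∑-cong L (λ f → sym (∑-*ˡ E.elements ⟦ inj? f ×-dec 𝒫? (image f) ⟧ _)) ⟩
  ∑ L (λ f → ∑ E.elements (λ S → ⟦ inj? f ×-dec 𝒫? (image f) ⟧ * ⟦ image f E.≈? S ⟧))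
    ≡⟨ ∑-swap L E.elements _ ⟩
  ∑ E.elements (λ S → ∑ L (λ f → ⟦ inj? f ×-dec 𝒫? (image f) ⟧ * ⟦ image f E.≈? S ⟧))
    ≡⟨ ∑-cong E.elements (λ S → ∑-cong L (λ f → begin
         ⟦ inj? f ×-dec 𝒫? (image f) ⟧ * ⟦ image f E.≈? S ⟧
           ≡⟨ sym (⟦⟧-× (inj? f ×-dec 𝒫? (image f)) (image f E.≈? S)) ⟩
         ⟦ (inj? f ×-dec 𝒫? (image f)) ×-dec (image f E.≈? S) ⟧
           -- For S of size m, an injection has image S as soon as its values lie in S, which turns
           -- the fibre over S into a count of injections into S.
           ≡⟨ ⟦⟧-cong _ (good? S ×-dec into? S f) (forward S f) (backward S f) ⟩
         ⟦ good? S ×-dec into? S f ⟧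
           ≡⟨ ⟦⟧-× (good? S) (into? S f) ⟩
         ⟦ good? S ⟧ * ⟦ into? S f ⟧ ∎)) ⟩
  ∑ E.elements (λ S → ∑ L (λ f → ⟦ good? S ⟧ * ⟦ into? S f ⟧))
    ≡⟨ ∑-cong E.elements (λ S → trans (∑-*ˡ L ⟦ good? S ⟧ _)
         (trans (cong (⟦ good? S ⟧ *_) (∑-injections m (λ j → S j Bool.≟ true)))
         (⟦⟧*-cong (good? S) (λ (∣S∣≡m , _) → trans (cong (λ s → falling s m) ∣S∣≡m) (falling-n-n m))))) ⟩
  ∑ E.elements (λ S → ⟦ good? S ⟧ * m !)
    ≡⟨ trans (∑-*ʳ E.elements (m !) _) (*-comm _ (m !)) ⟩
  m ! * ∑ E.elements (λ S → ⟦ good? S ⟧) ∎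
  where
  open ≡-Reasoning
  module E = Enumeration (subsets N)
  L = allFuns m (allFin N)
  good? : ∀ S → Dec (∣ S ∣ ≡ m × 𝒫 S)
  good? S = (∣ S ∣ ℕ.≟ m) ×-dec 𝒫? S
  into? : ∀ S (f : Fin m → Fin N) → Dec (Inj f × ∀ i → S (f i) ≡ true)
  into? S f = inj? f ×-dec Finₚ.all? (λ i → S (f i) Bool.≟ true)
  forward : ∀ S f → (Inj f × 𝒫 (image f)) × image f ≗ S →
            (∣ S ∣ ≡ m × 𝒫 S) × Inj f × ∀ i → S (f i) ≡ true
  forward S f ((inj , p) , eq) = (trans (∣∣-cong (sym ∘ eq)) (∣image∣ inj) , resp eq p)
                               , inj , λ i → trans (sym (eq (f i))) (image⁺ f i)
  backward : ∀ S f → (∣ S ∣ ≡ m × 𝒫 S) × Inj f × (∀ i → S (f i) ≡ true) →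
             (Inj f × 𝒫 (image f)) × image f ≗ S
  backward S f ((∣S∣≡m , p) , inj , into) = (inj , resp (sym ∘ eq) p) , eq
    where
    eq : image f ≗ S
    eq j with S j in Sj
    ... | true = dec-true (image? f j) (onto-by-cardinality inj (λ j → S j Bool.≟ true) into
                   (≤-reflexive ∣S∣≡m) j Sj)
    ... | false = dec-false (image? f j) λ { (i , refl) → contradiction (trans (sym Sj) (into i)) λ () }

-- Splitting by membership of the first element reproduces Pascal's rule.
∑-subsets-of-size : ∀ N k → ∑ᴱ (subsets N) (λ S → ⟦ ∣ S ∣ ℕ.≟ k ⟧) ≡ N C k
∑-subsets-of-size zero    zero    = cong (_+ 0) (⟦⟧-yes (0 ℕ.≟ 0) refl)
∑-subsets-of-size zero    (suc k) = cong (_+ 0) (⟦⟧-no (0 ℕ.≟ suc k) λ ())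
∑-subsets-of-size (suc N) k       = begin
  ∑ᴱ (subsets (suc N)) (λ S → ⟦ ∣ S ∣ ℕ.≟ k ⟧)
    ≡⟨ ∑-allFuns-suc boolEnum N _ (λ S T S≗T → cong (λ s → ⟦ s ℕ.≟ k ⟧) (∣∣-cong S≗T)) ⟩
  ∑ L (λ S → ⟦ ∣ true ◂ S ∣ ℕ.≟ k ⟧) + (∑ L (λ S → ⟦ ∣ false ◂ S ∣ ℕ.≟ k ⟧) + 0)
    ≡⟨ cong₂ _+_ (∑-cong L (λ S → cong (λ s → ⟦ s ℕ.≟ k ⟧) (trans (∣◂∣ true S)
                   (cong (_+ ∣ S ∣) (⟦⟧-yes (true Bool.≟ true) refl)))))
                 (trans (+-identityʳ _) (∑-cong L (λ S → cong (λ s → ⟦ s ℕ.≟ k ⟧) (trans (∣◂∣ false S)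
                   (cong (_+ ∣ S ∣) (⟦⟧-no (false Bool.≟ true) λ ())))))) ⟩
  ∑ L (λ S → ⟦ suc ∣ S ∣ ℕ.≟ k ⟧) + ∑ L (λ S → ⟦ ∣ S ∣ ℕ.≟ k ⟧)
    ≡⟨ cong (∑ L (λ S → ⟦ suc ∣ S ∣ ℕ.≟ k ⟧) +_) (∑-subsets-of-size N k) ⟩
  ∑ L (λ S → ⟦ suc ∣ S ∣ ℕ.≟ k ⟧) + N C k
    ≡⟨ pascal k ⟩
  suc N C k ∎
  where
  open ≡-Reasoning
  L = elements (subsets N)
  ∣◂∣ : ∀ b (S : Subset N) → ∣ b ◂ S ∣ ≡ ⟦ b Bool.≟ true ⟧ + ∣ S ∣
  ∣◂∣ b S = ∑-allFin-suc N (λ j → ⟦ (b ◂ S) j Bool.≟ true ⟧)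
  pascal : ∀ k → ∑ L (λ S → ⟦ suc ∣ S ∣ ℕ.≟ k ⟧) + N C k ≡ suc N C k
  pascal zero    = cong (_+ 1) (∑-no L (λ S → suc ∣ S ∣ ℕ.≟ 0) (λ S ()))
  pascal (suc k) = trans (cong (_+ N C suc k) (trans
    (∑-cong L (λ S → ⟦⟧-cong (suc ∣ S ∣ ℕ.≟ suc k) (∣ S ∣ ℕ.≟ k) suc-injective (cong suc)))
    (∑-subsets-of-size N k))) (nCk+nC[k+1]≡[n+1]C[k+1] N k)

-- The list of permutations

∑-Sym : ∀ m (h : (Fin m → Fin m) → ℕ) →
        ∑ (Sym m) h ≡ ∑ (allFuns m (allFin m)) (λ σ → ⟦ inj? σ ⟧ * h σ)
∑-Sym m h = trans (∑-filter _ (allFuns m (allFin m)) h) (∑-cong (allFuns m (allFin m)) (λ σ →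
  cong (_* h σ) (⟦⟧-cong (isInjective σ Bool.≟ true) (inj? σ)
    (λ eq i j → isInjective⁻ eq) (λ inj → isInjective⁺ (λ {i} {j} → inj i j)))))

length-Sym : ∀ m → length (Sym m) ≡ m !
length-Sym m = begin
  length (Sym m)                                       ≡⟨ sym (trans (∑-const (Sym m) 1) (*-identityʳ _)) ⟩
  ∑ (Sym m) (const 1)                                  ≡⟨ ∑-Sym m (const 1) ⟩
  ∑ L (λ σ → ⟦ inj? σ ⟧ * 1)                           ≡⟨ ∑-cong L (λ σ → trans (*-identityʳ _)
                                                            (⟦⟧-cong (inj? σ) (inj? σ ×-dec Finₚ.all? all⊤?) (_, λ _ → tt) proj₁)) ⟩
  ∑ L (λ σ → ⟦ inj? σ ×-dec Finₚ.all? all⊤? ⟧)         ≡⟨ ∑-injections m all⊤? ⟩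
  falling (∑ (allFin m) (λ i → ⟦ all⊤? i ⟧)) m         ≡⟨ cong (λ s → falling s m) (trans (∑-yes (allFin m) all⊤? (λ _ → tt)) (length-allFin m)) ⟩
  falling m m                                          ≡⟨ falling-n-n m ⟩
  m !                                                  ∎
  where
  open ≡-Reasoning
  L = allFuns m (allFin m)
  all⊤? : Fin m → Dec ⊤
  all⊤? _ = yes tt

-- Injectivity of f forces ρ(i) to be the preimage of t(π(i)), so at most one ρ can work; that ρ is
-- injective because t and π are. It is applied with f the entries of B and t a scalar multiple of
-- them.
∑-Sym-matching : ∀ {m N} {f t : Fin m → Fin N} → Inj f → Inj t → ∀ {π} → Inj π →
  ∑ (Sym m) (λ ρ → ⟦ Finₚ.all? (λ i → f (ρ i) Finₚ.≟ t (π i)) ⟧)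
    ≡ ⟦ Finₚ.all? (λ i → image? f (t i)) ⟧
∑-Sym-matching {m} {f = f} {t} f-inj t-inj {π} π-inj =
  trans (∑-Sym m _) (trans (∑-cong L (λ ρ → sym (⟦⟧-× (inj? ρ) (Finₚ.all? _)))) (count (Finₚ.all? _)))
  where
  L = allFuns m (allFin m)
  match? : ∀ ρ → Dec (Inj ρ × ∀ i → f (ρ i) ≡ t (π i))
  match? ρ = inj? ρ ×-dec Finₚ.all? (λ i → f (ρ i) Finₚ.≟ t (π i))
  count : (im? : Dec (∀ i → ∃ λ j → f j ≡ t i)) → ∑ L (λ ρ → ⟦ match? ρ ⟧) ≡ ⟦ im? ⟧
  count (yes im) = trans (Enumeration.∑-unique (funEnum m (finEnum m)) match?
    (λ ρ≗σ (inj , eq) → Inj-resp ρ≗σ inj , λ i → trans (cong f (sym (ρ≗σ i))) (eq i))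
    (λ i → proj₁ (im (π i)))
    ((λ i j eq → π-inj i j (t-inj _ _ (trans (sym (proj₂ (im (π i)))) (trans (cong f eq) (proj₂ (im (π j)))))))
      , λ i → proj₂ (im (π i)))
    (λ ρ (_ , eq) i → f-inj _ _ (trans (proj₂ (im (π i))) (sym (eq i))))) (sym (⟦⟧-yes (yes im) im))
  -- A matching ρ only exhibits preimages of the t(π(j)); surjectivity of π makes these all the
  -- t(i).
  count (no ¬im) = trans (∑-no L match? (λ ρ (_ , eq) → ¬im λ i →
    let j , πj≡i = injective⇒surjective π-inj i in ρ j , trans (eq j) (cong t πj≡i)))
    (sym (⟦⟧-no (no ¬im) ¬im))

-- Linear algebra over F

-- The number of independent ℓ-tuples of vectors in a subspace with w elements;
-- the truncated subtraction makes it 0 once ℓ exceeds the dimension.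
frameCount : ℕ → ℕ → ℕ → ℕ
frameCount q w zero    = 1
frameCount q w (suc ℓ) = frameCount q w ℓ * (w ∸ q ^ ℓ)

-- Giving one factor q of q^ℓ to each factor q^k - q^i turns it into q^(k+1) - q^(i+1). Both sides
-- are then the product of q^(k+1) - q^i over i ≤ ℓ, with the factor i = 0 or the factor i = ℓ split
-- off.
frameCount-telescope : ∀ q k ℓ →
  q ^ ℓ * frameCount q (q ^ k) ℓ * (q ^ suc k ∸ 1) ≡ frameCount q (q ^ suc k) ℓ * (q ^ suc k ∸ q ^ ℓ)
frameCount-telescope q k zero    = refl
frameCount-telescope q k (suc ℓ) = begin
  q * q ^ ℓ * (f * d) * a                ≡⟨ solve 5 (λ q r f d a → q :* r :* (f :* d) :* a := r :* f :* a :* (q :* d)) refl q (q ^ ℓ) f d a ⟩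
  q ^ ℓ * f * a * (q * d)                ≡⟨ cong₂ _*_ (frameCount-telescope q k ℓ) (*-distribˡ-∸ q (q ^ k) (q ^ ℓ)) ⟩
  frameCount q (q ^ suc k) (suc ℓ) * (q ^ suc k ∸ q ^ suc ℓ) ∎
  where
  open ≡-Reasoning
  open Data.Nat.Solver.+-*-Solver using (solve; _:*_; _:=_)
  f = frameCount q (q ^ k) ℓ
  d = q ^ k ∸ q ^ ℓ
  a = q ^ suc k ∸ 1

-- With m = 2 + k this is the probability (q^(m-ℓ) - q)/(q^m - q), cross-multiplied to remain in ℕ.
-- It is the telescoped identity scaled by q, from which q^ℓ is cancelled. At ℓ = k + 1 both sides
-- vanish.
frameCount-ratio : ∀ q .{{_ : NonZero q}} k ℓ → ℓ ≤ suc k →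
  (q ^ (2 + k) ∸ q) * frameCount q (q ^ k) ℓ ≡ frameCount q (q ^ suc k) ℓ * (q ^ (2 + k ∸ ℓ) ∸ q)
frameCount-ratio q k ℓ ℓ≤k+1 = *-cancelˡ-≡ _ _ (q ^ ℓ) (begin
  q ^ ℓ * ((q ^ (2 + k) ∸ q) * f)               ≡⟨ cong (λ s → q ^ ℓ * (s * f)) (sym q*a) ⟩
  q ^ ℓ * (q * (q ^ suc k ∸ 1) * f)             ≡⟨ solve 4 (λ r q a f → r :* (q :* a :* f) := q :* (r :* f :* a)) refl (q ^ ℓ) q (q ^ suc k ∸ 1) f ⟩
  q * (q ^ ℓ * f * (q ^ suc k ∸ 1))             ≡⟨ cong (q *_) (frameCount-telescope q k ℓ) ⟩
  q * (g * (q ^ suc k ∸ q ^ ℓ))                 ≡⟨ *-swapˡ q g _ ⟩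
  g * (q * (q ^ suc k ∸ q ^ ℓ))                 ≡⟨ cong (g *_) (trans (*-distribˡ-∸ q (q ^ suc k) (q ^ ℓ)) q^) ⟩
  g * (q ^ ℓ * (q ^ (2 + k ∸ ℓ) ∸ q))           ≡⟨ *-swapˡ g (q ^ ℓ) _ ⟩
  q ^ ℓ * (g * (q ^ (2 + k ∸ ℓ) ∸ q))           ∎)
  where
  open ≡-Reasoning
  open Data.Nat.Solver.+-*-Solver using (solve; _:*_; _:=_)
  instance _ = m^n≢0 q ℓ
  f = frameCount q (q ^ k) ℓ
  g = frameCount q (q ^ suc k) ℓ
  q*a : q * (q ^ suc k ∸ 1) ≡ q ^ (2 + k) ∸ q
  q*a = trans (*-distribˡ-∸ q (q ^ suc k) 1) (cong (q ^ (2 + k) ∸_) (*-identityʳ q))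
  q^ : q ^ (2 + k) ∸ q * q ^ ℓ ≡ q ^ ℓ * (q ^ (2 + k ∸ ℓ) ∸ q)
  q^ = sym (trans (*-distribˡ-∸ (q ^ ℓ) (q ^ (2 + k ∸ ℓ)) q) (cong₂ _∸_
    (trans (sym (^-distribˡ-+-* q ℓ (2 + k ∸ ℓ))) (cong (q ^_) (m+[n∸m]≡n (m≤n⇒m≤1+n ℓ≤k+1))))
    (*-comm (q ^ ℓ) q)))

frameCount≢0 : ∀ q → 2 ≤ q → ∀ k ℓ → ℓ ≤ k → frameCount q (q ^ k) ℓ ≢ 0
frameCount≢0 q 2≤q k zero    ℓ≤k = 1+n≢0
frameCount≢0 q 2≤q k (suc ℓ) ℓ<k eq with m*n≡0⇒m≡0∨n≡0 (frameCount q (q ^ k) ℓ) eq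
... | inj₁ ≡0 = frameCount≢0 q 2≤q k ℓ (<⇒≤ ℓ<k) ≡0
... | inj₂ ≡0 = <⇒≱ (^-monoʳ-< q 2≤q ℓ<k) (m∸n≡0⇒m≤n ≡0)

module FieldProperties {q : ℕ} (F : FiniteField q) where

  open FiniteField F public
    renaming (_+_ to infixl 6 _⊕_; _*_ to infixl 7 _⊗_; -_ to infix 8 ⊖_)
    using (0#; 1#; 0≢1; inverse; isCommutativeRing)
  open MatrixOps F public

  commutativeRing : CommutativeRing 0ℓ 0ℓ
  commutativeRing = record { isCommutativeRing = isCommutativeRing }

  module K = CommutativeRing commutativeRing
  module Kₚ = Algebra.Properties.Ring K.ring

  open Algebra.Properties.CommutativeSemigroup K.+-commutativeSemigroup public
    using () renaming (interchange to ⊕-interchange)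
  open Algebra.Properties.CommutativeSemigroup K.*-commutativeSemigroup public
    using () renaming (x∙yz≈y∙xz to ⊗-swapˡ)

  ⊗-cancelˡ-0 : ∀ {x y} → x ≢ 0# → x ⊗ y ≡ 0# → y ≡ 0#
  ⊗-cancelˡ-0 {x} {y} x≢0 xy≡0 = let x⁻¹ , xx⁻¹≡1 = inverse x x≢0 in begin
    y                ≡⟨ sym (K.*-identityˡ y) ⟩
    1# ⊗ y           ≡⟨ cong (_⊗ y) (trans (sym xx⁻¹≡1) (K.*-comm x x⁻¹)) ⟩
    x⁻¹ ⊗ x ⊗ y      ≡⟨ K.*-assoc x⁻¹ x y ⟩
    x⁻¹ ⊗ (x ⊗ y)    ≡⟨ cong (x⁻¹ ⊗_) xy≡0 ⟩
    x⁻¹ ⊗ 0#         ≡⟨ K.zeroʳ x⁻¹ ⟩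
    0#               ∎
    where open ≡-Reasoning

  x⊖y≡0⇒x≡y : ∀ {x y} → x ⊕ ⊖ y ≡ 0# → x ≡ y
  x⊖y≡0⇒x≡y {x} {y} eq = Kₚ.x∙y⁻¹≈ε⇒x≈y x y eq

  ⊗-cancelˡ : ∀ {x y z} → x ≢ 0# → x ⊗ y ≡ x ⊗ z → y ≡ z
  ⊗-cancelˡ {x} {y} {z} x≢0 eq = x⊖y≡0⇒x≡y (⊗-cancelˡ-0 x≢0 (begin
    x ⊗ (y ⊕ ⊖ z)         ≡⟨ K.distribˡ x y (⊖ z) ⟩
    x ⊗ y ⊕ x ⊗ ⊖ z       ≡⟨ cong₂ _⊕_ eq (sym (Kₚ.-‿distribʳ-* x z)) ⟩
    x ⊗ z ⊕ ⊖ (x ⊗ z)     ≡⟨ K.-‿inverseʳ (x ⊗ z) ⟩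
    0#                    ∎))
    where open ≡-Reasoning

  ⊗-cancelʳ : ∀ {x y z} → x ≢ 0# → y ⊗ x ≡ z ⊗ x → y ≡ z
  ⊗-cancelʳ {x} {y} {z} x≢0 eq = ⊗-cancelˡ x≢0 (trans (K.*-comm x y) (trans eq (K.*-comm z x)))

  [x⊖y]⊕y : ∀ x y → x ⊕ ⊖ y ⊕ y ≡ x
  [x⊖y]⊕y x y = trans (K.+-assoc x (⊖ y) y)
    (trans (cong (x ⊕_) (K.-‿inverseˡ y)) (K.+-identityʳ x))

  affine-solution : ∀ {u} → u ≢ 0# → ∀ c b →
                    ∑ (allFin q) (λ x → ⟦ (x ⊗ u ⊕ c) Finₚ.≟ b ⟧) ≡ 1
  affine-solution {u} u≢0 c b = Enumeration.∑-unique (finEnum q) (λ x → (x ⊗ u ⊕ c) Finₚ.≟ b)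
    (λ { refl eq → eq }) x₀ solves
    (λ x eq → ⊗-cancelʳ u≢0 (Kₚ.+-cancelʳ c _ _ (trans solves (sym eq))))
    where
    open ≡-Reasoning
    u⁻¹ = proj₁ (inverse u u≢0)
    x₀  = (b ⊕ ⊖ c) ⊗ u⁻¹
    solves : x₀ ⊗ u ⊕ c ≡ b
    solves = begin
      (b ⊕ ⊖ c) ⊗ u⁻¹ ⊗ u ⊕ c     ≡⟨ cong (_⊕ c) (K.*-assoc _ u⁻¹ u) ⟩
      (b ⊕ ⊖ c) ⊗ (u⁻¹ ⊗ u) ⊕ c   ≡⟨ cong (λ z → (b ⊕ ⊖ c) ⊗ z ⊕ c)
                                        (trans (K.*-comm u⁻¹ u) (proj₂ (inverse u u≢0))) ⟩
      (b ⊕ ⊖ c) ⊗ 1# ⊕ c          ≡⟨ cong (_⊕ c) (K.*-identityʳ _) ⟩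
      b ⊕ ⊖ c ⊕ c                 ≡⟨ [x⊖y]⊕y b c ⟩
      b                           ∎

  -- Finite sums, vectors and spans

  sumF-cong : ∀ n {f g : Fin n → Fin q} → f ≗ g → sumF n f ≡ sumF n g
  sumF-cong zero    f≗g = refl
  sumF-cong (suc n) f≗g = cong₂ _⊕_ (f≗g Fin.zero) (sumF-cong n (f≗g ∘ Fin.suc))

  sumF-zero : ∀ n → sumF n (const 0#) ≡ 0#
  sumF-zero zero    = refl
  sumF-zero (suc n) = trans (K.+-identityˡ _) (sumF-zero n)

  sumF-⊕ : ∀ n f g → sumF n (λ i → f i ⊕ g i) ≡ sumF n f ⊕ sumF n g
  sumF-⊕ zero    f g = sym (K.+-identityˡ 0#)
  sumF-⊕ (suc n) f g = trans (cong (f Fin.zero ⊕ g Fin.zero ⊕_) (sumF-⊕ n _ _))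
    (⊕-interchange (f Fin.zero) (g Fin.zero) _ _)

  sumF-⊗ˡ : ∀ n c f → sumF n (λ i → c ⊗ f i) ≡ c ⊗ sumF n f
  sumF-⊗ˡ zero    c f = sym (K.zeroʳ c)
  sumF-⊗ˡ (suc n) c f = trans (cong (c ⊗ f Fin.zero ⊕_) (sumF-⊗ˡ n c _)) (sym (K.distribˡ c _ _))

  sumF-⊗ʳ : ∀ n c f → sumF n (λ i → f i ⊗ c) ≡ sumF n f ⊗ c
  sumF-⊗ʳ n c f = trans (sumF-cong n (λ i → K.*-comm (f i) c))
    (trans (sumF-⊗ˡ n c f) (K.*-comm c _))

  sumF-swap : ∀ m n (f : Fin m → Fin n → Fin q) →
              sumF m (λ i → sumF n (f i)) ≡ sumF n (λ j → sumF m (λ i → f i j))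
  sumF-swap zero    n f = sym (sumF-zero n)
  sumF-swap (suc m) n f = trans (cong (sumF n (f Fin.zero) ⊕_) (sumF-swap m n (f ∘ Fin.suc)))
    (sym (sumF-⊕ n (f Fin.zero) _))

  sumF-select : ∀ n (i : Fin n) f → (∀ j → i ≢ j → f j ≡ 0#) → sumF n f ≡ f i
  sumF-select (suc n) Fin.zero    f off = trans
    (cong (f Fin.zero ⊕_) (trans (sumF-cong n (λ j → off (Fin.suc j) λ ())) (sumF-zero n)))
    (K.+-identityʳ _)
  sumF-select (suc n) (Fin.suc i) f off = trans
    (cong₂ _⊕_ (off Fin.zero λ ()) (sumF-select n i (f ∘ Fin.suc) (λ j i≢j → off (Fin.suc j) (i≢j ∘ Finₚ.suc-injective))))
    (K.+-identityˡ _)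

  Vector : ℕ → Set
  Vector n = Fin n → Fin q

  vectors : ∀ n → Enumeration (Vector n)
  vectors n = funEnum n (finEnum q)

  matrices : ∀ a b → Enumeration (Matrix a b)
  matrices a b = funEnum a (vectors b)

  length-vectors : ∀ n → length (elements (vectors n)) ≡ q ^ n
  length-vectors n = trans (length-allFuns (finEnum q) n) (cong (_^ n) (length-allFin q))

  dot : ∀ {n} → Vector n → Vector n → Fin q
  dot {n} v u = sumF n (λ j → v j ⊗ u j)

  comb : ∀ {ℓ m} → Vector ℓ → Matrix ℓ m → Vector m
  comb {ℓ} c A j = sumF ℓ (λ i → c i ⊗ A i j)

  dot-congˡ : ∀ {n} {v w : Vector n} u → v ≗ w → dot v u ≡ dot w u
  dot-congˡ {n} u v≗w = sumF-cong n (λ j → cong (_⊗ u j) (v≗w j))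

  dot-congʳ : ∀ {n} (v : Vector n) {u w} → u ≗ w → dot v u ≡ dot v w
  dot-congʳ {n} v u≗w = sumF-cong n (λ j → cong (v j ⊗_) (u≗w j))

  comb-cong : ∀ {ℓ m} {c d : Vector ℓ} {A B : Matrix ℓ m} → c ≗ d → (∀ i → A i ≗ B i) →
              comb c A ≗ comb d B
  comb-cong {ℓ} c≗d A≗B j = sumF-cong ℓ (λ i → cong₂ _⊗_ (c≗d i) (A≗B i j))

  dot-comb : ∀ {ℓ m} (c : Vector ℓ) (A : Matrix ℓ m) u →
             dot (comb c A) u ≡ sumF ℓ (λ i → c i ⊗ dot (A i) u)
  dot-comb {ℓ} {m} c A u = begin
    sumF m (λ j → sumF ℓ (λ i → c i ⊗ A i j) ⊗ u j)     ≡⟨ sumF-cong m (λ j → sym (sumF-⊗ʳ ℓ (u j) _)) ⟩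
    sumF m (λ j → sumF ℓ (λ i → c i ⊗ A i j ⊗ u j))     ≡⟨ sumF-swap m ℓ _ ⟩
    sumF ℓ (λ i → sumF m (λ j → c i ⊗ A i j ⊗ u j))     ≡⟨ sumF-cong ℓ (λ i → trans
                                                              (sumF-cong m (λ j → K.*-assoc (c i) (A i j) (u j)))
                                                              (sumF-⊗ˡ m (c i) _)) ⟩
    sumF ℓ (λ i → c i ⊗ dot (A i) u)                    ∎
    where open ≡-Reasoning

  dot-linearʳ : ∀ {n} (v x z : Vector n) t → dot v (λ j → t ⊗ x j ⊕ z j) ≡ t ⊗ dot v x ⊕ dot v z
  dot-linearʳ {n} v x z t = begin
    sumF n (λ j → v j ⊗ (t ⊗ x j ⊕ z j))                ≡⟨ sumF-cong n (λ j → trans (K.distribˡ (v j) _ _)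
                                                             (cong (_⊕ v j ⊗ z j) (⊗-swapˡ (v j) t (x j)))) ⟩
    sumF n (λ j → t ⊗ (v j ⊗ x j) ⊕ v j ⊗ z j)          ≡⟨ sumF-⊕ n _ _ ⟩
    sumF n (λ j → t ⊗ (v j ⊗ x j)) ⊕ dot v z            ≡⟨ cong (_⊕ dot v z) (sumF-⊗ˡ n t _) ⟩
    t ⊗ dot v x ⊕ dot v z                               ∎
    where open ≡-Reasoning

  isZeroMatrix⁺ : ∀ {a b} {M : Matrix a b} → (∀ i j → M i j ≡ 0#) → isZeroMatrix M ≡ true
  isZeroMatrix⁺ {a} {b} M≡0 = all-true⁺ (allFin a) λ {i} _ → all-true⁺ (allFin b) λ {j} _ →
    ⌊⌋-true⁺ (_ Finₚ.≟ 0#) (M≡0 i j)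

  isZeroMatrix⁻ : ∀ {a b} {M : Matrix a b} → isZeroMatrix M ≡ true → ∀ i j → M i j ≡ 0#
  isZeroMatrix⁻ {a} {b} {M} eq i j = ⌊⌋-true⁻ (M i j Finₚ.≟ 0#)
    (all-true⁻ (allFin b) (all-true⁻ (allFin a) eq (∈-allFin i)) (∈-allFin j))

  Independent : ∀ {ℓ m} → Matrix ℓ m → Set
  Independent A = ∀ c → (∀ j → comb c A j ≡ 0#) → ∀ i → c i ≡ 0#

  hasFullRowRank⁺ : ∀ {ℓ m} {A : Matrix ℓ m} → Independent A → hasFullRowRank A ≡ true
  hasFullRowRank⁺ {ℓ} {m} {A} ind = all-true⁺ (allMatrices 1 ℓ) λ {c} _ →
    implies-true⁺ (isZeroMatrix (c · A)) (isZeroMatrix c) λ cA≡0 →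
    isZeroMatrix⁺ {M = c} (λ { Fin.zero i → ind (c Fin.zero) (isZeroMatrix⁻ {M = c · A} cA≡0 Fin.zero) i })

  hasFullRowRank⁻ : ∀ {ℓ m} {A : Matrix ℓ m} → hasFullRowRank A ≡ true → Independent A
  hasFullRowRank⁻ {ℓ} {m} {A} full c cA≡0 i =
    -- The Boolean test ranges over listed matrices only, so c is replaced by a listed matrix that
    -- agrees with it pointwise.
    let c′ , c′∈ , c≈c′ = Enumeration.complete (matrices 1 ℓ) (const c)
        c′A≡0 = isZeroMatrix⁺ {M = c′ · A} λ { Fin.zero j →
          trans (comb-cong {A = A} {B = A} (sym ∘ c≈c′ Fin.zero) (λ _ _ → refl) j) (cA≡0 j) }
        c′≡0 = implies-true⁻ (isZeroMatrix (c′ · A)) (isZeroMatrix c′) (all-true⁻ (allMatrices 1 ℓ) full c′∈) c′A≡0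
    in trans (c≈c′ Fin.zero i) (isZeroMatrix⁻ {M = c′} c′≡0 Fin.zero i)

  independent? : ∀ {ℓ m} (A : Matrix ℓ m) → Dec (Independent A)
  independent? A = map′ hasFullRowRank⁻ hasFullRowRank⁺ (hasFullRowRank A Bool.≟ true)

  Independent-resp : ∀ {ℓ m} {A B : Matrix ℓ m} → (∀ i → A i ≗ B i) → Independent A → Independent B
  Independent-resp {A = A} {B} A≗B ind c cB≡0 =
    ind c (λ j → trans (comb-cong {A = A} {B = B} (λ _ → refl) A≗B j) (cB≡0 j))

  Span : ∀ {ℓ m} → Matrix ℓ m → Vector m → Set
  Span A v = ∃ λ c → comb c A ≗ v

  span? : ∀ {ℓ m} (A : Matrix ℓ m) v → Dec (Span A v)
  span? {ℓ} A v = Enumeration.∃? (vectors ℓ)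
    (λ c≗d eq j → trans (sym (comb-cong {A = A} {B = A} c≗d (λ _ _ → refl) j)) (eq j))
    (λ c → Finₚ.all? (λ j → comb c A j Finₚ.≟ v j))

  comb-injective : ∀ {ℓ m} {A : Matrix ℓ m} → Independent A → ∀ {c d} → comb c A ≗ comb d A → c ≗ d
  comb-injective {ℓ} {m} {A} ind {c} {d} eq i = x⊖y≡0⇒x≡y (ind (λ i → c i ⊕ ⊖ d i) vanish i)
    where
    open ≡-Reasoning
    vanish : ∀ j → comb (λ i → c i ⊕ ⊖ d i) A j ≡ 0#
    vanish j = Kₚ.+-cancelʳ (comb d A j) _ _ (begin
      comb (λ i → c i ⊕ ⊖ d i) A j ⊕ comb d A j             ≡⟨ sym (sumF-⊕ ℓ _ _) ⟩
      sumF ℓ (λ i → (c i ⊕ ⊖ d i) ⊗ A i j ⊕ d i ⊗ A i j)    ≡⟨ sumF-cong ℓ (λ i → trans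
                                                                 (sym (K.distribʳ (A i j) _ _))
                                                                 (cong (_⊗ A i j) ([x⊖y]⊕y (c i) (d i)))) ⟩
      comb c A j                                            ≡⟨ eq j ⟩
      comb d A j                                            ≡⟨ sym (K.+-identityˡ _) ⟩
      0# ⊕ comb d A j                                       ∎)

  -- Independence gives every vector of the span exactly one coefficient vector, and there are q^ℓ
  -- of these.
  ∑-span : ∀ {ℓ m} {A : Matrix ℓ m} → Independent A →
           ∑ (elements (vectors m)) (λ v → ⟦ span? A v ⟧) ≡ q ^ ℓ
  ∑-span {ℓ} {m} {A} ind = begin
    ∑ (elements (vectors m)) (λ v → ⟦ span? A v ⟧)   ≡⟨ double-counting (elements (vectors m)) (elements (vectors ℓ)) R?
                                                          (λ v → ⟦ span? A v ⟧) (const 1)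
                                                          (λ {v} _ ≢0 → unique-c v (⟦⟧≢0 (span? A v) ≢0))
                                                          (λ {c} _ _ → unique-v c)
                                                          (λ {v} {c} eq → ⟦⟧-yes (span? A v) (c , eq)) ⟩
    ∑ (elements (vectors ℓ)) (const 1)               ≡⟨ ∑-const (elements (vectors ℓ)) 1 ⟩
    length (elements (vectors ℓ)) * 1                ≡⟨ trans (*-identityʳ _) (length-vectors ℓ) ⟩
    q ^ ℓ                                            ∎
    where
    open ≡-Reasoning
    R? : ∀ v c → Dec (comb c A ≗ v)
    R? v c = Finₚ.all? (λ j → comb c A j Finₚ.≟ v j)
    unique-c : ∀ v → Span A v → ∑ (elements (vectors ℓ)) (λ c → ⟦ R? v c ⟧) ≡ 1
    unique-c v (c , cA≗v) = Enumeration.∑-unique (vectors ℓ) (R? v)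
      (λ c≗d eq j → trans (sym (comb-cong {A = A} {B = A} c≗d (λ _ _ → refl) j)) (eq j))
      c cA≗v (λ d dA≗v → comb-injective ind (λ j → trans (cA≗v j) (sym (dA≗v j))))
    unique-v : ∀ c → ∑ (elements (vectors m)) (λ v → ⟦ R? v c ⟧) ≡ 1
    unique-v c = Enumeration.∑-unique (vectors m) (λ v → R? v c)
      (λ v≗w eq j → trans (eq j) (v≗w j)) (comb c A) (λ _ → refl) (λ v eq → eq)

  independent-◂⁻ : ∀ {ℓ m} {v : Vector m} {A : Matrix ℓ m} → Independent (v ◂ A) → Independent A × ¬ Span A v
  independent-◂⁻ {ℓ} {m} {v} {A} ind = ind′ , ∉span
    where
    open ≡-Reasoning
    ind′ : Independent A
    ind′ c cA≡0 i = ind (0# ◂ c) (λ j → trans (cong₂ _⊕_ (K.zeroˡ (v j)) (cA≡0 j)) (K.+-identityˡ 0#)) (Fin.suc i)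
    ∉span : ¬ Span A v
    -- If v = cA, then (-1, c) is a vanishing combination of the extended rows, so -1 would be 0.
    ∉span (c , cA≗v) = 0≢1 (begin
      0#            ≡⟨ sym Kₚ.-0#≈0# ⟩
      ⊖ 0#          ≡⟨ cong ⊖_ (sym (ind ((⊖ 1#) ◂ c) vanish Fin.zero)) ⟩
      ⊖ (⊖ 1#)      ≡⟨ Kₚ.-‿involutive 1# ⟩
      1#            ∎)
      where
      vanish : ∀ j → ⊖ 1# ⊗ v j ⊕ comb c A j ≡ 0#
      vanish j = trans (cong₂ _⊕_ (Kₚ.-1*x≈-x (v j)) (cA≗v j)) (K.-‿inverseˡ (v j))

  independent-◂⁺ : ∀ {ℓ m} {v : Vector m} {A : Matrix ℓ m} → Independent A → ¬ Span A v → Independent (v ◂ A)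
  independent-◂⁺ {ℓ} {m} {v} {A} ind ∉span c cvA≡0 = c≡0
    where
    open ≡-Reasoning
    c₀ = c Fin.zero
    c₀≡0 : c₀ ≡ 0#
    c₀≡0 with c₀ Finₚ.≟ 0#
    ... | yes eq = eq
    -- A nonzero coefficient of v can be inverted, which solves the relation for v as a combination
    -- of the rows of A.
    ... | no c₀≢0 = contradiction ((λ i → (⊖ u) ⊗ c (Fin.suc i)) , spans) ∉span
      where
      u = proj₁ (inverse c₀ c₀≢0)
      spans : ∀ j → comb (λ i → (⊖ u) ⊗ c (Fin.suc i)) A j ≡ v j
      spans j = ⊗-cancelˡ c₀≢0 (begin
        c₀ ⊗ sumF ℓ (λ i → (⊖ u) ⊗ c (Fin.suc i) ⊗ A i j)    ≡⟨ cong (c₀ ⊗_) (trans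
                                                                (sumF-cong ℓ (λ i → K.*-assoc (⊖ u) _ _))
                                                                (sumF-⊗ˡ ℓ (⊖ u) _)) ⟩
        c₀ ⊗ ((⊖ u) ⊗ s)                                     ≡⟨ sym (K.*-assoc c₀ (⊖ u) s) ⟩
        c₀ ⊗ (⊖ u) ⊗ s                                       ≡⟨ cong (_⊗ s) (trans (sym (Kₚ.-‿distribʳ-* c₀ u))
                                                                 (cong ⊖_ (proj₂ (inverse c₀ c₀≢0)))) ⟩
        ⊖ 1# ⊗ s                                             ≡⟨ Kₚ.-1*x≈-x s ⟩
        ⊖ s                                                  ≡⟨ sym (Kₚ.+-inverseˡ-unique (c₀ ⊗ v j) s (cvA≡0 j)) ⟩
        c₀ ⊗ v j                                             ∎)
        where s = comb (c ∘ Fin.suc) A j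
    tail≡0 : ∀ i → c (Fin.suc i) ≡ 0#
    tail≡0 = ind (c ∘ Fin.suc) λ j → begin
      comb (c ∘ Fin.suc) A j                  ≡⟨ sym (K.+-identityˡ _) ⟩
      0# ⊕ comb (c ∘ Fin.suc) A j             ≡⟨ cong (_⊕ comb (c ∘ Fin.suc) A j) (sym (trans (cong (_⊗ v j) c₀≡0) (K.zeroˡ (v j)))) ⟩
      c₀ ⊗ v j ⊕ comb (c ∘ Fin.suc) A j       ≡⟨ cvA≡0 j ⟩
      0#                                      ∎
    c≡0 : ∀ i → c i ≡ 0#
    c≡0 Fin.zero    = c₀≡0
    c≡0 (Fin.suc i) = tail≡0 i

  -- W plays the role of a subspace. It is given by closure under combinations rather than by a
  -- basis, so the count of independent tuples can be applied directly to solution sets of one or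
  -- two linear equations; its dimension enters only through `∣W∣`.
  module _ {m} {W : Vector m → Set} (W? : ∀ v → Dec (W v))
    (W-resp : ∀ {v w} → v ≗ w → W v → W w)
    (W-comb : ∀ {ℓ} (c : Vector ℓ) A → (∀ i → W (A i)) → W (comb c A)) where

    frame? : ∀ {ℓ} (A : Matrix ℓ m) → Dec (Independent A × ∀ i → W (A i))
    frame? A = independent? A ×-dec Finₚ.all? (λ i → W? (A i))

    ∣W∣ : ℕ
    ∣W∣ = ∑ (elements (vectors m)) (λ v → ⟦ W? v ⟧)

    ∑-outside-span : ∀ {ℓ} {A : Matrix ℓ m} → Independent A × (∀ i → W (A i)) →
      ∑ (elements (vectors m)) (λ v → ⟦ W? v ×-dec ¬? (span? A v) ⟧) ≡ ∣W∣ ∸ q ^ ℓ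
    ∑-outside-span {ℓ} {A} (ind , A∈W) = sym (begin
      ∣W∣ ∸ q ^ ℓ
        ≡⟨ cong (_∸ q ^ ℓ) (trans (∑-cong V partition) (∑-+ V _ _)) ⟩
      outside + ∑ V (λ v → ⟦ span? A v ⟧) ∸ q ^ ℓ
        ≡⟨ cong (λ s → outside + s ∸ q ^ ℓ) (∑-span ind) ⟩
      outside + q ^ ℓ ∸ q ^ ℓ
        ≡⟨ m+n∸n≡m outside (q ^ ℓ) ⟩
      outside ∎)
      where
      open ≡-Reasoning
      V = elements (vectors m)
      outside = ∑ V (λ v → ⟦ W? v ×-dec ¬? (span? A v) ⟧)
      case : ∀ v (s? : Dec (Span A v)) → ⟦ W? v ⟧ ≡ ⟦ W? v ×-dec ¬? s? ⟧ + ⟦ s? ⟧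
      -- Closure under combinations puts the span inside W, so removing it removes exactly q^ℓ
      -- elements.
      case v s?@(yes (c , eq)) = trans (⟦⟧-yes (W? v) (W-resp eq (W-comb c A A∈W))) (sym (cong₂ _+_
        (⟦⟧-no (W? v ×-dec ¬? s?) (λ (_ , ∉s) → ∉s (c , eq))) (⟦⟧-yes s? (c , eq))))
      case v s?@(no ∉s) = trans (⟦⟧-cong (W? v) (W? v ×-dec ¬? s?) (_, ∉s) proj₁) (trans (sym (+-identityʳ _))
        (cong (⟦ W? v ×-dec ¬? s? ⟧ +_) (sym (⟦⟧-no s? ∉s))))
      partition : ∀ v → ⟦ W? v ⟧ ≡ ⟦ W? v ×-dec ¬? (span? A v) ⟧ + ⟦ span? A v ⟧
      partition v = case v (span? A v)

    ∑-frames : ∀ ℓ → ∑ (allMatrices ℓ m) (λ A → ⟦ frame? A ⟧) ≡ frameCount q ∣W∣ ℓ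
    ∑-frames zero    = ∑-yes (allMatrices 0 m) (λ A → frame? A) (λ A → (λ c _ ()) , λ ())
    ∑-frames (suc ℓ) = begin
      ∑ (allMatrices (suc ℓ) m) (λ A → ⟦ frame? A ⟧)
        ≡⟨ ∑-allFuns-suc (vectors m) ℓ _ (λ A B A≈B → ⟦⟧-cong (frame? A) (frame? B)
             (λ (ind , A∈W) → Independent-resp A≈B ind , λ i → W-resp (A≈B i) (A∈W i))
             (λ (ind , B∈W) → Independent-resp (λ i j → sym (A≈B i j)) ind , λ i → W-resp (λ j → sym (A≈B i j)) (B∈W i))) ⟩
      ∑ V (λ v → ∑ M (λ A → ⟦ frame? (v ◂ A) ⟧))
        -- The added row comes first in the enumeration but must be chosen last: it has to avoid the
        -- span of the other rows.
        ≡⟨ ∑-swap V M _ ⟩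
      ∑ M (λ A → ∑ V (λ v → ⟦ frame? (v ◂ A) ⟧))
        ≡⟨ ∑-cong M (λ A → ∑-cong V (λ v → trans
             (⟦⟧-cong (frame? (v ◂ A)) (frame? A ×-dec (W? v ×-dec ¬? (span? A v)))
               (λ (ind , vA∈W) → let ind′ , ∉s = independent-◂⁻ ind in
                  (ind′ , vA∈W ∘ Fin.suc) , vA∈W Fin.zero , ∉s)
               (λ ((ind , A∈W) , v∈W , ∉s) → independent-◂⁺ ind ∉s
                  , λ { Fin.zero → v∈W ; (Fin.suc i) → A∈W i }))
             (⟦⟧-× (frame? A) (W? v ×-dec ¬? (span? A v))))) ⟩
      ∑ M (λ A → ∑ V (λ v → ⟦ frame? A ⟧ * ⟦ W? v ×-dec ¬? (span? A v) ⟧))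
        ≡⟨ ∑-cong M (λ A → trans (∑-*ˡ V ⟦ frame? A ⟧ _) (⟦⟧*-cong (frame? A) ∑-outside-span)) ⟩
      ∑ M (λ A → ⟦ frame? A ⟧ * (∣W∣ ∸ q ^ ℓ))
        ≡⟨ ∑-*ʳ M (∣W∣ ∸ q ^ ℓ) _ ⟩
      ∑ M (λ A → ⟦ frame? A ⟧) * (∣W∣ ∸ q ^ ℓ)
        ≡⟨ cong (_* (∣W∣ ∸ q ^ ℓ)) (∑-frames ℓ) ⟩
      frameCount q ∣W∣ (suc ℓ) ∎
      where
      open ≡-Reasoning
      V = elements (vectors m)
      M = allMatrices ℓ m

  -- The equation can be solved for a coordinate at which u is nonzero, leaving the other n free.
  -- The right-hand side b is general because the search for that coordinate moves the term of each
  -- skipped one across.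
  ∑-hyperplane : ∀ n (u : Vector (suc n)) i → u i ≢ 0# → ∀ b →
                 ∑ (elements (vectors (suc n))) (λ v → ⟦ dot v u Finₚ.≟ b ⟧) ≡ q ^ n
  ∑-hyperplane n u i ui≢0 b = trans
    (∑-allFuns-suc (finEnum q) n _ (λ v w v≗w → cong (λ d → ⟦ d Finₚ.≟ b ⟧) (dot-congˡ u v≗w)))
    (slices n u i ui≢0)
    where
    open ≡-Reasoning
    slices : ∀ n (u : Vector (suc n)) i → u i ≢ 0# →
      ∑ (allFin q) (λ x → ∑ (elements (vectors n)) (λ v → ⟦ (x ⊗ u Fin.zero ⊕ dot v (u ∘ Fin.suc)) Finₚ.≟ b ⟧)) ≡ q ^ n
    slices n u Fin.zero u₀≢0 = begin
      ∑ (allFin q) (λ x → ∑ V (λ v → ⟦ (x ⊗ u Fin.zero ⊕ dot v (u ∘ Fin.suc)) Finₚ.≟ b ⟧))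
        ≡⟨ ∑-swap (allFin q) V _ ⟩
      ∑ V (λ v → ∑ (allFin q) (λ x → ⟦ (x ⊗ u Fin.zero ⊕ dot v (u ∘ Fin.suc)) Finₚ.≟ b ⟧))
        ≡⟨ ∑-cong V (λ v → affine-solution u₀≢0 _ b) ⟩
      ∑ V (const 1)
        ≡⟨ trans (∑-const V 1) (trans (*-identityʳ _) (length-vectors n)) ⟩
      q ^ n ∎
      where V = elements (vectors n)
    slices (suc n) u (Fin.suc i) ui≢0 = begin
      ∑ (allFin q) (λ x → ∑ V (λ v → ⟦ (x ⊗ u Fin.zero ⊕ dot v (u ∘ Fin.suc)) Finₚ.≟ b ⟧))
        ≡⟨ ∑-cong (allFin q) (λ x → trans (∑-cong V (λ v → ⟦⟧-cong (_ Finₚ.≟ b) (_ Finₚ.≟ (b ⊕ ⊖ (x ⊗ u Fin.zero)))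
             (λ eq → move (x ⊗ u Fin.zero) (dot v (u ∘ Fin.suc)) eq)
             (λ eq → trans (cong (x ⊗ u Fin.zero ⊕_) eq) (trans (K.+-comm _ _) ([x⊖y]⊕y b _)))))
             (∑-hyperplane n (u ∘ Fin.suc) i ui≢0 (b ⊕ ⊖ (x ⊗ u Fin.zero)))) ⟩
      ∑ (allFin q) (const (q ^ n))
        ≡⟨ trans (∑-const (allFin q) (q ^ n)) (cong (_* q ^ n) (length-allFin q)) ⟩
      q ^ suc n ∎
      where
      V = elements (vectors (suc n))
      move : ∀ a d → a ⊕ d ≡ b → d ≡ b ⊕ ⊖ a
      move a d eq = Kₚ.+-cancelʳ a _ _ (trans (K.+-comm d a) (trans eq (sym ([x⊖y]⊕y b a))))

  module _ {k} (x y : Vector (2 + k)) (x₀≢0 : x Fin.zero ≢ 0#)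
           (y∉⟨x⟩ : ∀ t → ¬ (∀ i → y i ≡ t ⊗ x i)) where

    private
      -- One step of Gaussian elimination: t = y₀/x₀ makes the first coordinate of y - t x vanish,
      -- and `z` is the rest of that vector. It is nonzero because y is no multiple of x.
      t : Fin q
      t = y Fin.zero ⊗ proj₁ (inverse (x Fin.zero) x₀≢0)

      tx₀≡y₀ : t ⊗ x Fin.zero ≡ y Fin.zero
      tx₀≡y₀ = trans (K.*-assoc _ _ _) (trans
        (cong (y Fin.zero ⊗_) (trans (K.*-comm _ _) (proj₂ (inverse (x Fin.zero) x₀≢0)))) (K.*-identityʳ _))

      z : Vector (suc k)
      z j = y (Fin.suc j) ⊕ ⊖ (t ⊗ x (Fin.suc j))

      tx+z : ∀ j → t ⊗ x (Fin.suc j) ⊕ z j ≡ y (Fin.suc j)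
      tx+z j = trans (K.+-comm _ _) ([x⊖y]⊕y _ _)

      z≢0 : ∃ λ j → z j ≢ 0#
      z≢0 = Finₚ.¬∀⟶∃¬ (suc k) (λ j → z j ≡ 0#) (λ j → z j Finₚ.≟ 0#) λ z≡0 →
        y∉⟨x⟩ t λ { Fin.zero → sym tx₀≡y₀ ; (Fin.suc j) → x⊖y≡0⇒x≡y (z≡0 j) }

      eliminate : ∀ a (v : Vector (suc k)) → dot (a ◂ v) y ≡ t ⊗ dot (a ◂ v) x ⊕ dot v z
      eliminate a v = begin
        a ⊗ y Fin.zero ⊕ dot v (y ∘ Fin.suc)
          ≡⟨ cong₂ _⊕_ (trans (cong (a ⊗_) (sym tx₀≡y₀)) (⊗-swapˡ a t _))
               (trans (dot-congʳ v (sym ∘ tx+z)) (dot-linearʳ v (x ∘ Fin.suc) z t)) ⟩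
        t ⊗ (a ⊗ x Fin.zero) ⊕ (t ⊗ dot v (x ∘ Fin.suc) ⊕ dot v z)
          ≡⟨ sym (K.+-assoc _ _ _) ⟩
        t ⊗ (a ⊗ x Fin.zero) ⊕ t ⊗ dot v (x ∘ Fin.suc) ⊕ dot v z
          ≡⟨ cong (_⊕ dot v z) (sym (K.distribˡ t _ _)) ⟩
        t ⊗ dot (a ◂ v) x ⊕ dot v z ∎
        where open ≡-Reasoning

    -- After elimination the two equations become triangular: one says that the tail v is orthogonal
    -- to `z`, the other then determines the head a, since x₀ ≠ 0.
    ∑-codimension-2 : ∑ (elements (vectors (2 + k))) (λ v → ⟦ (dot v x Finₚ.≟ 0#) ×-dec (dot v y Finₚ.≟ 0#) ⟧) ≡ q ^ k
    ∑-codimension-2 = begin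
      ∑ (elements (vectors (2 + k))) (λ v → ⟦ (dot v x Finₚ.≟ 0#) ×-dec (dot v y Finₚ.≟ 0#) ⟧)
        ≡⟨ ∑-allFuns-suc (finEnum q) (suc k) _ (λ v w v≗w → cong₂ (λ a b → ⟦ (a Finₚ.≟ 0#) ×-dec (b Finₚ.≟ 0#) ⟧)
             (dot-congˡ x v≗w) (dot-congˡ y v≗w)) ⟩
      ∑ (allFin q) (λ a → ∑ V (λ v → ⟦ (dot (a ◂ v) x Finₚ.≟ 0#) ×-dec (dot (a ◂ v) y Finₚ.≟ 0#) ⟧))
        ≡⟨ ∑-cong (allFin q) (λ a → ∑-cong V (λ v → trans
             (⟦⟧-cong _ ((dot v z Finₚ.≟ 0#) ×-dec (dot (a ◂ v) x Finₚ.≟ 0#))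
               (λ (ex , ey) → trans (sym (trans (cong (λ s → t ⊗ s ⊕ dot v z) ex) (trans (cong (_⊕ dot v z) (K.zeroʳ t)) (K.+-identityˡ _))))
                  (trans (sym (eliminate a v)) ey) , ex)
               (λ (ez , ex) → ex , trans (eliminate a v)
                  (trans (cong₂ (λ r s → t ⊗ r ⊕ s) ex ez) (trans (K.+-identityʳ _) (K.zeroʳ t)))))
             (⟦⟧-× (dot v z Finₚ.≟ 0#) (dot (a ◂ v) x Finₚ.≟ 0#)))) ⟩
      ∑ (allFin q) (λ a → ∑ V (λ v → ⟦ dot v z Finₚ.≟ 0# ⟧ * ⟦ dot (a ◂ v) x Finₚ.≟ 0# ⟧))
        ≡⟨ ∑-swap (allFin q) V _ ⟩
      ∑ V (λ v → ∑ (allFin q) (λ a → ⟦ dot v z Finₚ.≟ 0# ⟧ * ⟦ dot (a ◂ v) x Finₚ.≟ 0# ⟧))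
        ≡⟨ ∑-cong V (λ v → trans (∑-*ˡ (allFin q) ⟦ dot v z Finₚ.≟ 0# ⟧ _)
             (trans (cong (⟦ dot v z Finₚ.≟ 0# ⟧ *_) (affine-solution x₀≢0 _ 0#)) (*-identityʳ _))) ⟩
      ∑ V (λ v → ⟦ dot v z Finₚ.≟ 0# ⟧)
        ≡⟨ ∑-hyperplane k z (proj₁ z≢0) (proj₂ z≢0) 0# ⟩
      q ^ k ∎
      where
      open ≡-Reasoning
      V = elements (vectors (suc k))

  -- Matrices annihilating one or two vectors

  killed? : ∀ {ℓ m} (A : Matrix ℓ m) x → Dec (∀ i → dot (A i) x ≡ 0#)
  killed? A x = Finₚ.all? (λ i → dot (A i) x Finₚ.≟ 0#)

  dot-comb-0 : ∀ {ℓ m} (c : Vector ℓ) (A : Matrix ℓ m) x → (∀ i → dot (A i) x ≡ 0#) → dot (comb c A) x ≡ 0#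
  dot-comb-0 {ℓ} c A x Ax≡0 = trans (dot-comb c A x) (trans
    (sumF-cong ℓ (λ i → trans (cong (c i ⊗_) (Ax≡0 i)) (K.zeroʳ (c i)))) (sumF-zero ℓ))

  ∑-annihilators : ∀ ℓ {k} (x : Vector (suc k)) → x Fin.zero ≢ 0# →
    ∑ (allMatrices ℓ (suc k)) (λ A → ⟦ independent? A ×-dec killed? A x ⟧) ≡ frameCount q (q ^ k) ℓ
  ∑-annihilators ℓ {k} x x₀≢0 = trans
    (∑-frames (λ v → dot v x Finₚ.≟ 0#) (λ v≗w eq → trans (dot-congˡ x (sym ∘ v≗w)) eq)
              (λ c A → dot-comb-0 c A x) ℓ)
    (cong (λ w → frameCount q w ℓ) (∑-hyperplane k x Fin.zero x₀≢0 0#))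

  ∑-annihilators₂ : ∀ ℓ {k} (x y : Vector (2 + k)) → x Fin.zero ≢ 0# → (∀ t → ¬ (∀ i → y i ≡ t ⊗ x i)) →
    ∑ (allMatrices ℓ (2 + k)) (λ A → ⟦ (independent? A ×-dec killed? A x) ×-dec killed? A y ⟧)
      ≡ frameCount q (q ^ k) ℓ
  ∑-annihilators₂ ℓ {k} x y x₀≢0 y∉⟨x⟩ = trans
    (∑-cong (allMatrices ℓ (2 + k)) (λ A → ⟦⟧-cong _ (frame? W? W-resp W-comb A)
      (λ ((ind , Ax) , Ay) → ind , λ i → Ax i , Ay i)
      (λ (ind , Axy) → (ind , proj₁ ∘ Axy) , proj₂ ∘ Axy)))
    (trans (∑-frames W? W-resp W-comb ℓ)
      (cong (λ w → frameCount q w ℓ) (∑-codimension-2 x y x₀≢0 y∉⟨x⟩)))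
    where
    W : Vector (2 + k) → Set
    W v = dot v x ≡ 0# × dot v y ≡ 0#
    W? : ∀ v → Dec (W v)
    W? v = (dot v x Finₚ.≟ 0#) ×-dec (dot v y Finₚ.≟ 0#)
    W-resp : ∀ {v w} → v ≗ w → W v → W w
    W-resp v≗w (ex , ey) = trans (dot-congˡ x (sym ∘ v≗w)) ex , trans (dot-congˡ y (sym ∘ v≗w)) ey
    W-comb : ∀ {ℓ} (c : Vector ℓ) A → (∀ i → W (A i)) → W (comb c A)
    W-comb c A AW = dot-comb-0 c A x (proj₁ ∘ AW) , dot-comb-0 c A y (proj₂ ∘ AW)

  multiple? : ∀ {m} (x y : Vector m) t → Dec (∀ i → y i ≡ t ⊗ x i)
  multiple? x y t = Finₚ.all? (λ i → y i Finₚ.≟ (t ⊗ x i))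

  module _ ℓ {k} (x y : Vector (2 + k)) (x₀≢0 : x Fin.zero ≢ 0#) (ℓ≤k+1 : ℓ ≤ suc k) (1≤q : 1 ≤ q) where
    private
      instance _ = ℕ.>-nonZero 1≤q

      M : List (Matrix ℓ (2 + k))
      M = allMatrices ℓ (2 + k)

      D U R N scalars : ℕ
      D = q ^ (2 + k) ∸ q
      U = q ^ (2 + k ∸ ℓ) ∸ q
      R = q ^ (2 + k) ∸ q ^ (2 + k ∸ ℓ)
      N = frameCount q (q ^ suc k) ℓ
      scalars = ∑ (allFin q) (λ t → ⟦ multiple? x y t ⟧)

      q≤ : q ≤ q ^ (2 + k ∸ ℓ)
      q≤ = ≤-trans (≤-reflexive (sym (*-identityʳ q)))
        (^-monoʳ-≤ q (m<n⇒0<n∸m (s≤s ℓ≤k+1)))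

      U+R≡D : U + R ≡ D
      U+R≡D = begin
        U + R                                          ≡⟨ +-comm U R ⟩
        R + U                                          ≡⟨ sym (+-∸-assoc R q≤) ⟩
        R + q ^ (2 + k ∸ ℓ) ∸ q                        ≡⟨ cong (_∸ q) (m∸n+n≡m (^-monoʳ-≤ q (m∸n≤m (2 + k) ℓ))) ⟩
        D                                              ∎
        where open ≡-Reasoning

      both? : ∀ (A : Matrix ℓ (2 + k)) → Dec ((Independent A × (∀ i → dot (A i) x ≡ 0#)) × (∀ i → dot (A i) y ≡ 0#))
      both? A = (independent? A ×-dec killed? A x) ×-dec killed? A y

      nonmultiple : (∀ t → ¬ (∀ i → y i ≡ t ⊗ x i)) → D * ∑ M (λ A → ⟦ both? A ⟧) ≡ N * (U + R * scalars)
      nonmultiple ∄t = begin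
        D * ∑ M (λ A → ⟦ both? A ⟧)
          ≡⟨ cong (D *_) (∑-annihilators₂ ℓ x y x₀≢0 ∄t) ⟩
        D * frameCount q (q ^ k) ℓ
          ≡⟨ frameCount-ratio q k ℓ ℓ≤k+1 ⟩
        N * U
          ≡⟨ cong (N *_) (sym (trans (cong (λ s → U + R * s) (∑-no (allFin q) (multiple? x y) ∄t))
               (trans (cong (U +_) (*-zeroʳ R)) (+-identityʳ U)))) ⟩
        N * (U + R * scalars) ∎
        where open ≡-Reasoning

      multiple : ∀ t → (∀ i → y i ≡ t ⊗ x i) → D * ∑ M (λ A → ⟦ both? A ⟧) ≡ N * (U + R * scalars)
      multiple t y≡tx = begin
        D * ∑ M (λ A → ⟦ both? A ⟧)
          ≡⟨ cong (D *_) (trans (∑-cong M (λ A → ⟦⟧-cong (both? A) (independent? A ×-dec killed? A x) proj₁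
               (λ (ind , Ax) → (ind , Ax) , λ i → trans (Ay A i) (trans (cong (t ⊗_) (Ax i)) (K.zeroʳ t)))))
               (∑-annihilators ℓ x x₀≢0)) ⟩
        D * N
          ≡⟨ *-comm D N ⟩
        N * D
          ≡⟨ cong (N *_) (sym (trans (cong (λ s → U + R * s) one) (trans (cong (U +_) (*-identityʳ R)) U+R≡D))) ⟩
        N * (U + R * scalars) ∎
        where
        open ≡-Reasoning
        Ay : ∀ (A : Matrix ℓ (2 + k)) i → dot (A i) y ≡ t ⊗ dot (A i) x
        Ay A i = trans (sumF-cong (2 + k) (λ j → trans (cong (A i j ⊗_) (y≡tx j)) (⊗-swapˡ (A i j) t (x j))))
                       (sumF-⊗ˡ (2 + k) t (λ j → A i j ⊗ x j))
        one : scalars ≡ 1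
        one = Enumeration.∑-unique (finEnum q) (multiple? x y) (λ { refl eq → eq }) t y≡tx
          (λ s y≡sx → ⊗-cancelʳ x₀≢0 (trans (sym (y≡tx Fin.zero)) (y≡sx Fin.zero)))

    -- The last sum is 1 if y is a multiple of x and 0 otherwise, and U + R = D, so one formula
    -- covers both cases. Writing the indicator as a sum over scalars allows it to be exchanged
    -- later with the sum over permutations.
    ∑-annihilators-pair :
      (q ^ (2 + k) ∸ q) * ∑ (allMatrices ℓ (2 + k)) (λ A → ⟦ (independent? A ×-dec killed? A x) ×-dec killed? A y ⟧)
        ≡ frameCount q (q ^ suc k) ℓ *
          ((q ^ (2 + k ∸ ℓ) ∸ q) + (q ^ (2 + k) ∸ q ^ (2 + k ∸ ℓ)) * ∑ (allFin q) (λ t → ⟦ multiple? x y t ⟧))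
    ∑-annihilators-pair = case Finₚ.any? (multiple? x y) of λ
      { (yes (t , y≡tx)) → multiple t y≡tx ; (no ∄t) → nonmultiple (λ t eq → ∄t (t , eq)) }

-- Sums over divisors

-- The list that both `divisors` and `totient` filter.
range : ℕ → List ℕ
range n = map suc (upTo n)

∈-range⁺ : ∀ {n k} → 1 ≤ k → k ≤ n → k ∈ range n
∈-range⁺ (s≤s z≤n) k≤n = ∈-map⁺ suc (∈-upTo⁺ k≤n)

∈-range⁻ : ∀ {n k} → k ∈ range n → 1 ≤ k × k ≤ n
∈-range⁻ k∈ with ∈-map⁻ suc k∈
... | i , i∈ , refl = s≤s z≤n , ∈-upTo⁻ i∈

∑-applyUpTo : ∀ (g : ℕ → A) n f → ∑ (applyUpTo g n) f ≡ ∑ (allFin n) (f ∘ g ∘ toℕ)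
∑-applyUpTo g zero    f = refl
∑-applyUpTo g (suc n) f = trans (cong (f (g 0) +_) (∑-applyUpTo (g ∘ suc) n f)) (sym (∑-allFin-suc n (f ∘ g ∘ toℕ)))

∑-range : ∀ n f → ∑ (range n) f ≡ ∑ (allFin n) (f ∘ suc ∘ toℕ)
∑-range n f = trans (∑-map suc (upTo n) f) (∑-applyUpTo id n (f ∘ suc))

length-range : ∀ n → length (range n) ≡ n
length-range n = trans (length-map suc (upTo n)) (length-upTo n)

∑-range-δ : ∀ {n j} → 1 ≤ j → j ≤ n → ∑ (range n) (λ k → ⟦ k ℕ.≟ j ⟧) ≡ 1
∑-range-δ {n} {suc j} (s≤s z≤n) j<n = trans (∑-range n (λ k → ⟦ k ℕ.≟ suc j ⟧)) (trans
  (∑-cong (allFin n) (λ i → ⟦⟧-cong (suc (toℕ i) ℕ.≟ suc j) (Fin.fromℕ< j<n Finₚ.≟ i)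
    (λ eq → Finₚ.toℕ-injective (trans (Finₚ.toℕ-fromℕ< j<n) (sym (suc-injective eq))))
    (λ eq → cong suc (trans (cong toℕ (sym eq)) (Finₚ.toℕ-fromℕ< j<n)))))
  (finOccursOnce n (Fin.fromℕ< j<n)))

∑-range-unique : ∀ {n} {P : ℕ → Set} (P? : ∀ k → Dec (P k)) {j} → 1 ≤ j → j ≤ n → P j →
  (∀ {k} → k ∈ range n → P k → k ≡ j) → ∑ (range n) (λ k → ⟦ P? k ⟧) ≡ 1
∑-range-unique {n} {P} P? {j} 1≤j j≤n Pj unique = trans
  (∑-cong-∈ (range n) (λ {k} k∈ → ⟦⟧-cong (P? k) (k ℕ.≟ j) (unique k∈) (λ { refl → Pj })))
  (∑-range-δ 1≤j j≤n)

∑-divisors : ∀ n f → ∑ (divisors n) f ≡ ∑ (range n) (λ d → ⟦ d ∣? n ⟧ * f d)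
∑-divisors n f = ∑-filter (_∣? n) (range n) f

∈-divisors⁺ : ∀ {n d} → 1 ≤ n → d ∣ n → d ∈ divisors n
∈-divisors⁺ {suc n} {zero}  _ 0∣n = contradiction (sym (0∣⇒≡0 0∣n)) 0≢1+n
∈-divisors⁺ {suc n} {suc d} _ d∣n = ∈-filter⁺ (_∣? suc n) (∈-range⁺ (s≤s z≤n) (∣⇒≤ d∣n)) d∣n

∈-divisors⁻ : ∀ {n d} → d ∈ divisors n → 1 ≤ d × d ∣ n
∈-divisors⁻ {n} d∈ = let d∈range , d∣n = ∈-filter⁻ (_∣? n) {xs = range n} d∈ in proj₁ (∈-range⁻ d∈range) , d∣n

∑-divisors-unique : ∀ {n} {P : ℕ → Set} (P? : ∀ k → Dec (P k)) {j} → 1 ≤ n → j ∣ n → P j →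
  (∀ {k} → k ∈ divisors n → P k → k ≡ j) → ∑ (divisors n) (λ k → ⟦ P? k ⟧) ≡ 1
∑-divisors-unique {n} {P} P? {j} 1≤n j∣n Pj unique =
  trans (∑-divisors n (λ k → ⟦ P? k ⟧)) (trans
    (∑-cong (range n) (λ k → sym (⟦⟧-× (k ∣? n) (P? k))))
    (∑-range-unique (λ k → (k ∣? n) ×-dec P? k) (proj₁ j∈) (proj₂ j∈) (j∣n , Pj)
      (λ k∈ (k∣n , Pk) → unique (∈-divisors⁺ 1≤n k∣n) Pk)))
  where j∈ = ∈-range⁻ (proj₁ (∈-filter⁻ (_∣? n) {xs = range n} (∈-divisors⁺ 1≤n j∣n)))

totient-∑ : ∀ d → totient d ≡ ∑ (range d) (λ k → ⟦ gcd k d ℕ.≟ 1 ⟧)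
totient-∑ d = length-filter-∑ (λ k → gcd k d ℕ.≟ 1) (range d)

1≤*⇒1≤ʳ : ∀ a b → 1 ≤ a * b → 1 ≤ b
1≤*⇒1≤ʳ a zero    1≤ = contradiction (subst (1 ≤_) (*-zeroʳ a) 1≤) λ ()
1≤*⇒1≤ʳ a (suc b) _  = s≤s z≤n

1≤*⇒1≤ˡ : ∀ a b → 1 ≤ a * b → 1 ≤ a
1≤*⇒1≤ˡ a b 1≤ = 1≤*⇒1≤ʳ b a (subst (1 ≤_) (*-comm a b) 1≤)

-- The k with gcd(k,n) = e are the e·k′ with k′ coprime to d = n/e.
∑-gcd-fibre : ∀ {n d} → 1 ≤ n → d ∣ n → ∑ (range n) (λ k → ⟦ d * gcd k n ℕ.≟ n ⟧) ≡ totient d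
∑-gcd-fibre {n} {d} 1≤n (divides e n≡e*d) = trans
  (double-counting (range n) (range d) (λ k k′ → k ℕ.≟ e * k′)
    (λ k → ⟦ d * gcd k n ℕ.≟ n ⟧) (λ k′ → ⟦ gcd k′ d ℕ.≟ 1 ⟧)
    (λ {k} k∈ ≢0 → partner k∈ (⟦⟧≢0 (d * gcd k n ℕ.≟ n) ≢0))
    (λ {k′} k′∈ _ → let 1≤k′ , k′≤d = ∈-range⁻ k′∈ in
      ∑-range-δ (*-mono-≤ 1≤e 1≤k′) (≤-trans (*-monoʳ-≤ e k′≤d) (≤-reflexive (sym n≡e*d))))
    (λ {k} {k′} → weight k k′))
  (sym (totient-∑ d))
  where
  1≤e : 1 ≤ e
  1≤e = 1≤*⇒1≤ˡ e d (subst (1 ≤_) n≡e*d 1≤n)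
  1≤d : 1 ≤ d
  1≤d = 1≤*⇒1≤ʳ e d (subst (1 ≤_) n≡e*d 1≤n)
  instance
    _ = ℕ.>-nonZero 1≤e
    _ = ℕ.>-nonZero 1≤d
    _ = ℕ.>-nonZero 1≤n
  partner : ∀ {k} → k ∈ range n → d * gcd k n ≡ n → ∑ (range d) (λ k′ → ⟦ k ℕ.≟ e * k′ ⟧) ≡ 1
  partner {k} k∈ dg≡n with subst (_∣ k) (*-cancelˡ-≡ (gcd k n) e d (trans dg≡n (trans n≡e*d (*-comm e d)))) (gcd[m,n]∣m k n)
  ... | divides k′ refl = ∑-range-unique (λ k″ → k ℕ.≟ e * k″)
    (1≤*⇒1≤ˡ k′ e (proj₁ (∈-range⁻ k∈)))
    (*-cancelˡ-≤ e (≤-trans (≤-reflexive (*-comm e k′)) (≤-trans (proj₂ (∈-range⁻ k∈)) (≤-reflexive n≡e*d))))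
    (*-comm k′ e)
    (λ {k″} _ eq → *-cancelˡ-≡ k″ k′ e (trans (sym eq) (*-comm k′ e)))
  weight : ∀ k k′ → k ≡ e * k′ → ⟦ d * gcd k n ℕ.≟ n ⟧ ≡ ⟦ gcd k′ d ℕ.≟ 1 ⟧
  weight _ k′ refl = ⟦⟧-cong (d * gcd (e * k′) n ℕ.≟ n) (gcd k′ d ℕ.≟ 1)
    (λ eq → *-cancelˡ-≡ _ 1 n (trans (sym product) (trans eq (sym (*-identityʳ n)))))
    (λ eq → trans product (trans (cong (n *_) eq) (*-identityʳ n)))
    where
    open ≡-Reasoning
    product : d * gcd (e * k′) n ≡ n * gcd k′ d
    product = begin
      d * gcd (e * k′) n          ≡⟨ cong (λ s → d * gcd (e * k′) s) n≡e*d ⟩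
      d * gcd (e * k′) (e * d)    ≡⟨ cong (d *_) (sym (c*gcd[m,n]≡gcd[cm,cn] e k′ d)) ⟩
      d * (e * gcd k′ d)          ≡⟨ sym (*-assoc d e _) ⟩
      d * e * gcd k′ d            ≡⟨ cong (_* gcd k′ d) (trans (*-comm d e) (sym n≡e*d)) ⟩
      n * gcd k′ d                ∎

-- Every k belongs to exactly one class d = n/gcd(k, n), written without division, and the class of
-- d has φ(d) members. For a generator g of a cyclic group of order n, this d is the order of g^k.
∑-by-gcd : ∀ {n} → 1 ≤ n → (f h : ℕ → ℕ) →
  (∀ {k d} → k ∈ range n → d * gcd k n ≡ n → h k ≡ f d) →
  ∑ (range n) h ≡ ∑ (divisors n) (λ d → totient d * f d)
∑-by-gcd {n} 1≤n f h h≡f = begin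
  ∑ (range n) h
    ≡⟨ ∑-cong (range n) (λ k → sym (trans (cong (_* h k) (one k)) (*-identityˡ (h k)))) ⟩
  ∑ (range n) (λ k → ∑ (divisors n) (λ d → ⟦ has? d k ⟧) * h k)
    ≡⟨ ∑-cong-∈ (range n) (λ {k} k∈ → trans (sym (∑-*ʳ (divisors n) (h k) _))
         (∑-cong (divisors n) (λ d → ⟦⟧*-cong (has? d k) (h≡f k∈)))) ⟩
  ∑ (range n) (λ k → ∑ (divisors n) (λ d → ⟦ has? d k ⟧ * f d))
    ≡⟨ ∑-swap (range n) (divisors n) _ ⟩
  ∑ (divisors n) (λ d → ∑ (range n) (λ k → ⟦ has? d k ⟧ * f d))
    ≡⟨ ∑-cong-∈ (divisors n) (λ {d} d∈ → trans (∑-*ʳ (range n) (f d) _)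
         (cong (_* f d) (∑-gcd-fibre 1≤n (proj₂ (∈-divisors⁻ d∈))))) ⟩
  ∑ (divisors n) (λ d → totient d * f d) ∎
  where
  open ≡-Reasoning
  has? : ∀ d k → Dec (d * gcd k n ≡ n)
  has? d k = d * gcd k n ℕ.≟ n
  one : ∀ k → ∑ (divisors n) (λ d → ⟦ has? d k ⟧) ≡ 1
  one k with gcd[m,n]∣n k n
  ... | divides d n≡dg = ∑-divisors-unique (λ d → has? d k) 1≤n (divides (gcd k n) (trans n≡dg (*-comm d _))) (sym n≡dg)
    (λ {d′} _ eq → *-cancelʳ-≡ d′ d (gcd k n) (trans eq n≡dg))
    where instance _ = ℕ.>-nonZero (1≤*⇒1≤ʳ d (gcd k n) (subst (1 ≤_) n≡dg 1≤n))

∑-totient : ∀ {n} → 1 ≤ n → ∑ (divisors n) totient ≡ n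
∑-totient {n} 1≤n = begin
  ∑ (divisors n) totient                   ≡⟨ ∑-cong (divisors n) (λ d → sym (*-identityʳ (totient d))) ⟩
  ∑ (divisors n) (λ d → totient d * 1)     ≡⟨ sym (∑-by-gcd 1≤n (const 1) (const 1) (λ _ _ → refl)) ⟩
  ∑ (range n) (const 1)                    ≡⟨ ∑-const (range n) 1 ⟩
  length (range n) * 1                     ≡⟨ trans (*-identityʳ _) (length-range n) ⟩
  n                                        ∎
  where open ≡-Reasoning

-- Dividing both n and m is the same as dividing their gcd. The two lists are filtered from
-- different ranges, so they are matched by double counting instead of term by term.
∑-common-divisors : ∀ {n} m → 1 ≤ n → ∀ f →
  ∑ (divisors n) (λ d → ⟦ d ∣? m ⟧ * f d) ≡ ∑ (divisors (gcd n m)) f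
∑-common-divisors {n} m 1≤n f = trans (∑-divisors n _)
  (double-counting (range n) (divisors (gcd n m)) R? (λ d → ⟦ d ∣? n ⟧ * (⟦ d ∣? m ⟧ * f d)) f
    (λ {d} _ ≢0 → let d∣n = ⟦⟧≢0 (d ∣? n) (λ eq → ≢0 (cong (_* (⟦ d ∣? m ⟧ * f d)) eq))
                      d∣m = ⟦⟧≢0 (d ∣? m) (λ eq → ≢0 (trans (cong (λ s → ⟦ d ∣? n ⟧ * (s * f d)) eq) (*-zeroʳ ⟦ d ∣? n ⟧)))
                      d∣g = gcd-greatest d∣n d∣m
      in ∑-divisors-unique (R? d) 1≤g d∣g (d∣g , refl) (λ _ (_ , eq) → sym eq))
    (λ {d} d∈ _ → let 1≤d , d∣g = ∈-divisors⁻ d∈ in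
      ∑-range-unique (λ d′ → R? d′ d) 1≤d (∣⇒≤ (∣-trans d∣g (gcd[m,n]∣m n m))) (d∣g , refl) (λ _ (_ , eq) → eq))
    (λ { {d} (d∣g , refl) → trans
      (cong₂ _*_ (⟦⟧-yes (d ∣? n) (∣-trans d∣g (gcd[m,n]∣m n m)))
                 (cong (_* f d) (⟦⟧-yes (d ∣? m) (∣-trans d∣g (gcd[m,n]∣n n m)))))
      (trans (*-identityˡ _) (*-identityˡ (f d))) }))
  where
  instance _ = ℕ.>-nonZero 1≤n
  -- Divisibility is part of the relation because related elements must have equal weights, which
  -- requires both brackets to be 1.
  R? : ∀ d d′ → Dec (d ∣ gcd n m × d ≡ d′)
  R? d d′ = (d ∣? gcd n m) ×-dec (d ℕ.≟ d′)
  1≤g : 1 ≤ gcd n m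
  1≤g with gcd[m,n]∣m n m
  ... | divides c n≡cg = 1≤*⇒1≤ʳ c (gcd n m) (subst (1 ≤_) n≡cg 1≤n)

-- Cyclicity of the multiplicative group

least : ∀ {P : ℕ → Set} → (∀ k → Dec (P k)) → ∀ n → P n → ∃ λ d → P d × (∀ {k} → k < d → ¬ P k)
least {P} P? = <-rec (λ n → P n → ∃ λ d → P d × (∀ {k} → k < d → ¬ P k)) λ n rec Pn → case anyUpTo? P? n of λ
  { (yes (k , k<n , Pk)) → rec k<n Pk
  ; (no ∄k)              → n , Pn , λ {k} k<n Pk → ∄k (k , k<n , Pk) }

module Multiplicative {q : ℕ} (F : FiniteField q) where
  open FieldProperties F
  open Algebra.Properties.CommutativeSemiring.Exp K.commutativeSemiring public
    using () renaming (_^_ to infixr 8 _↑_; ^-homo-* to ↑-homo; ^-assocʳ to ↑-assoc)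
  private
    module Product = Algebra.Properties.CommutativeMonoid.Sum K.*-commutativeMonoid

  1≢0 : 1# ≢ 0#
  1≢0 = 0≢1 ∘ sym

  1↑ : ∀ k → 1# ↑ k ≡ 1#
  1↑ zero    = refl
  1↑ (suc k) = trans (K.*-identityˡ _) (1↑ k)

  ⊗≢0 : ∀ {x y} → x ≢ 0# → y ≢ 0# → x ⊗ y ≢ 0#
  ⊗≢0 x≢0 y≢0 xy≡0 = y≢0 (⊗-cancelˡ-0 x≢0 xy≡0)

  ↑≢0 : ∀ {x} → x ≢ 0# → ∀ k → x ↑ k ≢ 0#
  ↑≢0 x≢0 zero    = 1≢0
  ↑≢0 x≢0 (suc k) = ⊗≢0 x≢0 (↑≢0 x≢0 k)

  nonzero? : ∀ x → Dec (x ≢ 0#)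
  nonzero? x = ¬? (x Finₚ.≟ 0#)

  ∑-nonzero : ∑ (allFin q) (λ x → ⟦ nonzero? x ⟧) ≡ q ∸ 1
  ∑-nonzero = sym (begin
    q ∸ 1
      ≡⟨ cong (_∸ 1) (sym (trans (∑-const (allFin q) 1) (trans (*-identityʳ _) (length-allFin q)))) ⟩
    ∑ (allFin q) (const 1) ∸ 1
      ≡⟨ cong (_∸ 1) (trans (∑-cong (allFin q) (λ x → split x (x Finₚ.≟ 0#) (0# Finₚ.≟ x))) (∑-+ (allFin q) _ _)) ⟩
    ∑ (allFin q) (λ x → ⟦ nonzero? x ⟧) + ∑ (allFin q) (λ x → ⟦ 0# Finₚ.≟ x ⟧) ∸ 1
      ≡⟨ cong (λ s → ∑ (allFin q) (λ x → ⟦ nonzero? x ⟧) + s ∸ 1) (finOccursOnce q 0#) ⟩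
    ∑ (allFin q) (λ x → ⟦ nonzero? x ⟧) + 1 ∸ 1
      ≡⟨ m+n∸n≡m _ 1 ⟩
    ∑ (allFin q) (λ x → ⟦ nonzero? x ⟧) ∎)
    where
    open ≡-Reasoning
    split : ∀ x (d : Dec (x ≡ 0#)) (e : Dec (0# ≡ x)) → 1 ≡ ⟦ ¬? d ⟧ + ⟦ e ⟧
    split x d e with d
    ... | yes x≡0 = sym (cong₂ _+_ (⟦⟧-no (¬? (yes x≡0)) (λ x≢0 → x≢0 x≡0)) (⟦⟧-yes e (sym x≡0)))
    ... | no x≢0  = sym (cong₂ _+_ (⟦⟧-yes (¬? (no x≢0)) x≢0) (⟦⟧-no e (x≢0 ∘ sym)))

  private
    -- Puts the neutral factor 1 at y = 0, so that a product over the nonzero elements can run over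
    -- all of F and be permuted as such.
    orOne : Fin q → Fin q → Fin q
    orOne y x = if does (nonzero? y) then x else 1#

    orOne-nonzero : ∀ {y} x → y ≢ 0# → orOne y x ≡ x
    orOne-nonzero {y} x y≢0 = cong (if_then x else 1#) (dec-true (nonzero? y) y≢0)

    orOne-zero : ∀ x → orOne 0# x ≡ 1#
    orOne-zero x = cong (if_then x else 1#) (dec-false (nonzero? 0#) (λ 0≢0 → 0≢0 refl))

    product-orOne : ∀ k (f : Fin k → Fin q) x →
      Product.sum (λ i → orOne (f i) x) ≡ x ↑ ∑ (allFin k) (λ i → ⟦ nonzero? (f i) ⟧)
    product-orOne zero    f x = refl
    product-orOne (suc k) f x = trans
      (cong₂ _⊗_ (first (f Fin.zero) (f Fin.zero Finₚ.≟ 0#)) (product-orOne k (f ∘ Fin.suc) x))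
      (trans (sym (↑-homo x ⟦ nonzero? (f Fin.zero) ⟧ _))
             (cong (x ↑_) (sym (∑-allFin-suc k (λ i → ⟦ nonzero? (f i) ⟧)))))
      where
      first : ∀ y → Dec (y ≡ 0#) → orOne y x ≡ x ↑ ⟦ nonzero? y ⟧
      first y (yes refl) = trans (orOne-zero x) (cong (x ↑_) (sym (⟦⟧-no (nonzero? 0#) (λ 0≢0 → 0≢0 refl))))
      first y (no y≢0)   = trans (orOne-nonzero x y≢0) (trans (sym (K.*-identityʳ x))
        (cong (x ↑_) (sym (⟦⟧-yes (nonzero? y) y≢0))))

    product-nonzero : ∀ k (f : Fin k → Fin q) → Product.sum (λ i → orOne (f i) (f i)) ≢ 0#
    product-nonzero zero    f = 1≢0
    product-nonzero (suc k) f = ⊗≢0 (factor (f Fin.zero) (f Fin.zero Finₚ.≟ 0#)) (product-nonzero k (f ∘ Fin.suc))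
      where
      factor : ∀ y → Dec (y ≡ 0#) → orOne y y ≢ 0#
      factor y (yes refl) eq = 1≢0 (trans (sym (orOne-zero 0#)) eq)
      factor y (no y≢0)   eq = y≢0 (trans (sym (orOne-nonzero y y≢0)) eq)

  -- Multiplication by x permutes the nonzero elements, so it fixes their product.
  fermat : ∀ {x} → x ≢ 0# → x ↑ (q ∸ 1) ≡ 1#
  fermat {x} x≢0 = sym (⊗-cancelʳ (product-nonzero q id) (begin
    1# ⊗ Product.sum (λ y → orOne y y)
      ≡⟨ K.*-identityˡ _ ⟩
    Product.sum (λ y → orOne y y)
      ≡⟨ Product.sum-permute (λ y → orOne y y) scale ⟩
    Product.sum (λ y → orOne (x ⊗ y) (x ⊗ y))
      ≡⟨ Product.sum-cong-≗ (λ y → factor y (y Finₚ.≟ 0#)) ⟩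
    Product.sum (λ y → orOne y x ⊗ orOne y y)
      ≡⟨ Product.∑-distrib-+ (λ y → orOne y x) (λ y → orOne y y) ⟩
    Product.sum (λ y → orOne y x) ⊗ Product.sum (λ y → orOne y y)
      ≡⟨ cong (_⊗ Product.sum (λ y → orOne y y)) (trans (product-orOne q id x) (cong (x ↑_) ∑-nonzero)) ⟩
    x ↑ (q ∸ 1) ⊗ Product.sum (λ y → orOne y y) ∎))
    where
    open ≡-Reasoning
    x⁻¹ = proj₁ (inverse x x≢0)
    xx⁻¹ : x ⊗ x⁻¹ ≡ 1#
    xx⁻¹ = proj₂ (inverse x x≢0)
    scale : Permutation q q
    scale = permutation (x ⊗_) (x⁻¹ ⊗_)
      (λ y → trans (sym (K.*-assoc x x⁻¹ y)) (trans (cong (_⊗ y) xx⁻¹) (K.*-identityˡ y)))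
      (λ y → trans (sym (K.*-assoc x⁻¹ x y)) (trans (cong (_⊗ y) (trans (K.*-comm x⁻¹ x) xx⁻¹)) (K.*-identityˡ y)))
    factor : ∀ y → Dec (y ≡ 0#) → orOne (x ⊗ y) (x ⊗ y) ≡ orOne y x ⊗ orOne y y
    factor y (yes refl) = trans (cong (λ z → orOne z z) (K.zeroʳ x)) (trans (orOne-zero 0#)
      (sym (trans (cong₂ _⊗_ (orOne-zero x) (orOne-zero 0#)) (K.*-identityˡ 1#))))
    factor y (no y≢0)   = trans (orOne-nonzero (x ⊗ y) (⊗≢0 x≢0 y≢0))
      (sym (cong₂ _⊗_ (orOne-nonzero x y≢0) (orOne-nonzero y y≢0)))

  -- Polynomials and the number of their roots

  -- The monic polynomial with the given non-leading coefficients, lowest first.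
  eval : List (Fin q) → Fin q → Fin q
  eval []       x = 1#
  eval (c ∷ cs) x = c ⊕ x ⊗ eval cs x

  -- Horner's scheme: dividing the polynomial of `c ∷ cs` by x - a yields `quotient a cs`, whose
  -- coefficients are the values at a of the suffixes of `cs`, each read as a monic polynomial.
  quotient : Fin q → List (Fin q) → List (Fin q)
  quotient a []       = []
  quotient a (c ∷ cs) = eval (c ∷ cs) a ∷ quotient a cs

  length-quotient : ∀ a cs → length (quotient a cs) ≡ length cs
  length-quotient a []       = refl
  length-quotient a (c ∷ cs) = cong suc (length-quotient a cs)

  synthetic-division : ∀ a c cs x →
    eval (c ∷ cs) x ≡ eval (c ∷ cs) a ⊕ (x ⊕ ⊖ a) ⊗ eval (quotient a cs) x
  synthetic-division a c cs x = begin
    c ⊕ x ⊗ eval cs x                             ≡⟨ cong (c ⊕_) (step cs) ⟩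
    c ⊕ (a ⊗ eval cs a ⊕ δ ⊗ eval (quotient a cs) x)   ≡⟨ sym (K.+-assoc c _ _) ⟩
    c ⊕ a ⊗ eval cs a ⊕ δ ⊗ eval (quotient a cs) x     ∎
    where
    open ≡-Reasoning
    δ = x ⊕ ⊖ a
    x≡a+δ : x ≡ a ⊕ δ
    x≡a+δ = sym (trans (K.+-comm a δ) ([x⊖y]⊕y x a))
    step : ∀ cs → x ⊗ eval cs x ≡ a ⊗ eval cs a ⊕ δ ⊗ eval (quotient a cs) x
    step []       = trans (cong (_⊗ 1#) x≡a+δ) (K.distribʳ 1# a δ)
    step (c ∷ cs) = begin
      x ⊗ eval (c ∷ cs) x                         ≡⟨ cong (x ⊗_) (synthetic-division a c cs x) ⟩
      x ⊗ (h ⊕ δ ⊗ g)                             ≡⟨ K.distribˡ x h _ ⟩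
      x ⊗ h ⊕ x ⊗ (δ ⊗ g)                         ≡⟨ cong₂ _⊕_ (trans (cong (_⊗ h) x≡a+δ) (K.distribʳ h a δ)) (⊗-swapˡ x δ g) ⟩
      a ⊗ h ⊕ δ ⊗ h ⊕ δ ⊗ (x ⊗ g)                 ≡⟨ trans (K.+-assoc _ _ _) (cong (a ⊗ h ⊕_) (sym (K.distribˡ δ h _))) ⟩
      a ⊗ h ⊕ δ ⊗ (h ⊕ x ⊗ g)                     ∎
      where
      h = eval (c ∷ cs) a
      g = eval (quotient a cs) x

  -- Given a root a, any other root x has x - a invertible and is therefore a root of the quotient.
  -- The recursion is on the length, as the quotient list is no subterm.
  ∑-roots : ∀ cs → ∑ (allFin q) (λ x → ⟦ eval cs x Finₚ.≟ 0# ⟧) ≤ length cs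
  ∑-roots cs = bound (length cs) cs refl
    where
    bound : ∀ d cs → length cs ≡ d → ∑ (allFin q) (λ x → ⟦ eval cs x Finₚ.≟ 0# ⟧) ≤ d
    bound _       []       refl = ≤-reflexive (∑-no (allFin q) (λ _ → 1# Finₚ.≟ 0#) (λ _ → 1≢0))
    bound (suc d) (c ∷ cs) eq with Finₚ.any? (λ a → eval (c ∷ cs) a Finₚ.≟ 0#)
    ... | no ∄root = ≤-trans (≤-reflexive (∑-no (allFin q) (λ x → eval (c ∷ cs) x Finₚ.≟ 0#) (λ x root → ∄root (x , root)))) z≤n
    ... | yes (a , root) = ≤-trans
      (∑-mono (allFin q) (λ x → pointwise x (eval (c ∷ cs) x Finₚ.≟ 0#) (a Finₚ.≟ x) (eval (quotient a cs) x Finₚ.≟ 0#)))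
      (≤-trans (≤-reflexive (∑-+ (allFin q) _ _))
        (+-mono-≤ (≤-reflexive (finOccursOnce q a))
          (bound d (quotient a cs) (trans (length-quotient a cs) (suc-injective eq)))))
      where
      pointwise : ∀ x (p? : Dec (eval (c ∷ cs) x ≡ 0#)) (q? : Dec (a ≡ x)) (r? : Dec (eval (quotient a cs) x ≡ 0#)) →
                  ⟦ p? ⟧ ≤ ⟦ q? ⟧ + ⟦ r? ⟧
      pointwise x p? (yes a≡x) r? = ≤-trans (⟦⟧-≤ p? (yes a≡x) (const a≡x)) (m≤m+n _ _)
      pointwise x p? (no a≢x)  r? = ≤-trans (⟦⟧-≤ p? r? (λ p → ⊗-cancelˡ-0
        (λ x-a≡0 → a≢x (sym (x⊖y≡0⇒x≡y x-a≡0)))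
        (trans (sym (K.+-identityˡ _)) (trans (cong (_⊕ (x ⊕ ⊖ a) ⊗ eval (quotient a cs) x) (sym root))
          (trans (sym (synthetic-division a c cs x)) p))))) (m≤n+m _ _)

  ∑-roots-of-unity : ∀ {d} → 1 ≤ d → ∑ (allFin q) (λ x → ⟦ x ↑ d Finₚ.≟ 1# ⟧) ≤ d
  ∑-roots-of-unity {suc d} _ = ≤-trans
    (≤-reflexive (∑-cong (allFin q) (λ x → ⟦⟧-cong (x ↑ suc d Finₚ.≟ 1#) (eval cs x Finₚ.≟ 0#)
      (λ eq → trans (cong (λ s → ⊖ 1# ⊕ x ⊗ s) (eval-monomial d x)) (trans (cong (⊖ 1# ⊕_) eq) (K.-‿inverseˡ 1#)))
      (λ eq → x⊖y≡0⇒x≡y (trans (K.+-comm _ (⊖ 1#)) (trans (cong (λ s → ⊖ 1# ⊕ x ⊗ s) (sym (eval-monomial d x))) eq))))))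
    (≤-trans (∑-roots cs) (≤-reflexive (cong suc (length-replicate d))))
    where
    -- With the implicit leading coefficient this is x^(d+1) - 1, `d` being the predecessor of the
    -- exponent.
    cs = ⊖ 1# ∷ replicate d 0#
    eval-monomial : ∀ d x → eval (replicate d 0#) x ≡ x ↑ d
    eval-monomial zero    x = refl
    eval-monomial (suc d) x = trans (K.+-identityˡ _) (cong (x ⊗_) (eval-monomial d x))

  -- Orders of elements and a generator

  record IsOrder (x : Fin q) (d : ℕ) : Set where
    field
      positive : 1 ≤ d
      ↑-order  : x ↑ d ≡ 1#
      minimal  : ∀ {k} → 1 ≤ k → k < d → x ↑ k ≢ 1#

    divides-exponent : ∀ {k} → x ↑ k ≡ 1# → d ∣ k
    divides-exponent {k} x↑k≡1 = m%n≡0⇒n∣m k d remainder≡0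
      where
      instance _ = ℕ.>-nonZero positive
      open ≡-Reasoning
      x↑r≡1 : x ↑ (k % d) ≡ 1#
      x↑r≡1 = begin
        x ↑ (k % d)                          ≡⟨ sym (K.*-identityʳ _) ⟩
        x ↑ (k % d) ⊗ 1#                     ≡⟨ cong (x ↑ (k % d) ⊗_) (sym (trans
                                                  (cong (x ↑_) (*-comm (k / d) d))
                                                  (trans (sym (↑-assoc x d (k / d))) (trans (cong (_↑ (k / d)) ↑-order) (1↑ (k / d)))))) ⟩
        x ↑ (k % d) ⊗ x ↑ (k / d * d)        ≡⟨ sym (↑-homo x (k % d) (k / d * d)) ⟩
        x ↑ (k % d + k / d * d)              ≡⟨ cong (x ↑_) (sym (m≡m%n+[m/n]*n k d)) ⟩
        x ↑ k                                ≡⟨ x↑k≡1 ⟩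
        1#                                   ∎
      remainder≡0 : k % d ≡ 0
      remainder≡0 with k % d in eq
      ... | zero  = refl
      ... | suc r = contradiction (subst (λ s → x ↑ s ≡ 1#) eq x↑r≡1)
                      (minimal (s≤s z≤n) (subst (_< d) eq (m%n<n k d)))

    nonzero : x ≢ 0#
    nonzero x≡0 = 1≢0 (trans (sym ↑-order) (zero-power positive))
      where
      zero-power : ∀ {k} → 1 ≤ k → x ↑ k ≡ 0#
      zero-power {suc k} _ = trans (cong (_⊗ x ↑ k) x≡0) (K.zeroˡ _)

    powers-increasing-distinct : ∀ {j k} → 1 ≤ j → j < k → k ≤ d → x ↑ j ≢ x ↑ k
    -- Cancelling x^j leaves x^(k-j) = 1 with 0 < k - j < d; the upper bound comes from 1 ≤ j, the
    -- exponents running over 1, ..., d.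
    powers-increasing-distinct {j} {k} 1≤j j<k k≤d eq = minimal (m<n⇒0<n∸m j<k)
      (<-≤-trans (∸-monoʳ-< 1≤j (<⇒≤ j<k)) k≤d)
      (⊗-cancelˡ (↑≢0 nonzero j) (trans (sym (↑-homo x j (k ∸ j)))
        (trans (cong (x ↑_) (m+[n∸m]≡n (<⇒≤ j<k))) (trans (sym eq) (sym (K.*-identityʳ _))))))

    powers-distinct : ∀ {j k} → 1 ≤ j → 1 ≤ k → j ≤ d → k ≤ d → x ↑ j ≡ x ↑ k → j ≡ k
    powers-distinct {j} {k} 1≤j 1≤k j≤d k≤d eq with <-cmp j k
    ... | tri≈ _ j≡k _ = j≡k
    ... | tri< j<k _ _ = contradiction eq (powers-increasing-distinct 1≤j j<k k≤d)
    ... | tri> _ _ k<j = contradiction (sym eq) (powers-increasing-distinct 1≤k k<j j≤d)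

    power? : ∀ y k → Dec (x ↑ k ≡ y)
    power? y k = x ↑ k Finₚ.≟ y

    -- The d distinct powers of x already exhaust the at most d roots of y^d = 1.
    powers-exhaust : ∀ {y} → y ↑ d ≡ 1# → ∑ (range d) (λ k → ⟦ power? y k ⟧) ≡ 1
    powers-exhaust {y} y↑d≡1 = trans (∑-≤-≡ (allFin q) (λ {y} _ → pointwise y) total (∈-allFin y)) (⟦⟧-yes (y ↑ d Finₚ.≟ 1#) y↑d≡1)
      where
      pointwise : ∀ y → ∑ (range d) (λ k → ⟦ power? y k ⟧) ≤ ⟦ y ↑ d Finₚ.≟ 1# ⟧
      pointwise y with ∑ (range d) (λ k → ⟦ power? y k ⟧) ℕ.≟ 0
      ... | yes ≡0 = ≤-trans (≤-reflexive ≡0) z≤n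
      ... | no ≢0 with ∑≢0⇒∃ (range d) _ ≢0
      ...   | k , k∈ , k≢0 = let x↑k≡y = ⟦⟧≢0 (power? y k) k≢0 ; 1≤k , k≤d = ∈-range⁻ k∈ in ≤-reflexive (trans
        (∑-range-unique (power? y) 1≤k k≤d x↑k≡y (λ k′∈ x↑k′≡y → let 1≤k′ , k′≤d = ∈-range⁻ k′∈ in
          powers-distinct 1≤k′ 1≤k k′≤d k≤d (trans x↑k′≡y (sym x↑k≡y))))
        (sym (⟦⟧-yes (y ↑ d Finₚ.≟ 1#) (begin
          y ↑ d             ≡⟨ cong (_↑ d) (sym x↑k≡y) ⟩
          (x ↑ k) ↑ d       ≡⟨ trans (↑-assoc x k d) (cong (x ↑_) (*-comm k d)) ⟩
          x ↑ (d * k)       ≡⟨ sym (↑-assoc x d k) ⟩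
          (x ↑ d) ↑ k       ≡⟨ trans (cong (_↑ k) ↑-order) (1↑ k) ⟩
          1#                ∎))))
        where open ≡-Reasoning
      total : ∑ (allFin q) (λ y → ⟦ y ↑ d Finₚ.≟ 1# ⟧) ≤ ∑ (allFin q) (λ y → ∑ (range d) (λ k → ⟦ power? y k ⟧))
      total = ≤-trans (∑-roots-of-unity positive) (≤-reflexive (sym (begin
        ∑ (allFin q) (λ y → ∑ (range d) (λ k → ⟦ power? y k ⟧))   ≡⟨ ∑-swap (allFin q) (range d) _ ⟩
        ∑ (range d) (λ k → ∑ (allFin q) (λ y → ⟦ power? y k ⟧))   ≡⟨ ∑-cong (range d) (λ k → finOccursOnce q (x ↑ k)) ⟩
        ∑ (range d) (const 1)                                     ≡⟨ ∑-const (range d) 1 ⟩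
        length (range d) * 1                                      ≡⟨ trans (*-identityʳ _) (length-range d) ⟩
        d                                                         ∎)))
        where open ≡-Reasoning

  open IsOrder

  -- Put g = gcd(k, d) and d = d′g. Then kd′ is a multiple of d, so (x^k)^d′ = 1, and the order d of
  -- x^k divides d′; this forces g = 1.
  order-of-power : ∀ {x d k} → IsOrder x d → IsOrder (x ↑ k) d → gcd k d ≡ 1
  order-of-power {x} {d} {k} x-order xᵏ-order with gcd[m,n]∣n k d | gcd[m,n]∣m k d
  ... | divides d′ d≡d′g | divides k′ k≡k′g = *-cancelˡ-≡ g 1 d′ (≤-antisym
    (≤-trans (≤-reflexive (sym d≡d′g)) (≤-trans (∣⇒≤ d∣d′) (≤-reflexive (sym (*-identityʳ d′)))))
    (*-monoʳ-≤ d′ 1≤g))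
    where
    open ≡-Reasoning
    g = gcd k d
    1≤g : 1 ≤ g
    1≤g = 1≤*⇒1≤ʳ d′ g (subst (1 ≤_) d≡d′g (positive x-order))
    instance
      _ = ℕ.>-nonZero (1≤*⇒1≤ˡ d′ g (subst (1 ≤_) d≡d′g (positive x-order)))
    d∣d′ : d ∣ d′
    d∣d′ = divides-exponent xᵏ-order (begin
      (x ↑ k) ↑ d′         ≡⟨ ↑-assoc x k d′ ⟩
      x ↑ (k * d′)         ≡⟨ cong (x ↑_) (trans (cong (_* d′) k≡k′g) (trans (*-assoc k′ g d′)
                                (trans (*-comm k′ _) (cong (_* k′) (trans (*-comm g d′) (sym d≡d′g)))))) ⟩
      x ↑ (d * k′)         ≡⟨ sym (↑-assoc x d k′) ⟩
      (x ↑ d) ↑ k′         ≡⟨ trans (cong (_↑ k′) (↑-order x-order)) (1↑ k′) ⟩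
      1#                   ∎)

  module _ (1≤n : 1 ≤ q ∸ 1) where
    private
      n : ℕ
      n = q ∸ 1

    order-exists : ∀ {x} → x ≢ 0# → ∃ (IsOrder x)
    order-exists {x} x≢0 =
      let d , (1≤d , x↑d≡1) , min = least (λ k → (1 ≤? k) ×-dec (x ↑ k Finₚ.≟ 1#)) n (1≤n , fermat x≢0)
      in d , record { positive = 1≤d ; ↑-order = x↑d≡1 ; minimal = λ 1≤k k<d x↑k≡1 → min k<d (1≤k , x↑k≡1) }

    -- The order of 0# is 0 by convention.
    order : Fin q → ℕ
    order x with x Finₚ.≟ 0#
    ... | yes _  = 0
    ... | no x≢0 = proj₁ (order-exists x≢0)

    order-0 : order 0# ≡ 0
    order-0 with 0# Finₚ.≟ 0#
    ... | yes _  = refl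
    ... | no 0≢0 = contradiction refl 0≢0

    order-isOrder : ∀ {x} → x ≢ 0# → IsOrder x (order x)
    order-isOrder {x} x≢0 with x Finₚ.≟ 0#
    ... | yes x≡0 = contradiction x≡0 x≢0
    ... | no x≢0  = proj₂ (order-exists x≢0)

    isOrder : ∀ {x d} → 1 ≤ d → order x ≡ d → IsOrder x d
    isOrder {x} 1≤d refl = order-isOrder (λ { refl → contradiction (subst (1 ≤_) order-0 1≤d) λ () })

    ofOrder : ℕ → ℕ
    ofOrder d = ∑ (allFin q) (λ x → ⟦ order x ℕ.≟ d ⟧)

    -- By Fermat each nonzero element has an order dividing n, while the conventional order 0 of
    -- `0#` is not listed among the divisors.
    ∑-ofOrder : ∑ (divisors n) ofOrder ≡ n
    ∑-ofOrder = begin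
      ∑ (divisors n) (λ d → ∑ (allFin q) (λ x → ⟦ order x ℕ.≟ d ⟧))   ≡⟨ ∑-swap (divisors n) (allFin q) _ ⟩
      ∑ (allFin q) (λ x → ∑ (divisors n) (λ d → ⟦ order x ℕ.≟ d ⟧))   ≡⟨ ∑-cong (allFin q) (λ x → orders x (x Finₚ.≟ 0#)) ⟩
      ∑ (allFin q) (λ x → ⟦ nonzero? x ⟧)                                    ≡⟨ ∑-nonzero ⟩
      n                                                                      ∎
      where
      open ≡-Reasoning
      orders : ∀ x → Dec (x ≡ 0#) → ∑ (divisors n) (λ d → ⟦ order x ℕ.≟ d ⟧) ≡ ⟦ nonzero? x ⟧
      orders x (yes refl) = trans
        (∑-cong-∈ (divisors n) {g = const 0} (λ {d} d∈ → ⟦⟧-no (order 0# ℕ.≟ d)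
          (λ eq → contradiction (subst (1 ≤_) (trans (sym eq) order-0) (proj₁ (∈-divisors⁻ {n} d∈))) λ ())))
        (trans (∑-zero (divisors n)) (sym (⟦⟧-no (nonzero? 0#) (λ 0≢0 → 0≢0 refl))))
      orders x (no x≢0) = trans
        (∑-divisors-unique (λ d → order x ℕ.≟ d) 1≤n (divides-exponent (order-isOrder x≢0) (fermat x≢0)) refl (λ _ eq → sym eq))
        (sym (⟦⟧-yes (nonzero? x) x≢0))

    -- If some x has order d, its powers exhaust the roots of y^d = 1, so every y of order d is x^k
    -- for exactly one k ≤ d, and that k is coprime to d. If there is no such x, the count is 0.
    ofOrder≤totient : ∀ {d} → 1 ≤ d → ofOrder d ≤ totient d
    ofOrder≤totient {d} 1≤d with Finₚ.any? (λ x → order x ℕ.≟ d)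
    ... | no ∄x = ≤-trans (≤-reflexive (∑-no (allFin q) (λ x → order x ℕ.≟ d) (λ x eq → ∄x (x , eq)))) z≤n
    ... | yes (x , ord-x≡d) = ≤-trans (≤-reflexive (begin
      ∑ (allFin q) (λ y → ⟦ order y ℕ.≟ d ⟧)
        ≡⟨ ∑-cong (allFin q) (λ y → sym (*-identityʳ _)) ⟩
      ∑ (allFin q) (λ y → ⟦ order y ℕ.≟ d ⟧ * 1)
        ≡⟨ ∑-cong (allFin q) (λ y → ⟦⟧*-cong (order y ℕ.≟ d) (λ eq →
             sym (powers-exhaust x-order (↑-order (isOrder 1≤d eq))))) ⟩
      ∑ (allFin q) (λ y → ⟦ order y ℕ.≟ d ⟧ * ∑ (range d) (λ k → ⟦ x ↑ k Finₚ.≟ y ⟧))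
        ≡⟨ ∑-cong (allFin q) (λ y → sym (∑-*ˡ (range d) ⟦ order y ℕ.≟ d ⟧ _)) ⟩
      ∑ (allFin q) (λ y → ∑ (range d) (λ k → ⟦ order y ℕ.≟ d ⟧ * ⟦ x ↑ k Finₚ.≟ y ⟧))
        ≡⟨ ∑-swap (allFin q) (range d) _ ⟩
      ∑ (range d) (λ k → ∑ (allFin q) (λ y → ⟦ order y ℕ.≟ d ⟧ * ⟦ x ↑ k Finₚ.≟ y ⟧)) ∎))
      (≤-trans (∑-mono (range d) (λ k → ∑-mono (allFin q) (λ y → pointwise k y)))
      (≤-reflexive (begin
      ∑ (range d) (λ k → ∑ (allFin q) (λ y → ⟦ gcd k d ℕ.≟ 1 ⟧ * ⟦ x ↑ k Finₚ.≟ y ⟧))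
        ≡⟨ ∑-cong (range d) (λ k → trans (∑-*ˡ (allFin q) ⟦ gcd k d ℕ.≟ 1 ⟧ _)
             (trans (cong (⟦ gcd k d ℕ.≟ 1 ⟧ *_) (finOccursOnce q (x ↑ k))) (*-identityʳ _))) ⟩
      ∑ (range d) (λ k → ⟦ gcd k d ℕ.≟ 1 ⟧)
        ≡⟨ sym (totient-∑ d) ⟩
      totient d ∎)))
      where
      open ≡-Reasoning
      x-order = isOrder 1≤d ord-x≡d
      pointwise : ∀ k y → ⟦ order y ℕ.≟ d ⟧ * ⟦ x ↑ k Finₚ.≟ y ⟧ ≤ ⟦ gcd k d ℕ.≟ 1 ⟧ * ⟦ x ↑ k Finₚ.≟ y ⟧
      pointwise k y = ≤-trans (≤-reflexive (sym (⟦⟧-× (order y ℕ.≟ d) (x ↑ k Finₚ.≟ y))))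
        (≤-trans (⟦⟧-≤ _ ((gcd k d ℕ.≟ 1) ×-dec (x ↑ k Finₚ.≟ y))
          (λ { (ord-y≡d , refl) → order-of-power {k = k} x-order (isOrder 1≤d ord-y≡d) , refl }))
        (≤-reflexive (⟦⟧-× (gcd k d ℕ.≟ 1) (x ↑ k Finₚ.≟ y))))

    ofOrder≡totient : ∀ {d} → d ∣ n → ofOrder d ≡ totient d
    ofOrder≡totient d∣n = ∑-≤-≡ (divisors n) (λ d∈ → ofOrder≤totient (proj₁ (∈-divisors⁻ {n} d∈)))
      (≤-reflexive (trans (∑-totient 1≤n) (sym ∑-ofOrder))) (∈-divisors⁺ 1≤n d∣n)

    primitive-element : ∃ λ g → IsOrder g n
    primitive-element =
      let g , _ , g≢0 = ∑≢0⇒∃ (allFin q) (λ x → ⟦ order x ℕ.≟ n ⟧)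
                          (λ ≡0 → totient≢0 (trans (sym (ofOrder≡totient ∣-refl)) ≡0))
      in g , isOrder 1≤n (⟦⟧≢0 (order g ℕ.≟ n) g≢0)
      where
      totient≢0 : totient n ≢ 0
      -- k = 1 is coprime to n; comparing a vanishing sum with the zero function isolates its
      -- bracket, which is 1.
      totient≢0 ≡0 = 1+n≢0 (trans (sym (⟦⟧-yes (gcd 1 n ℕ.≟ 1) (∣1⇒≡1 (gcd[m,n]∣m 1 n))))
        (sym (∑-≤-≡ (range n) {f = const 0} {g = λ k → ⟦ gcd k n ℕ.≟ 1 ⟧} (λ _ → z≤n)
          (≤-reflexive (trans (trans (sym (totient-∑ n)) ≡0) (sym (∑-zero (range n))))) (∈-range⁺ ≤-refl 1≤n))))

-- Subsets of F* invariant under multiplication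

-- Exponents run over 1, ..., n but residues over 0, ..., e-1; for f with f 0 = f e this shifts one
-- range to the other.
∑-rotate : ∀ e (f : ℕ → ℕ) → ∑ (allFin e) (f ∘ suc ∘ toℕ) + f 0 ≡ ∑ (allFin e) (f ∘ toℕ) + f e
∑-rotate zero    f = refl
∑-rotate (suc e) f = begin
  ∑ (allFin (suc e)) (f ∘ suc ∘ toℕ) + f 0             ≡⟨ cong (_+ f 0) (∑-allFin-suc e (f ∘ suc ∘ toℕ)) ⟩
  f 1 + ∑ (allFin e) (f ∘ suc ∘ suc ∘ toℕ) + f 0       ≡⟨ cong (_+ f 0) (trans (+-comm (f 1) _) (∑-rotate e (f ∘ suc))) ⟩
  ∑ (allFin e) (f ∘ suc ∘ toℕ) + f (suc e) + f 0       ≡⟨ trans (+-comm _ (f 0)) (sym (+-assoc (f 0) _ _)) ⟩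
  f 0 + ∑ (allFin e) (f ∘ suc ∘ toℕ) + f (suc e)       ≡⟨ cong (_+ f (suc e)) (sym (∑-allFin-suc e (f ∘ toℕ))) ⟩
  ∑ (allFin (suc e)) (f ∘ toℕ) + f (suc e)             ∎
  where open ≡-Reasoning

∑-allFin-+ : ∀ a b (f : ℕ → ℕ) →
  ∑ (allFin (a + b)) (f ∘ toℕ) ≡ ∑ (allFin a) (f ∘ toℕ) + ∑ (allFin b) (λ i → f (a + toℕ i))
∑-allFin-+ zero    b f = refl
∑-allFin-+ (suc a) b f = begin
  ∑ (allFin (suc a + b)) (f ∘ toℕ)
    ≡⟨ trans (∑-allFin-suc (a + b) (f ∘ toℕ)) (cong (f 0 +_) (∑-allFin-+ a b (f ∘ suc))) ⟩
  f 0 + (∑ (allFin a) (f ∘ suc ∘ toℕ) + ∑ (allFin b) (λ i → f (suc a + toℕ i)))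
    ≡⟨ sym (+-assoc (f 0) _ _) ⟩
  f 0 + ∑ (allFin a) (f ∘ suc ∘ toℕ) + ∑ (allFin b) (λ i → f (suc a + toℕ i))
    ≡⟨ cong (_+ ∑ (allFin b) (λ i → f (suc a + toℕ i))) (sym (∑-allFin-suc a (f ∘ toℕ))) ⟩
  ∑ (allFin (suc a)) (f ∘ toℕ) + ∑ (allFin b) (λ i → f (suc a + toℕ i)) ∎
  where open ≡-Reasoning

∑-periodic : ∀ d e (f : ℕ → ℕ) → (∀ i → f (e + i) ≡ f i) →
             ∑ (allFin (d * e)) (f ∘ toℕ) ≡ d * ∑ (allFin e) (f ∘ toℕ)
∑-periodic zero    e f period = refl
∑-periodic (suc d) e f period = trans (∑-allFin-+ e (d * e) f)
  (cong (∑ (allFin e) (f ∘ toℕ) +_)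
    (trans (∑-cong (allFin (d * e)) (period ∘ toℕ)) (∑-periodic d e f period)))

toℕ-mod : ∀ i e .{{_ : NonZero e}} → toℕ (i mod e) ≡ i % e
toℕ-mod i e = Finₚ.toℕ-fromℕ< (m%n<n i e)

mod-cong : ∀ {i j} e .{{_ : NonZero e}} → i % e ≡ j % e → i mod e ≡ j mod e
mod-cong {i} {j} e eq = Finₚ.toℕ-injective (trans (toℕ-mod i e) (trans eq (sym (toℕ-mod j e))))

toℕ-mod-id : ∀ {e} .{{_ : NonZero e}} (i : Fin e) → toℕ i mod e ≡ i
toℕ-mod-id {e} i = Finₚ.toℕ-injective (trans (toℕ-mod (toℕ i) e) (m<n⇒m%n≡m (Finₚ.toℕ<n i)))

div-exact : ∀ c {d} → 1 ≤ d → (c * d) div d ≡ c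
div-exact c {suc d} _ = m*n/n≡m c (suc d)

∑-subsets-scaled : ∀ {d} → 1 ≤ d → ∀ e m →
  ∑ᴱ (subsets e) (λ T → ⟦ d * ∣ T ∣ ℕ.≟ m ⟧) ≡ ⟦ d ∣? m ⟧ * (((e * d) div d) C (m div d))
∑-subsets-scaled {d} 1≤d e m = scaled (d ∣? m)
  where
  instance _ = ℕ.>-nonZero 1≤d
  L = elements (subsets e)
  scaled : (d∣m? : Dec (d ∣ m)) →
    ∑ L (λ T → ⟦ d * ∣ T ∣ ℕ.≟ m ⟧) ≡ ⟦ d∣m? ⟧ * (((e * d) div d) C (m div d))
  scaled (yes (divides c refl)) = trans
    (∑-cong L (λ T → ⟦⟧-cong (d * ∣ T ∣ ℕ.≟ c * d) (∣ T ∣ ℕ.≟ c)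
      (λ eq → *-cancelˡ-≡ _ c d (trans eq (*-comm c d))) (λ eq → trans (cong (d *_) eq) (*-comm d c))))
    (trans (∑-subsets-of-size e c) (sym (trans
      (cong₂ _*_ (⟦⟧-yes (yes (divides c refl)) (divides c refl)) (cong₂ _C_ (div-exact e 1≤d) (div-exact c 1≤d)))
      (*-identityˡ _))))
  scaled (no d∤m) = trans
    (∑-no L (λ T → d * ∣ T ∣ ℕ.≟ m) (λ T eq → d∤m (divides ∣ T ∣ (trans (sym eq) (*-comm d _)))))
    (sym (cong (_* _) (⟦⟧-no (no d∤m) d∤m)))

module InvariantSubsets {q : ℕ} (F : FiniteField q) (1≤n : 1 ≤ q ∸ 1)
  (g : Fin q) (g-order : Multiplicative.IsOrder F g (q ∸ 1)) where
  open FieldProperties F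
  open Multiplicative F
  open IsOrder

  n : ℕ
  n = q ∸ 1

  g↑≢0 : ∀ k → g ↑ k ≢ 0#
  g↑≢0 = ↑≢0 (nonzero g-order)

  -- Each nonzero x is g^k for exactly one k in 1, ..., n, so the field is 0 together with the
  -- powers of g.
  ∑-powers : ∀ (h : Fin q → ℕ) → ∑ (allFin q) h ≡ h 0# + ∑ (range n) (λ k → h (g ↑ k))
  ∑-powers h = begin
    ∑ (allFin q) h
      ≡⟨ ∑-cong (allFin q) (λ x → weight x (x Finₚ.≟ 0#)) ⟩
    ∑ (allFin q) (λ x → (⟦ 0# Finₚ.≟ x ⟧ + ∑ (range n) (λ k → ⟦ g ↑ k Finₚ.≟ x ⟧)) * h x)
      ≡⟨ trans (∑-cong (allFin q) (λ x → *-distribʳ-+ (h x) ⟦ 0# Finₚ.≟ x ⟧ _)) (∑-+ (allFin q) _ _) ⟩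
    ∑ (allFin q) (λ x → ⟦ 0# Finₚ.≟ x ⟧ * h x) + ∑ (allFin q) (λ x → ∑ (range n) (λ k → ⟦ g ↑ k Finₚ.≟ x ⟧) * h x)
      ≡⟨ cong₂ _+_ (evaluate 0#) (trans
           (∑-cong (allFin q) (λ x → sym (∑-*ʳ (range n) (h x) _)))
           (trans (∑-swap (allFin q) (range n) _) (∑-cong (range n) (λ k → evaluate (g ↑ k))))) ⟩
    h 0# + ∑ (range n) (λ k → h (g ↑ k)) ∎
    where
    open ≡-Reasoning
    evaluate : ∀ a → ∑ (allFin q) (λ x → ⟦ a Finₚ.≟ x ⟧ * h x) ≡ h a
    evaluate a = trans (∑-cong (allFin q) (λ x → ⟦⟧*-cong (a Finₚ.≟ x) (λ a≡x → cong h (sym a≡x))))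
      (trans (∑-*ʳ (allFin q) (h a) _) (trans (cong (_* h a) (finOccursOnce q a)) (*-identityˡ (h a))))
    weight : ∀ x → Dec (x ≡ 0#) → h x ≡ (⟦ 0# Finₚ.≟ x ⟧ + ∑ (range n) (λ k → ⟦ g ↑ k Finₚ.≟ x ⟧)) * h x
    weight x (yes refl) = sym (trans (cong (_* h 0#) (cong₂ _+_ (⟦⟧-yes (0# Finₚ.≟ 0#) refl)
      (∑-no (range n) (λ k → g ↑ k Finₚ.≟ 0#) g↑≢0))) (*-identityˡ (h 0#)))
    weight x (no x≢0) = sym (trans (cong (_* h x) (cong₂ _+_ (⟦⟧-no (0# Finₚ.≟ x) (x≢0 ∘ sym))
      (powers-exhaust g-order (fermat x≢0)))) (*-identityˡ (h x)))

  log : ∀ {x} → x ≢ 0# → ∃ λ k → g ↑ k ≡ x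
  log {x} x≢0 =
    let k , _ , k≢0 = ∑≢0⇒∃ (range n) (λ k → ⟦ g ↑ k Finₚ.≟ x ⟧)
                        (λ ≡0 → 1+n≢0 (trans (sym (powers-exhaust g-order (fermat x≢0))) ≡0))
    in k , ⟦⟧≢0 (g ↑ k Finₚ.≟ x) k≢0

  g↑+*n : ∀ i t → g ↑ (i + t * n) ≡ g ↑ i
  g↑+*n i t = begin
    g ↑ (i + t * n)            ≡⟨ ↑-homo g i (t * n) ⟩
    g ↑ i ⊗ g ↑ (t * n)        ≡⟨ cong (g ↑ i ⊗_) (trans (cong (g ↑_) (*-comm t n)) (trans (sym (↑-assoc g n t))
                                    (trans (cong (_↑ t) (↑-order g-order)) (1↑ t)))) ⟩
    g ↑ i ⊗ 1#                 ≡⟨ K.*-identityʳ _ ⟩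
    g ↑ i                      ∎
    where open ≡-Reasoning

  -- Equal powers of g have exponents congruent modulo n, hence modulo e. So the residue modulo e of
  -- a logarithm is well defined although `log` returns an arbitrary one.
  exponents-congruent-≤ : ∀ {e} .{{_ : NonZero e}} → e ∣ n → ∀ {i j} → i ≤ j → g ↑ i ≡ g ↑ j → j % e ≡ i % e
  exponents-congruent-≤ {e} e∣n {i} {j} i≤j eq with ∣-trans e∣n (divides-exponent g-order {j ∸ i} (⊗-cancelˡ (g↑≢0 i)
    (trans (sym (↑-homo g i (j ∸ i))) (trans (cong (g ↑_) (m+[n∸m]≡n i≤j)) (trans (sym eq) (sym (K.*-identityʳ _)))))))
  ... | divides c j∸i≡ce = trans (cong (_% e) (trans (sym (m+[n∸m]≡n i≤j)) (cong (i +_) j∸i≡ce))) ([m+kn]%n≡m%n i c e)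

  exponents-congruent : ∀ {e} .{{_ : NonZero e}} → e ∣ n → ∀ {i j} → g ↑ i ≡ g ↑ j → i % e ≡ j % e
  exponents-congruent {e} e∣n {i} {j} eq with ≤-total i j
  ... | inj₁ i≤j = sym (exponents-congruent-≤ e∣n i≤j eq)
  ... | inj₂ j≤i = exponents-congruent-≤ e∣n j≤i (sym eq)

  -- The first clause says S ⊆ F*. For t ≠ 0 the inclusion tS ⊆ S already gives tS = S,
  -- multiplication by t being injective and S finite.
  Invariant : Fin q → Subset q → Set
  Invariant t S = S 0# ≡ false × (∀ x → S x ≡ true → S (t ⊗ x) ≡ true)

  invariant? : ∀ t S → Dec (Invariant t S)
  invariant? t S = (S 0# Bool.≟ false) ×-dec Finₚ.all? (λ x → (S x Bool.≟ true) →-dec (S (t ⊗ x) Bool.≟ true))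

  Invariant-resp : ∀ {t S T} → S ≗ T → Invariant t S → Invariant t T
  Invariant-resp S≗T (S0 , inv) = trans (sym (S≗T _)) S0
    , λ x Tx → trans (sym (S≗T _)) (inv x (trans (S≗T x) Tx))

  -- A subset of F* invariant under g^k is a union of cosets of ⟨g^e⟩ with e = gcd(k,n).
  module _ (k d : ℕ) (d*e≡n : d * gcd k n ≡ n) where
    private
      e : ℕ
      e = gcd k n

      1≤e : 1 ≤ e
      1≤e = 1≤*⇒1≤ʳ d e (subst (1 ≤_) (sym d*e≡n) 1≤n)

      1≤d : 1 ≤ d
      1≤d = 1≤*⇒1≤ˡ d e (subst (1 ≤_) (sym d*e≡n) 1≤n)

      instance
        e-nonZero : NonZero e
        e-nonZero = ℕ.>-nonZero 1≤e

      e∣n : e ∣ n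
      e∣n = gcd[m,n]∣n k n

      -- T lists residues of logarithms modulo e, and each residue stands for one coset of the
      -- subgroup generated by g^e; the result is the union of the chosen cosets.
      extend : Subset e → Subset q
      extend T x with x Finₚ.≟ 0#
      ... | yes _  = false
      ... | no x≢0 = T (proj₁ (log x≢0) mod e)

      extend-0 : ∀ T → extend T 0# ≡ false
      extend-0 T with 0# Finₚ.≟ 0#
      ... | yes _  = refl
      ... | no 0≢0 = contradiction refl 0≢0

      extend-power : ∀ T i → extend T (g ↑ i) ≡ T (i mod e)
      extend-power T i with g ↑ i Finₚ.≟ 0#
      ... | yes ≡0 = contradiction ≡0 (g↑≢0 i)
      ... | no ≢0  = cong T (mod-cong e (exponents-congruent e∣n {proj₁ (log ≢0)} {i} (proj₂ (log ≢0))))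

      restrict : Subset q → Subset e
      restrict S i = S (g ↑ toℕ i)

      extend-invariant : ∀ T → Invariant (g ↑ k) (extend T)
      extend-invariant T = extend-0 T , λ x → closed x (x Finₚ.≟ 0#)
        where
        closed : ∀ x → Dec (x ≡ 0#) → extend T x ≡ true → extend T (g ↑ k ⊗ x) ≡ true
        closed x (yes refl) Tx = contradiction (trans (sym (extend-0 T)) Tx) λ ()
        closed x (no x≢0)   Tx with log x≢0
        ... | j , refl = trans (cong (extend T) (sym (↑-homo g k j))) (trans (extend-power T (k + j))
          (trans (cong T (mod-cong e shift)) (trans (sym (extend-power T j)) Tx)))
          where
          shift : (k + j) % e ≡ j % e
          shift with gcd[m,n]∣m k n
          ... | divides c k≡ce = trans (cong (_% e) (trans (+-comm k j) (cong (j +_) k≡ce))) ([m+kn]%n≡m%n j c e)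

      -- By Bézout e is congruent modulo n to a multiple of k, so g^k and g^e generate the same
      -- subgroup.
      g↑e-power : ∃ λ a → (g ↑ k) ↑ a ≡ g ↑ e
      g↑e-power with Bézout.identity (gcd-GCD k n)
      ... | +- x y e+yn≡xk = x , trans (↑-assoc g k x) (trans (cong (g ↑_) (trans (*-comm k x) (sym e+yn≡xk))) (g↑+*n e y))
      -- Here the coefficient of k is -x; since g has order n, the natural number x(n - 1) serves in
      -- its place.
      ... | -+ x y e+xk≡yn = x * (n ∸ 1) , ⊗-cancelʳ (↑≢0 (g↑≢0 k) x) (begin
        (g ↑ k) ↑ (x * (n ∸ 1)) ⊗ (g ↑ k) ↑ x   ≡⟨ sym (↑-homo (g ↑ k) (x * (n ∸ 1)) x) ⟩
        (g ↑ k) ↑ (x * (n ∸ 1) + x)             ≡⟨ cong ((g ↑ k) ↑_) (trans (+-comm _ x) (trans (sym (*-suc x (n ∸ 1)))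
                                                     (cong (x *_) (m+[n∸m]≡n 1≤n)))) ⟩
        (g ↑ k) ↑ (x * n)                       ≡⟨ trans (↑-assoc g k (x * n)) (cong (g ↑_) (sym (*-assoc k x n))) ⟩
        g ↑ (0 + k * x * n)                     ≡⟨ g↑+*n 0 (k * x) ⟩
        g ↑ 0                                   ≡⟨ sym (g↑+*n 0 y) ⟩
        g ↑ (y * n)                             ≡⟨ cong (g ↑_) (trans (sym e+xk≡yn) (cong (e +_) (*-comm x k))) ⟩
        g ↑ (e + k * x)                         ≡⟨ trans (↑-homo g e (k * x)) (cong (g ↑ e ⊗_) (sym (↑-assoc g k x))) ⟩
        g ↑ e ⊗ (g ↑ k) ↑ x                     ∎)
        where open ≡-Reasoning

      module _ {S : Subset q} (inv : Invariant (g ↑ k) S) where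

        closed-powers : ∀ a x → S x ≡ true → S ((g ↑ k) ↑ a ⊗ x) ≡ true
        closed-powers zero    x Sx = trans (cong S (K.*-identityˡ x)) Sx
        closed-powers (suc a) x Sx = trans (cong S (K.*-assoc (g ↑ k) _ x)) (proj₂ inv _ (closed-powers a x Sx))

        closed-e : ∀ i c → S (g ↑ i) ≡ true → S (g ↑ (i + c * e)) ≡ true
        closed-e i zero    Si = trans (cong (λ s → S (g ↑ s)) (+-identityʳ i)) Si
        closed-e i (suc c) Si = let a , ≡g↑e = g↑e-power in
          trans (cong S (begin
            g ↑ (i + (e + c * e))              ≡⟨ cong (g ↑_) (trans (sym (+-assoc i e _)) (trans (cong (_+ c * e) (+-comm i e)) (+-assoc e i _))) ⟩
            g ↑ (e + (i + c * e))              ≡⟨ ↑-homo g e (i + c * e) ⟩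
            g ↑ e ⊗ g ↑ (i + c * e)            ≡⟨ cong (_⊗ g ↑ (i + c * e)) (sym ≡g↑e) ⟩
            (g ↑ k) ↑ a ⊗ g ↑ (i + c * e)      ∎))
          (closed-powers a _ (closed-e i c Si))
          where open ≡-Reasoning

        periodic : ∀ i → S (g ↑ (i % e)) ≡ S (g ↑ i)
        periodic i = bool-≡ forward backward
          where
          bool-≡ : ∀ {a b} → (a ≡ true → b ≡ true) → (b ≡ true → a ≡ true) → a ≡ b
          bool-≡ {true}  {b}     f h = sym (f refl)
          bool-≡ {false} {true}  f h = h refl
          bool-≡ {false} {false} f h = refl
          forward : S (g ↑ (i % e)) ≡ true → S (g ↑ i) ≡ true
          forward Sr = trans (cong (λ s → S (g ↑ s)) (m≡m%n+[m/n]*n i e)) (closed-e (i % e) (i / e) Sr)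
          backward : S (g ↑ i) ≡ true → S (g ↑ (i % e)) ≡ true
          -- Closure only moves exponents upwards. From i, a further (i/e)(d - 1) steps of length e
          -- = n/d reach i % e + (i/e) n, which gives the same power as i % e.
          backward Si = trans (cong S (begin
            g ↑ (i % e)                                       ≡⟨ sym (g↑+*n (i % e) (i / e)) ⟩
            g ↑ (i % e + i / e * n)                           ≡⟨ cong (g ↑_) exponent ⟩
            g ↑ (i + (i / e * (d ∸ 1)) * e)                   ∎))
            (closed-e i (i / e * (d ∸ 1)) Si)
            where
            open ≡-Reasoning
            open Data.Nat.Solver.+-*-Solver using (solve; _:+_; _:*_; _:=_; con)
            exponent : i % e + i / e * n ≡ i + (i / e * (d ∸ 1)) * e
            exponent = begin
              i % e + i / e * n                                  ≡⟨ cong (λ s → i % e + i / e * s) (sym d*e≡n) ⟩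
              i % e + i / e * (d * e)                            ≡⟨ cong (λ s → i % e + i / e * (s * e)) (sym (m+[n∸m]≡n 1≤d)) ⟩
              i % e + i / e * ((1 + (d ∸ 1)) * e)                ≡⟨ solve 4 (λ r c d e → r :+ c :* ((con 1 :+ d) :* e) := r :+ c :* e :+ c :* d :* e)
                                                                      refl (i % e) (i / e) (d ∸ 1) e ⟩
              i % e + i / e * e + (i / e * (d ∸ 1)) * e          ≡⟨ cong (_+ (i / e * (d ∸ 1)) * e) (sym (m≡m%n+[m/n]*n i e)) ⟩
              i + (i / e * (d ∸ 1)) * e                          ∎

        extend-restrict : S ≗ extend (restrict S)
        extend-restrict x = at x (x Finₚ.≟ 0#)
          where
          at : ∀ x → Dec (x ≡ 0#) → S x ≡ extend (restrict S) x
          at x (yes refl) = trans (proj₁ inv) (sym (extend-0 (restrict S)))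
          at x (no x≢0) with log x≢0
          ... | j , refl = sym (trans (extend-power (restrict S) j)
            (trans (cong (λ s → S (g ↑ s)) (toℕ-mod j e)) (periodic j)))

      restrict-extend : ∀ T → restrict (extend T) ≗ T
      restrict-extend T i = trans (extend-power T (toℕ i)) (cong T (toℕ-mod-id i))

      -- Along the exponents, membership is periodic with period e, and n = de contains d periods.
      ∣extend∣ : ∀ T → ∣ extend T ∣ ≡ d * ∣ T ∣
      ∣extend∣ T = begin
        ∑ (allFin q) (λ x → ⟦ extend T x Bool.≟ true ⟧)
          ≡⟨ ∑-powers (λ x → ⟦ extend T x Bool.≟ true ⟧) ⟩
        ⟦ extend T 0# Bool.≟ true ⟧ + ∑ (range n) (λ i → ⟦ extend T (g ↑ i) Bool.≟ true ⟧)
          ≡⟨ cong₂ _+_ (⟦⟧-no (extend T 0# Bool.≟ true) (λ eq → contradiction (trans (sym (extend-0 T)) eq) λ ()))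
               (∑-cong (range n) (λ i → cong (λ b → ⟦ b Bool.≟ true ⟧) (extend-power T i))) ⟩
        ∑ (range n) f
          ≡⟨ ∑-range n f ⟩
        ∑ (allFin n) (f ∘ suc ∘ toℕ)
          ≡⟨ +-cancelʳ-≡ (f 0) _ _ (trans (∑-rotate n f) (cong (∑ (allFin n) (f ∘ toℕ) +_) f-n)) ⟩
        ∑ (allFin n) (f ∘ toℕ)
          ≡⟨ cong (λ s → ∑ (allFin s) (f ∘ toℕ)) (sym d*e≡n) ⟩
        ∑ (allFin (d * e)) (f ∘ toℕ)
          ≡⟨ ∑-periodic d e f (λ i → f-cong (trans (cong (_% e) (trans (+-comm e i) (cong (i +_) (sym (*-identityˡ e))))) ([m+kn]%n≡m%n i 1 e))) ⟩
        d * ∑ (allFin e) (f ∘ toℕ)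
          ≡⟨ cong (d *_) (∑-cong (allFin e) (λ i → cong (λ j → ⟦ T j Bool.≟ true ⟧) (toℕ-mod-id i))) ⟩
        d * ∣ T ∣ ∎
        where
        open ≡-Reasoning
        f : ℕ → ℕ
        f i = ⟦ T (i mod e) Bool.≟ true ⟧
        f-cong : ∀ {i j} → i % e ≡ j % e → f i ≡ f j
        f-cong eq = cong (λ j → ⟦ T j Bool.≟ true ⟧) (mod-cong e eq)
        f-n : f n ≡ f 0
        f-n = f-cong (trans (cong (_% e) (sym d*e≡n)) ([m+kn]%n≡m%n 0 d e))

    -- `extend` and `restrict` are mutually inverse between the subsets T of residues and the
    -- invariant S, and multiply sizes by d. What remains is to count the T with d times their size
    -- equal to m.
    ∑-invariant-subsets : ∀ m →
      ∑ᴱ (subsets q) (λ S → ⟦ (∣ S ∣ ℕ.≟ m) ×-dec invariant? (g ↑ k) S ⟧)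
        ≡ ⟦ d ∣? m ⟧ * ((n div d) C (m div d))
    ∑-invariant-subsets m = begin
      ∑ᴱ (subsets q) (λ S → ⟦ good? S ⟧)
        ≡⟨ double-counting (elements (subsets q)) (elements (subsets e)) (λ S T → S Q.≈? extend T)
             (λ S → ⟦ good? S ⟧) (λ T → ⟦ d * ∣ T ∣ ℕ.≟ m ⟧)
             (λ {S} _ ≢0 → uniqueʳ S (proj₂ (⟦⟧≢0 (good? S) ≢0)))
             (λ {T} _ _ → Q.∑-unique (λ S → S Q.≈? extend T) (λ S≈S′ eq x → trans (sym (S≈S′ x)) (eq x))
                (extend T) (λ _ → refl) (λ S eq x → sym (eq x)))
             (λ {S} {T} → weights S T) ⟩
      ∑ᴱ (subsets e) (λ T → ⟦ d * ∣ T ∣ ℕ.≟ m ⟧)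
        ≡⟨ ∑-subsets-scaled 1≤d e m ⟩
      ⟦ d ∣? m ⟧ * (((e * d) div d) C (m div d))
        ≡⟨ cong (λ s → ⟦ d ∣? m ⟧ * ((s div d) C (m div d))) (trans (*-comm e d) d*e≡n) ⟩
      ⟦ d ∣? m ⟧ * ((n div d) C (m div d)) ∎
      where
      open ≡-Reasoning
      module Q = Enumeration (subsets q)
      module E = Enumeration (subsets e)
      good? : ∀ S → Dec (∣ S ∣ ≡ m × Invariant (g ↑ k) S)
      good? S = (∣ S ∣ ℕ.≟ m) ×-dec invariant? (g ↑ k) S
      uniqueʳ : ∀ S → Invariant (g ↑ k) S → ∑ E.elements (λ T → ⟦ S Q.≈? extend T ⟧) ≡ 1
      uniqueʳ S inv = E.∑-unique (λ T → S Q.≈? extend T)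
        (λ T≈T′ eq x → trans (eq x) (extend-cong T≈T′ x))
        (restrict S) (extend-restrict inv)
        (λ T eq i → trans (eq (g ↑ toℕ i)) (restrict-extend T i))
        where
        extend-cong : ∀ {T T′} → T ≗ T′ → extend T ≗ extend T′
        extend-cong T≗T′ x with x Finₚ.≟ 0#
        ... | yes _ = refl
        ... | no _  = T≗T′ _
      weights : ∀ S T → S ≗ extend T → ⟦ good? S ⟧ ≡ ⟦ d * ∣ T ∣ ℕ.≟ m ⟧
      weights S T eq = ⟦⟧-cong (good? S) (d * ∣ T ∣ ℕ.≟ m)
        (λ (∣S∣≡m , _) → trans (sym card) ∣S∣≡m)
        (λ d∣T∣≡m → trans card d∣T∣≡m , Invariant-resp (sym ∘ eq) (extend-invariant T))
        where
        card : ∣ S ∣ ≡ d * ∣ T ∣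
        card = trans (∣∣-cong eq) (∣extend∣ T)

-- Solution counts

module Counting {q : ℕ} (F : FiniteField q) where
  open FieldProperties F
  open Multiplicative F

  isStarColumn⁺ : ∀ {m} {B : Matrix m 1} → Inj (λ i → B i Fin.zero) → (∀ i → B i Fin.zero ≢ 0#) → isStarColumn B ≡ true
  isStarColumn⁺ {m} {B} inj B≢0 = cong₂ _∧_
    (all-true⁺ (allFin m) λ {i} _ → cong not (⌊⌋-false (B i Fin.zero Finₚ.≟ 0#) (B≢0 i)))
    (all-true⁺ (allFin m) λ {i} _ → all-true⁺ (allFin m) λ {j} _ →
      ⌊implies⌋-true⁺ (B i Fin.zero Finₚ.≟ B j Fin.zero) (i Finₚ.≟ j) (inj i j))
    where
    ⌊⌋-false : ∀ {P : Set} (p? : Dec P) → ¬ P → ⌊ p? ⌋ ≡ false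
    ⌊⌋-false (yes p) ¬p = contradiction p ¬p
    ⌊⌋-false (no _)  _  = refl

  isStarColumn⁻ : ∀ {m} {B : Matrix m 1} → isStarColumn B ≡ true → Inj (λ i → B i Fin.zero) × (∀ i → B i Fin.zero ≢ 0#)
  isStarColumn⁻ {m} {B} star =
    let nonzeros , distinct = ∧-true⁻ (all (λ i → not (isZero (B i Fin.zero))) (allFin m)) _ star in
    (λ i j → ⌊implies⌋-true⁻ (B i Fin.zero Finₚ.≟ B j Fin.zero) (i Finₚ.≟ j)
       (all-true⁻ (allFin m) (all-true⁻ (allFin m) distinct (∈-allFin i)) (∈-allFin j)))
    , λ i Bi≡0 → contradiction (trans (sym (all-true⁻ (allFin m) nonzeros (∈-allFin i)))
        (cong not (⌊⌋-true⁺ (B i Fin.zero Finₚ.≟ 0#) Bi≡0))) λ ()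

  star? : ∀ {m} (b : Vector m) → Dec (Inj b × ∀ i → b i ≢ 0#)
  star? b = inj? b ×-dec Finₚ.all? (nonzero? ∘ b)

  ∑-starColumns : ∀ m (h : Vector m → ℕ) → (∀ {b c} → b ≗ c → h b ≡ h c) →
    ∑ (starColumns m) (λ B → h (λ i → B i Fin.zero)) ≡ ∑ (elements (vectors m)) (λ b → ⟦ star? b ⟧ * h b)
  ∑-starColumns m h h-cong = trans (∑-filter _ (allMatrices m 1) _)
    (double-counting (allMatrices m 1) (elements (vectors m)) (λ B b → Col._≈?_ (column B) b) _ _
      (λ {B} _ _ → Col.occursOnce (column B))
      (λ {b} _ _ → Enumeration.∑-unique (matrices m 1) (λ B → Col._≈?_ (column B) b)
        (λ B≈B′ eq i → trans (sym (B≈B′ i Fin.zero)) (eq i)) (λ i _ → b i) (λ _ → refl)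
        (λ B eq → λ { i Fin.zero → sym (eq i) }))
      (λ {B} {b} eq → cong₂ _*_
        (⟦⟧-cong (isStarColumn B Bool.≟ true) (star? b)
          (λ star → let inj , ≢0 = isStarColumn⁻ {B = B} star in Inj-resp eq inj , λ i bi≡0 → ≢0 i (trans (eq i) bi≡0))
          (λ (inj , ≢0) → isStarColumn⁺ {B = B} (Inj-resp (sym ∘ eq) inj) (λ i Bi≡0 → ≢0 i (trans (sym (eq i)) Bi≡0))))
        (h-cong eq)))
    where
    module Col = Enumeration (vectors m)
    column : Matrix m 1 → Vector m
    column B i = B i Fin.zero

  length-starColumns : ∀ {m} → m ≤ q ∸ 1 → length (starColumns m) ≡ m ! * ((q ∸ 1) C m)
  length-starColumns {m} m≤n = begin
    length (starColumns m)                                    ≡⟨ sym (trans (∑-const (starColumns m) 1) (*-identityʳ _)) ⟩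
    ∑ (starColumns m) (const 1)                               ≡⟨ ∑-starColumns m (const 1) (λ _ → refl) ⟩
    ∑ (elements (vectors m)) (λ b → ⟦ star? b ⟧ * 1)          ≡⟨ ∑-cong (elements (vectors m)) (λ b → *-identityʳ ⟦ star? b ⟧) ⟩
    ∑ (elements (vectors m)) (λ b → ⟦ star? b ⟧)              ≡⟨ ∑-injections m nonzero? ⟩
    falling (∑ (allFin q) (λ x → ⟦ nonzero? x ⟧)) m           ≡⟨ cong (λ s → falling s m) ∑-nonzero ⟩
    falling (q ∸ 1) m                                         ≡⟨ falling≡!*C m≤n ⟩
    m ! * ((q ∸ 1) C m)                                       ∎
    where open ≡-Reasoning

  dot-permMatrix : ∀ {m} (ρ : Fin m → Fin m) k b → dot (permMatrix ρ k) b ≡ b (ρ k)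
  dot-permMatrix {m} ρ k b = trans
    (sumF-select m (ρ k) (λ j → permMatrix ρ k j ⊗ b j) (λ j ρk≢j → off j (ρ k Finₚ.≟ j) ρk≢j))
    (on (ρ k Finₚ.≟ ρ k))
    where
    off : ∀ j (d : Dec (ρ k ≡ j)) → ρ k ≢ j → (if ⌊ d ⌋ then 1# else 0#) ⊗ b j ≡ 0#
    off j (yes eq) ρk≢j = contradiction eq ρk≢j
    off j (no _)   _    = K.zeroˡ (b j)
    on : (d : Dec (ρ k ≡ ρ k)) → (if ⌊ d ⌋ then 1# else 0#) ⊗ b (ρ k) ≡ b (ρ k)
    on (yes _) = K.*-identityˡ _
    on (no ≢)  = contradiction refl ≢

  permuted-product : ∀ {ℓ m} (A : Matrix ℓ m) ρ (B : Matrix m 1) i →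
    ((A · permMatrix ρ) · B) i Fin.zero ≡ dot (A i) (λ j → B (ρ j) Fin.zero)
  -- `dot-comb` acts as associativity here, (Aρ)B = A(ρB).
  permuted-product {ℓ} {m} A ρ B i = trans (dot-comb (A i) (permMatrix ρ) (λ j → B j Fin.zero))
    (sumF-cong m (λ k → cong (A i k ⊗_) (dot-permMatrix ρ k (λ j → B j Fin.zero))))

  ⟦isZeroMatrix⟧ : ∀ {ℓ m} (A : Matrix ℓ m) ρ (B : Matrix m 1) →
    ⟦ isZeroMatrix ((A · permMatrix ρ) · B) Bool.≟ true ⟧ ≡ ⟦ killed? A (λ j → B (ρ j) Fin.zero) ⟧
  ⟦isZeroMatrix⟧ A ρ B = ⟦⟧-cong (isZeroMatrix ((A · permMatrix ρ) · B) Bool.≟ true) (killed? A (λ j → B (ρ j) Fin.zero))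
    (λ product≡0 i → trans (sym (permuted-product A ρ B i)) (isZeroMatrix⁻ {M = (A · permMatrix ρ) · B} product≡0 i Fin.zero))
    (λ killed → isZeroMatrix⁺ {M = (A · permMatrix ρ) · B} λ { i Fin.zero → trans (permuted-product A ρ B i) (killed i) })

  ∑-admissibleA : ∀ ℓ m π (B : Matrix m 1) h →
    ∑ (admissibleA ℓ m π B) h
      ≡ ∑ (allMatrices ℓ m) (λ A → ⟦ independent? A ×-dec killed? A (λ j → B (π j) Fin.zero) ⟧ * h A)
  ∑-admissibleA ℓ m π B h = trans (∑-filter _ (allMatrices ℓ m) h) (∑-cong (allMatrices ℓ m) (λ A → cong (_* h A)
    (⟦⟧-cong ((hasFullRowRank A ∧ isZeroMatrix ((A · permMatrix π) · B)) Bool.≟ true)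
             (independent? A ×-dec killed? A (λ j → B (π j) Fin.zero))
      (λ both → let full , product≡0 = ∧-true⁻ (hasFullRowRank A) _ both in
        hasFullRowRank⁻ full , λ i → trans (sym (permuted-product A π B i)) (isZeroMatrix⁻ {M = (A · permMatrix π) · B} product≡0 i Fin.zero))
      (λ (ind , killed) → cong₂ _∧_ (hasFullRowRank⁺ ind)
        (isZeroMatrix⁺ {M = (A · permMatrix π) · B} λ { i Fin.zero → trans (permuted-product A π B i) (killed i) })))))

  length-admissibleA : ∀ ℓ {k} π (B : Matrix (suc k) 1) → B (π Fin.zero) Fin.zero ≢ 0# →
    length (admissibleA ℓ (suc k) π B) ≡ frameCount q (q ^ k) ℓ
  length-admissibleA ℓ {k} π B x₀≢0 = begin
    length (admissibleA ℓ (suc k) π B)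
      ≡⟨ sym (trans (∑-const (admissibleA ℓ (suc k) π B) 1) (*-identityʳ _)) ⟩
    ∑ (admissibleA ℓ (suc k) π B) (const 1)
      ≡⟨ ∑-admissibleA ℓ (suc k) π B (const 1) ⟩
    ∑ (allMatrices ℓ (suc k)) (λ A → ⟦ independent? A ×-dec killed? A (λ j → B (π j) Fin.zero) ⟧ * 1)
      ≡⟨ ∑-cong (allMatrices ℓ (suc k)) (λ A → *-identityʳ ⟦ independent? A ×-dec killed? A (λ j → B (π j) Fin.zero) ⟧) ⟩
    ∑ (allMatrices ℓ (suc k)) (λ A → ⟦ independent? A ×-dec killed? A (λ j → B (π j) Fin.zero) ⟧)
      ≡⟨ ∑-annihilators ℓ (λ j → B (π j) Fin.zero) x₀≢0 ⟩
    frameCount q (q ^ k) ℓ ∎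
    where open ≡-Reasoning

  -- Counts the pairs (ρ, t) with ρB = t πB. When πB has a nonzero entry, t is determined by ρ, so
  -- this is the number of ρ whose ρB is a multiple of πB.
  multiples : ∀ {m} → (Fin m → Fin m) → Vector m → ℕ
  multiples {m} π b = ∑ (Sym m) (λ ρ → ∑ (allFin q) (λ t → ⟦ multiple? (b ∘ π) (b ∘ ρ) t ⟧))

  -- The sum over A is moved inside the sum over ρ, where each ρ asks for the matrices killing both
  -- πB and ρB. In the result only `multiples` still depends on π and B.
  ∑-Nsol : ∀ ℓ {k} π (B : Matrix (2 + k) 1) → B (π Fin.zero) Fin.zero ≢ 0# → ℓ ≤ suc k → 1 ≤ q →
    (q ^ (2 + k) ∸ q) * ∑ (admissibleA ℓ (2 + k) π B) (λ A → Nsol A B)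
      ≡ frameCount q (q ^ suc k) ℓ *
        ((2 + k) ! * (q ^ (2 + k ∸ ℓ) ∸ q) + (q ^ (2 + k) ∸ q ^ (2 + k ∸ ℓ)) * multiples π (λ i → B i Fin.zero))
  ∑-Nsol ℓ {k} π B x₀≢0 ℓ≤k+1 1≤q = begin
    D * ∑ (admissibleA ℓ (2 + k) π B) (λ A → Nsol A B)
      ≡⟨ cong (D *_) (∑-admissibleA ℓ (2 + k) π B (λ A → Nsol A B)) ⟩
    D * ∑ M (λ A → ⟦ adm? A ⟧ * Nsol A B)
      ≡⟨ cong (D *_) (∑-cong M (λ A → trans
           (cong (⟦ adm? A ⟧ *_) (trans (length-filter-∑ _ (Sym (2 + k))) (∑-cong (Sym (2 + k)) (λ ρ → ⟦isZeroMatrix⟧ A ρ B))))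
           (trans (sym (∑-*ˡ (Sym (2 + k)) ⟦ adm? A ⟧ _))
             (∑-cong (Sym (2 + k)) (λ ρ → sym (⟦⟧-× (adm? A) (killed? A (b ∘ ρ)))))))) ⟩
    D * ∑ M (λ A → ∑ (Sym (2 + k)) (λ ρ → ⟦ adm? A ×-dec killed? A (b ∘ ρ) ⟧))
      ≡⟨ cong (D *_) (∑-swap M (Sym (2 + k)) _) ⟩
    D * ∑ (Sym (2 + k)) (λ ρ → ∑ M (λ A → ⟦ adm? A ×-dec killed? A (b ∘ ρ) ⟧))
      ≡⟨ sym (∑-*ˡ (Sym (2 + k)) D _) ⟩
    ∑ (Sym (2 + k)) (λ ρ → D * ∑ M (λ A → ⟦ adm? A ×-dec killed? A (b ∘ ρ) ⟧))
      ≡⟨ ∑-cong (Sym (2 + k)) (λ ρ → ∑-annihilators-pair ℓ (b ∘ π) (b ∘ ρ) x₀≢0 ℓ≤k+1 1≤q) ⟩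
    ∑ (Sym (2 + k)) (λ ρ → N * (U + R * scalars ρ))
      ≡⟨ trans (∑-*ˡ (Sym (2 + k)) N _) (cong (N *_) (trans (∑-+ (Sym (2 + k)) (const U) _)
           (cong₂ _+_ (trans (∑-const (Sym (2 + k)) U) (cong (_* U) (length-Sym (2 + k)))) (∑-*ˡ (Sym (2 + k)) R scalars)))) ⟩
    N * ((2 + k) ! * U + R * multiples π b) ∎
    where
    open ≡-Reasoning
    M = allMatrices ℓ (2 + k)
    D = q ^ (2 + k) ∸ q
    U = q ^ (2 + k ∸ ℓ) ∸ q
    R = q ^ (2 + k) ∸ q ^ (2 + k ∸ ℓ)
    N = frameCount q (q ^ suc k) ℓ
    b : Vector (2 + k)
    b i = B i Fin.zero
    adm? : (A : Matrix ℓ (2 + k)) → Dec (Independent A × ∀ i → dot (A i) (b ∘ π) ≡ 0#)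
    adm? A = independent? A ×-dec killed? A (b ∘ π)
    scalars : (Fin (2 + k) → Fin (2 + k)) → ℕ
    scalars ρ = ∑ (allFin q) (λ t → ⟦ multiple? (b ∘ π) (b ∘ ρ) t ⟧)

  module _ (1≤n : 1 ≤ q ∸ 1) {g : Fin q} (g-order : IsOrder g (q ∸ 1)) where
    open InvariantSubsets F 1≤n g g-order

    closed? : ∀ {m} (b : Vector m) t → Dec (∀ i → ∃ λ j → b j ≡ t ⊗ b i)
    closed? b t = Finₚ.all? (λ i → image? b (t ⊗ b i))

    -- For a fixed scalar at most one ρ fits, and the scalar 0 never does because the entries are
    -- nonzero. The outcome no longer mentions π.
    multiples-by-scalar : ∀ {m} {π : Fin (suc m) → Fin (suc m)} → Inj π → ∀ {b} → Inj b × (∀ i → b i ≢ 0#) →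
      multiples π b ≡ ∑ (range n) (λ k → ⟦ closed? b (g ↑ k) ⟧)
    multiples-by-scalar {m} {π} π-inj {b} (b-inj , b≢0) = begin
      ∑ (Sym (suc m)) (λ ρ → ∑ (allFin q) (λ t → ⟦ multiple? (b ∘ π) (b ∘ ρ) t ⟧))
        ≡⟨ ∑-swap (Sym (suc m)) (allFin q) _ ⟩
      ∑ (allFin q) (λ t → ∑ (Sym (suc m)) (λ ρ → ⟦ multiple? (b ∘ π) (b ∘ ρ) t ⟧))
        ≡⟨ ∑-powers _ ⟩
      ∑ (Sym (suc m)) (λ ρ → ⟦ multiple? (b ∘ π) (b ∘ ρ) 0# ⟧)
        + ∑ (range n) (λ k → ∑ (Sym (suc m)) (λ ρ → ⟦ multiple? (b ∘ π) (b ∘ ρ) (g ↑ k) ⟧))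
        ≡⟨ cong₂ _+_
             (∑-no (Sym (suc m)) (λ ρ → multiple? (b ∘ π) (b ∘ ρ) 0#)
               (λ ρ eq → b≢0 (ρ Fin.zero) (trans (eq Fin.zero) (K.zeroˡ _))))
             (∑-cong (range n) (λ k → ∑-Sym-matching b-inj
               (λ i j eq → b-inj i j (⊗-cancelˡ (g↑≢0 k) eq)) π-inj)) ⟩
      ∑ (range n) (λ k → ⟦ closed? b (g ↑ k) ⟧) ∎
      where open ≡-Reasoning

    -- Both conditions concern only the set of entries, which lets columns be traded for subsets.
    star-closed : ∀ {m} (b : Vector m) t →
      ⟦ star? b ⟧ * ⟦ closed? b t ⟧ ≡ ⟦ inj? b ×-dec invariant? t (image b) ⟧
    star-closed b t = trans (sym (⟦⟧-× (star? b) (closed? b t))) (⟦⟧-cong _ (inj? b ×-dec invariant? t (image b))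
      (λ ((inj , b≢0) , closed) → inj , dec-false (image? b 0#) (λ (i , bi≡0) → b≢0 i bi≡0)
        , λ x x∈ → let i , bi≡x = image⁻ b x x∈ in
            dec-true (image? b (t ⊗ x)) (subst (λ y → ∃ λ j → b j ≡ t ⊗ y) bi≡x (closed i)))
      (λ (inj , 0∉ , inv) → (inj , λ i bi≡0 → contradiction
          (trans (sym 0∉) (subst (λ y → image b y ≡ true) bi≡0 (image⁺ b i))) λ ())
        , λ i → image⁻ b (t ⊗ b i) (inv (b i) (image⁺ b i))))

    ∑-multiples : ∀ m {π : Fin (suc m) → Fin (suc m)} → Inj π →
      ∑ (starColumns (suc m)) (λ B → multiples π (λ i → B i Fin.zero))
        ≡ suc m ! * ∑ (divisors (gcd n (suc m))) (λ d → totient d * ((n div d) C (suc m div d)))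
    ∑-multiples m {π} π-inj = begin
      ∑ (starColumns (suc m)) (λ B → multiples π (λ i → B i Fin.zero))
        ≡⟨ ∑-starColumns (suc m) (multiples π) multiples-cong ⟩
      ∑ V (λ b → ⟦ star? b ⟧ * multiples π b)
        ≡⟨ ∑-cong V (λ b → trans (⟦⟧*-cong (star? b) (multiples-by-scalar π-inj))
             (trans (sym (∑-*ˡ (range n) ⟦ star? b ⟧ _)) (∑-cong (range n) (λ k → star-closed b (g ↑ k))))) ⟩
      ∑ V (λ b → ∑ (range n) (λ k → ⟦ inj? b ×-dec invariant? (g ↑ k) (image b) ⟧))
        ≡⟨ ∑-swap V (range n) _ ⟩
      ∑ (range n) (λ k → ∑ V (λ b → ⟦ inj? b ×-dec invariant? (g ↑ k) (image b) ⟧))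
        ≡⟨ ∑-cong (range n) (λ k → ∑-injections-by-image {suc m} (invariant? (g ↑ k)) (Invariant-resp {g ↑ k})) ⟩
      ∑ (range n) (λ k → suc m ! * ∑ᴱ (subsets q) (λ S → ⟦ (∣ S ∣ ℕ.≟ suc m) ×-dec invariant? (g ↑ k) S ⟧))
        ≡⟨ ∑-*ˡ (range n) (suc m !) _ ⟩
      suc m ! * ∑ (range n) (λ k → ∑ᴱ (subsets q) (λ S → ⟦ (∣ S ∣ ℕ.≟ suc m) ×-dec invariant? (g ↑ k) S ⟧))
        -- The number of invariant subsets depends on the exponent k only through the order d =
        -- n/gcd(k, n) of g^k, so exponents are grouped by d.
        ≡⟨ cong (suc m ! *_) (∑-by-gcd 1≤n (λ d → ⟦ d ∣? suc m ⟧ * ((n div d) C (suc m div d))) _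
             (λ {k} {d} _ d*e≡n → ∑-invariant-subsets k d d*e≡n (suc m))) ⟩
      suc m ! * ∑ (divisors n) (λ d → totient d * (⟦ d ∣? suc m ⟧ * ((n div d) C (suc m div d))))
        ≡⟨ cong (suc m ! *_) (∑-cong (divisors n) (λ d → *-swapˡ (totient d) ⟦ d ∣? suc m ⟧ ((n div d) C (suc m div d)))) ⟩
      suc m ! * ∑ (divisors n) (λ d → ⟦ d ∣? suc m ⟧ * (totient d * ((n div d) C (suc m div d))))
        ≡⟨ cong (suc m ! *_) (∑-common-divisors (suc m) 1≤n _) ⟩
      suc m ! * ∑ (divisors (gcd n (suc m))) (λ d → totient d * ((n div d) C (suc m div d))) ∎
      where
      open ≡-Reasoning
      V = elements (vectors (suc m))
      multiples-cong : ∀ {b c} → b ≗ c → multiples π b ≡ multiples π c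
      multiples-cong {b} {c} b≗c = ∑-cong (Sym (suc m)) (λ ρ → ∑-cong (allFin q) (λ t →
        ⟦⟧-cong (multiple? (b ∘ π) (b ∘ ρ) t) (multiple? (c ∘ π) (c ∘ ρ) t)
          (λ eq i → trans (sym (b≗c _)) (trans (eq i) (cong (t ⊗_) (b≗c _))))
          (λ eq i → trans (b≗c _) (trans (eq i) (cong (t ⊗_) (sym (b≗c _)))))))

-- Averages of rational numbers

opaque
  -- An opaque copy of ℕtoℚ, whose gcd normalisation would otherwise unfold during unification.
  ι : ℕ → ℚ
  ι = ℕtoℚ

  ι≡ℕtoℚ : ∀ a → ι a ≡ ℕtoℚ a
  ι≡ℕtoℚ a = refl

  ι-+ : ∀ a b → ι (a + b) ≡ ι a ℚ.+ ι b
  ι-+ a b = ℚₚ.toℚᵘ-injective (begin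
    ℚ.toℚᵘ (ι (a + b))                           ≈⟨ ℚₚ.toℚᵘ-fromℚᵘ (ℚᵘ.mkℚᵘ (ℤ.+ (a + b)) 0) ⟩
    ℚᵘ.mkℚᵘ (ℤ.+ (a + b)) 0                           ≈⟨ ℚᵘ.*≡* (cong (ℤ._* ℤ.+ 1) (sym (cong₂ ℤ._+_ (ℤₚ.*-identityʳ (ℤ.+ a)) (ℤₚ.*-identityʳ (ℤ.+ b))))) ⟩
    ℚᵘ.mkℚᵘ (ℤ.+ a) 0 ℚᵘ.+ ℚᵘ.mkℚᵘ (ℤ.+ b) 0            ≈⟨ ℚᵘₚ.+-cong (ℚₚ.toℚᵘ-fromℚᵘ (ℚᵘ.mkℚᵘ (ℤ.+ a) 0)) (ℚₚ.toℚᵘ-fromℚᵘ (ℚᵘ.mkℚᵘ (ℤ.+ b) 0)) ⟨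
    ℚ.toℚᵘ (ι a) ℚᵘ.+ ℚ.toℚᵘ (ι b)            ≈⟨ ℚₚ.toℚᵘ-homo-+ (ι a) (ι b) ⟨
    ℚ.toℚᵘ (ι a ℚ.+ ι b)                      ∎)
    where open import Relation.Binary.Reasoning.Setoid ℚᵘₚ.≃-setoid

  ι-* : ∀ a b → ι (a * b) ≡ ι a ℚ.* ι b
  ι-* a b = ℚₚ.toℚᵘ-injective (begin
    ℚ.toℚᵘ (ι (a * b))                           ≈⟨ ℚₚ.toℚᵘ-fromℚᵘ (ℚᵘ.mkℚᵘ (ℤ.+ (a * b)) 0) ⟩
    ℚᵘ.mkℚᵘ (ℤ.+ (a * b)) 0                           ≈⟨ ℚᵘ.*≡* (cong (ℤ._* ℤ.+ 1) (ℤₚ.pos-* a b)) ⟩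
    ℚᵘ.mkℚᵘ (ℤ.+ a) 0 ℚᵘ.* ℚᵘ.mkℚᵘ (ℤ.+ b) 0            ≈⟨ ℚᵘₚ.*-cong (ℚₚ.toℚᵘ-fromℚᵘ (ℚᵘ.mkℚᵘ (ℤ.+ a) 0)) (ℚₚ.toℚᵘ-fromℚᵘ (ℚᵘ.mkℚᵘ (ℤ.+ b) 0)) ⟨
    ℚ.toℚᵘ (ι a) ℚᵘ.* ℚ.toℚᵘ (ι b)            ≈⟨ ℚₚ.toℚᵘ-homo-* (ι a) (ι b) ⟨
    ℚ.toℚᵘ (ι a ℚ.* ι b)                      ∎)
    where open import Relation.Binary.Reasoning.Setoid ℚᵘₚ.≃-setoid

  ι≢0 : ∀ {a} → a ≢ 0 → ι a ≢ 0ℚ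
  ι≢0 {a} a≢0 eq with ℚₚ.fromℚᵘ-injective {ℚᵘ.mkℚᵘ (ℤ.+ a) 0} {ℚᵘ.mkℚᵘ (ℤ.+ 0) 0} eq
  ... | ℚᵘ.*≡* a*1≡0 = a≢0 (ℤₚ.+-injective (trans (sym (ℤₚ.*-identityʳ (ℤ.+ a))) a*1≡0))

ι-∸ : ∀ {a b} → b ≤ a → ι (a ∸ b) ≡ ι a ℚ.- ι b
ι-∸ {a} {b} b≤a = begin
  ι (a ∸ b)                                    ≡⟨ solve 2 (λ x y → x := x :+ y :- y) refl (ι (a ∸ b)) (ι b) ⟩
  ι (a ∸ b) ℚ.+ ι b ℚ.- ι b              ≡⟨ cong (ℚ._- ι b) (trans (sym (ι-+ (a ∸ b) b)) (cong ι (m∸n+n≡m b≤a))) ⟩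
  ι a ℚ.- ι b                               ∎
  where
  open ≡-Reasoning
  open Data.Rational.Solver.+-*-Solver using (solve; _:+_; _:-_; _:=_)

÷′-* : ∀ {p r} → r ≢ 0ℚ → (p ÷' r) ℚ.* r ≡ p
÷′-* {p} {r} r≢0 with r ℚₚ.≟ 0ℚ
... | yes r≡0 = contradiction r≡0 r≢0
... | no r≢0′ = trans (ℚₚ.*-assoc p _ r) (trans (cong (p ℚ.*_) (ℚₚ.*-inverseˡ r {{ℚ.≢-nonZero r≢0′}})) (ℚₚ.*-identityʳ p))

*-÷′ : ∀ {x r} → r ≢ 0ℚ → (x ℚ.* r) ÷' r ≡ x
*-÷′ {x} {r} r≢0 with r ℚₚ.≟ 0ℚ
... | yes r≡0 = contradiction r≡0 r≢0
... | no r≢0′ = trans (ℚₚ.*-assoc x r _) (trans (cong (x ℚ.*_) (ℚₚ.*-inverseʳ r {{ℚ.≢-nonZero r≢0′}})) (ℚₚ.*-identityʳ x))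

÷′-unique : ∀ {p r x} → r ≢ 0ℚ → x ℚ.* r ≡ p → p ÷' r ≡ x
÷′-unique r≢0 refl = *-÷′ r≢0

*-cancelʳ-ℚ : ∀ {r x y} → r ≢ 0ℚ → x ℚ.* r ≡ y ℚ.* r → x ≡ y
*-cancelʳ-ℚ {r} r≢0 eq = trans (sym (*-÷′ r≢0)) (trans (cong (_÷' r) eq) (*-÷′ r≢0))

*≢0-ℚ : ∀ {r s} → r ≢ 0ℚ → s ≢ 0ℚ → r ℚ.* s ≢ 0ℚ
*≢0-ℚ {r} {s} r≢0 s≢0 eq = r≢0 (*-cancelʳ-ℚ s≢0 (trans eq (sym (ℚₚ.*-zeroˡ s))))

÷′-cross : ∀ {x n d y} → n ≢ 0 → d ≢ 0 → d * x ≡ n * y → ι x ÷' ι n ≡ ι y ÷' ι d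
÷′-cross {x} {n} {d} {y} n≢0 d≢0 eq = ÷′-unique (ι≢0 n≢0) (*-cancelʳ-ℚ (ι≢0 d≢0) (begin
  (ι y ÷' ι d) ℚ.* ι n ℚ.* ι d    ≡⟨ solve 3 (λ a n d → a :* n :* d := a :* d :* n) refl (ι y ÷' ι d) (ι n) (ι d) ⟩
  (ι y ÷' ι d) ℚ.* ι d ℚ.* ι n    ≡⟨ cong (ℚ._* ι n) (÷′-* (ι≢0 d≢0)) ⟩
  ι y ℚ.* ι n                           ≡⟨ sym (ι-* y n) ⟩
  ι (y * n)                                ≡⟨ cong ι (trans (*-comm y n) (trans (sym eq) (*-comm d x))) ⟩
  ι (x * d)                                ≡⟨ ι-* x d ⟩
  ι x ℚ.* ι d                           ∎))
  where
  open ≡-Reasoning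
  open Data.Rational.Solver.+-*-Solver using (solve; _:*_; _:=_)

sumℚ-map-cong : ∀ (xs : List A) {f g : A → ℚ} → (∀ {x} → x ∈ xs → f x ≡ g x) → sumℚ (map f xs) ≡ sumℚ (map g xs)
sumℚ-map-cong []       f≡g = refl
sumℚ-map-cong (x ∷ xs) f≡g = cong₂ ℚ._+_ (f≡g (here refl)) (sumℚ-map-cong xs (f≡g ∘ there))

sumℚ-map-* : ∀ (xs : List A) (f : A → ℚ) r → sumℚ (map (λ x → f x ℚ.* r) xs) ≡ sumℚ (map f xs) ℚ.* r
sumℚ-map-* []       f r = sym (ℚₚ.*-zeroˡ r)
sumℚ-map-* (x ∷ xs) f r = trans (cong (f x ℚ.* r ℚ.+_) (sumℚ-map-* xs f r)) (sym (ℚₚ.*-distribʳ-+ r (f x) _))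

sumℚ-ι : ∀ (xs : List A) f → sumℚ (map (λ x → ι (f x)) xs) ≡ ι (∑ xs f)
sumℚ-ι []       f = sym (ι≡ℕtoℚ 0)
sumℚ-ι (x ∷ xs) f = trans (cong (ι (f x) ℚ.+_) (sumℚ-ι xs f)) (sym (ι-+ (f x) _))

average-cong : ∀ (xs : List A) {f g : A → ℚ} → (∀ {x} → x ∈ xs → f x ≡ g x) → average xs f ≡ average xs g
average-cong xs f≡g = cong (_÷' ℕtoℚ (length xs)) (sumℚ-map-cong xs f≡g)

average-ℕtoℚ : ∀ (xs : List A) f → average xs (λ x → ℕtoℚ (f x)) ≡ ι (∑ xs f) ÷' ι (length xs)
average-ℕtoℚ xs f = cong₂ _÷'_
  (trans (sumℚ-map-cong xs (λ {x} _ → sym (ι≡ℕtoℚ (f x)))) (sumℚ-ι xs f)) (sym (ι≡ℕtoℚ (length xs)))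

average-unique : ∀ (xs : List A) (f : A → ℚ) → length xs ≢ 0 → ∀ {r} →
  r ℚ.* ι (length xs) ≡ sumℚ (map f xs) → average xs f ≡ r
average-unique xs f ≢0 eq = trans (cong (sumℚ (map f xs) ÷'_) (sym (ι≡ℕtoℚ (length xs)))) (÷′-unique (ι≢0 ≢0) eq)

average-const : ∀ (xs : List A) → length xs ≢ 0 → ∀ r → average xs (const r) ≡ r
average-const xs ≢0 r = average-unique xs (const r) ≢0 (sym (begin
  sumℚ (map (const r) xs)                                    ≡⟨ sumℚ-map-cong xs (λ _ → sym (ℚₚ.*-identityˡ r)) ⟩
  sumℚ (map (λ x → 1ℚ ℚ.* r) xs)                             ≡⟨ sumℚ-map-* xs (const 1ℚ) r ⟩
  sumℚ (map (const 1ℚ) xs) ℚ.* r                             ≡⟨ cong (ℚ._* r) (trans (sumℚ-map-cong xs (λ _ → sym (ι≡ℕtoℚ 1)))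
                                                                  (trans (sumℚ-ι xs (const 1))
                                                                  (cong ι (trans (∑-const xs 1) (*-identityʳ (length xs)))))) ⟩
  ι (length xs) ℚ.* r                                        ≡⟨ ℚₚ.*-comm (ι (length xs)) r ⟩
  r ℚ.* ι (length xs)                                        ∎))
  where open ≡-Reasoning

average-scaled : ∀ (xs : List A) (f : A → ℕ) {d} → d ≢ 0 → length xs ≢ 0 → ∀ {r} →
  r ℚ.* (ι (length xs) ℚ.* ι d) ≡ ι (∑ xs f) →
  average xs (λ x → ι (f x) ÷' ι d) ≡ r
average-scaled xs f {d} d≢0 ≢0 {r} eq = average-unique xs _ ≢0 (*-cancelʳ-ℚ (ι≢0 d≢0) (begin
  r ℚ.* ι (length xs) ℚ.* ι d                              ≡⟨ trans (ℚₚ.*-assoc r _ _) eq ⟩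
  ι (∑ xs f)                                               ≡⟨ sym (sumℚ-ι xs f) ⟩
  sumℚ (map (λ x → ι (f x)) xs)                            ≡⟨ sumℚ-map-cong xs (λ _ → sym (÷′-* (ι≢0 d≢0))) ⟩
  sumℚ (map (λ x → (ι (f x) ÷' ι d) ℚ.* ι d) xs)           ≡⟨ sumℚ-map-* xs _ (ι d) ⟩
  sumℚ (map (λ x → ι (f x) ÷' ι d) xs) ℚ.* ι d             ∎))
  where open ≡-Reasoning

-- Assembling the expectation

-- Here M = m!, D = q^m − q, U = q^(m−ℓ) − q, R = q^m − q^(m−ℓ), W is the binomial
-- coefficient and Z the divisor sum.
clear-denominators : ∀ {M U D R W Z} → D ≢ 0ℚ → W ≢ 0ℚ →
  (((M ℚ.* U) ÷' D) ℚ.+ (R ÷' (D ℚ.* W)) ℚ.* Z) ℚ.* ((M ℚ.* W) ℚ.* D)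
    ≡ (M ℚ.* W) ℚ.* (M ℚ.* U) ℚ.+ R ℚ.* (M ℚ.* Z)
clear-denominators {M} {U} {D} {R} {W} {Z} D≢0 W≢0 = begin
  (a ℚ.+ b ℚ.* Z) ℚ.* ((M ℚ.* W) ℚ.* D)
    ≡⟨ solve 6 (λ a b Z M W D → (a :+ b :* Z) :* ((M :* W) :* D) := (M :* W) :* (a :* D) :+ b :* (D :* W) :* (M :* Z)) refl a b Z M W D ⟩
  (M ℚ.* W) ℚ.* (a ℚ.* D) ℚ.+ b ℚ.* (D ℚ.* W) ℚ.* (M ℚ.* Z)
    ≡⟨ cong₂ (λ s t → (M ℚ.* W) ℚ.* s ℚ.+ t ℚ.* (M ℚ.* Z)) (÷′-* D≢0) (÷′-* (*≢0-ℚ D≢0 W≢0)) ⟩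
  (M ℚ.* W) ℚ.* (M ℚ.* U) ℚ.+ R ℚ.* (M ℚ.* Z) ∎
  where
  open ≡-Reasoning
  open Data.Rational.Solver.+-*-Solver using (solve; _:+_; _:*_; _:=_)
  a = (M ℚ.* U) ÷' D
  b = R ÷' (D ℚ.* W)

-- The average over B and A has the same value for every π, so the outermost average is over a
-- constant.
expectedNsol-unique : ∀ {q} (F : FiniteField q) ℓ m {r} →
  (∀ {π} → π ∈ Sym m → average (MatrixOps.starColumns F m) (λ B → average (MatrixOps.admissibleA F ℓ m π B) (λ A → ℕtoℚ (MatrixOps.Nsol F A B))) ≡ r) →
  length (Sym m) ≢ 0 → expectedNsol F ℓ m ≡ r
expectedNsol-unique F ℓ m {r} constant ≢0 = trans (average-cong (Sym m) {g = const r} constant) (average-const (Sym m) ≢0 r)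

module Expectation {q : ℕ} (F : FiniteField q) ℓ k (ℓ≤k+1 : ℓ ≤ suc k) (m<q : 2 + k < q) where
  open FieldProperties F
  open Multiplicative F
  open Counting F

  private
    m n D U R Z : ℕ
    m = 2 + k
    n = q ∸ 1
    D = q ^ m ∸ q
    U = q ^ (m ∸ ℓ) ∸ q
    R = q ^ m ∸ q ^ (m ∸ ℓ)
    Z = ∑ (divisors (gcd n m)) (λ d → totient d * ((n div d) C (m div d)))

    2≤q : 2 ≤ q
    2≤q = ≤-trans (s≤s (s≤s z≤n)) (<⇒≤ m<q)

    1≤q : 1 ≤ q
    1≤q = <⇒≤ 2≤q

    instance
      q-nonZero : NonZero q
      q-nonZero = ℕ.>-nonZero 1≤q

    m≤n : m ≤ n
    m≤n = ∸-monoˡ-≤ 1 m<q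

    1≤n : 1 ≤ n
    1≤n = ≤-trans (s≤s z≤n) m≤n

    q<q^m : q < q ^ m
    q<q^m = subst (_< q ^ m) (*-identityʳ q) (^-monoʳ-< q 2≤q (s≤s (s≤s (z≤n {k}))))

    q≤q^[m-ℓ] : q ≤ q ^ (m ∸ ℓ)
    q≤q^[m-ℓ] = ≤-trans (≤-reflexive (sym (*-identityʳ q))) (^-monoʳ-≤ q (m<n⇒0<n∸m (s≤s ℓ≤k+1)))

    q^[m-ℓ]≤q^m : q ^ (m ∸ ℓ) ≤ q ^ m
    q^[m-ℓ]≤q^m = ^-monoʳ-≤ q (m∸n≤m m ℓ)

    D≢0 : D ≢ 0
    D≢0 D≡0 = <⇒≱ q<q^m (m∸n≡0⇒m≤n D≡0)

    -- The number of columns averaged over; m < q makes it nonzero.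
    m!*C≢0 : m ! * (n C m) ≢ 0
    m!*C≢0 eq = falling≢0 m≤n (trans (falling≡!*C m≤n) eq)

    C≢0 : n C m ≢ 0
    C≢0 eq = m!*C≢0 (trans (cong (m ! *_) eq) (*-zeroʳ (m !)))

    numerator : (Fin m → Fin m) → Matrix m 1 → ℕ
    numerator π B = m ! * U + R * multiples π (λ i → B i Fin.zero)

  -- Qualified names and an unabbreviated m keep the types below syntactically equal to
  -- the unfolding of expectedNsol; otherwise conversion checking evaluates the enumerations.
  average-Nsol : ∀ π {B} → B ∈ MatrixOps.starColumns F (suc (suc k)) →
    average (MatrixOps.admissibleA F ℓ (suc (suc k)) π B) (λ A → ℕtoℚ (MatrixOps.Nsol F A B)) ≡ ι (numerator π B) ÷' ι D
  average-Nsol π {B} B∈ = trans (average-ℕtoℚ (MatrixOps.admissibleA F ℓ (suc (suc k)) π B) (λ A → MatrixOps.Nsol F A B))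
    (trans (cong (λ s → ι (∑ (admissibleA ℓ m π B) (λ A → Nsol A B)) ÷' ι s) (length-admissibleA ℓ π B x₀≢0))
    -- `∑-Nsol` says that D times the sum equals N times the numerator, N being the number of
    -- admissible A; dividing by N and D gives the average.
    (÷′-cross (frameCount≢0 q 2≤q (suc k) ℓ ℓ≤k+1) D≢0 (∑-Nsol ℓ π B x₀≢0 ℓ≤k+1 1≤q)))
    where
    star : isStarColumn B ≡ true
    star = proj₂ (∈-filter⁻ (λ B → isStarColumn B Bool.≟ true) {xs = allMatrices m 1} B∈)
    x₀≢0 : B (π Fin.zero) Fin.zero ≢ 0#
    x₀≢0 = proj₂ (isStarColumn⁻ {B = B} star) (π Fin.zero)

  ∑-numerator : ∀ {π} → Inj π → ∑ (starColumns m) (numerator π) ≡ (m ! * (n C m)) * (m ! * U) + R * (m ! * Z)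
  ∑-numerator {π} π-inj = let g , g-order = primitive-element 1≤n in trans (∑-+ (starColumns m) (const (m ! * U)) _)
    (cong₂ _+_
      (trans (∑-const (starColumns m) (m ! * U)) (cong (_* (m ! * U)) (length-starColumns m≤n)))
      (trans (∑-*ˡ (starColumns m) R _) (cong (R *_) (∑-multiples 1≤n g-order (suc k) π-inj))))

  private
    rhs≡ : rhs q ℓ m ≡ ((ι (m !) ℚ.* ι U) ÷' ι D) ℚ.+ (ι R ÷' (ι D ℚ.* ι (n C m))) ℚ.* ι Z
    rhs≡ = sym (substitute (ι≡ℕtoℚ (m !)) (ι-∸′ q≤q^[m-ℓ]) (ι-∸′ (<⇒≤ q<q^m)) (ι-∸′ q^[m-ℓ]≤q^m) (ι≡ℕtoℚ (n C m))
      (trans (sym (sumℚ-ι divs f)) (sumℚ-map-cong divs (λ {d} _ → ι≡ℕtoℚ (f d)))))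
      where
      divs = divisors (gcd n m)
      f : ℕ → ℕ
      f d = totient d * ((n div d) C (m div d))
      ι-∸′ : ∀ {a b} → b ≤ a → ι (a ∸ b) ≡ ℕtoℚ a ℚ.- ℕtoℚ b
      ι-∸′ {a} {b} b≤a = trans (ι-∸ b≤a) (cong₂ ℚ._-_ (ι≡ℕtoℚ a) (ι≡ℕtoℚ b))
      substitute : ∀ {M M′ U U′ D D′ R R′ W W′ Z Z′ : ℚ} → M ≡ M′ → U ≡ U′ → D ≡ D′ → R ≡ R′ → W ≡ W′ → Z ≡ Z′ →
        ((M ℚ.* U) ÷' D) ℚ.+ (R ÷' (D ℚ.* W)) ℚ.* Z ≡ ((M′ ℚ.* U′) ÷' D′) ℚ.+ (R′ ÷' (D′ ℚ.* W′)) ℚ.* Z′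
      substitute refl refl refl refl refl refl = refl

  average-over-columns : ∀ {π} → Inj π →
    average (MatrixOps.starColumns F (suc (suc k))) (λ B →
      average (MatrixOps.admissibleA F ℓ (suc (suc k)) π B) (λ A → ℕtoℚ (MatrixOps.Nsol F A B)))
        ≡ rhs q ℓ (suc (suc k))
  average-over-columns {π} π-inj = trans
    (average-cong (MatrixOps.starColumns F (suc (suc k)))
      {λ B → average (MatrixOps.admissibleA F ℓ (suc (suc k)) π B) (λ A → ℕtoℚ (MatrixOps.Nsol F A B))}
      {λ B → ι (numerator π B) ÷' ι D} (average-Nsol π))
    (average-scaled (starColumns m) (numerator π) D≢0
    (λ eq → m!*C≢0 (trans (sym (length-starColumns m≤n)) eq)) equation)
    where
    open ≡-Reasoning
    equation : rhs q ℓ m ℚ.* (ι (length (starColumns m)) ℚ.* ι D) ≡ ι (∑ (starColumns m) (numerator π))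
    equation = begin
      rhs q ℓ m ℚ.* (ι (length (starColumns m)) ℚ.* ι D)
        ≡⟨ cong₂ (λ r s → r ℚ.* (s ℚ.* ι D)) rhs≡ (trans (cong ι (length-starColumns m≤n)) (ι-* (m !) (n C m))) ⟩
      (((ι (m !) ℚ.* ι U) ÷' ι D) ℚ.+ (ι R ÷' (ι D ℚ.* ι (n C m))) ℚ.* ι Z)
        ℚ.* ((ι (m !) ℚ.* ι (n C m)) ℚ.* ι D)
        ≡⟨ clear-denominators {ι (m !)} {ι U} (ι≢0 D≢0) (ι≢0 C≢0) ⟩
      (ι (m !) ℚ.* ι (n C m)) ℚ.* (ι (m !) ℚ.* ι U) ℚ.+ ι R ℚ.* (ι (m !) ℚ.* ι Z)
        ≡⟨ sym (trans (ι-+ _ _) (cong₂ ℚ._+_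
             (trans (ι-* _ _) (cong₂ ℚ._*_ (ι-* (m !) (n C m)) (ι-* (m !) U)))
             (trans (ι-* R _) (cong (ι R ℚ.*_) (ι-* (m !) Z))))) ⟩
      ι ((m ! * (n C m)) * (m ! * U) + R * (m ! * Z))
        ≡⟨ cong ι (sym (∑-numerator π-inj)) ⟩
      ι (∑ (starColumns m) (numerator π)) ∎

Sym-injective : ∀ {m} {π : Fin m → Fin m} → π ∈ Sym m → Inj π
Sym-injective {m} {π} π∈ i j = isInjective⁻ {σ = π}
  (proj₂ (∈-filter⁻ (λ σ → isInjective σ Bool.≟ true) {xs = allFuns m (allFin m)} π∈))

length-Sym≢0 : ∀ m → length (Sym m) ≢ 0
length-Sym≢0 m eq = ℕ.≢-nonZero⁻¹ (m !) {{m !≢0}} (trans (sym (length-Sym m)) eq)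

-- The bounds 1 ≤ ℓ < m force m = 2 + k, the shape in which the denominator q^m - q is nonzero.
average-given-permutation : ∀ {q} (F : FiniteField q) ℓ m → 1 ≤ ℓ → ℓ < m → m < q → ∀ {π} → Inj π →
  average (MatrixOps.starColumns F m) (λ B →
    average (MatrixOps.admissibleA F ℓ m π B) (λ A → ℕtoℚ (MatrixOps.Nsol F A B))) ≡ rhs q ℓ m
average-given-permutation F ℓ (suc (suc k)) _ (s≤s ℓ≤k+1) m<q = Expectation.average-over-columns F ℓ k ℓ≤k+1 m<q
average-given-permutation F ℓ (suc zero) 1≤ℓ ℓ<1 m<q = contradiction ℓ<1 (≤⇒≯ 1≤ℓ)

theorem4 : (q : ℕ) → IsPrimePower q → (F : FiniteField q) →
    (ℓ m : ℕ) → 1 ≤ ℓ → ℓ < m → m < q →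
    expectedNsol F ℓ m ≡ rhs q ℓ m
theorem4 q _ F ℓ m 1≤ℓ ℓ<m m<q = expectedNsol-unique F ℓ m
  (λ π∈ → average-given-permutation F ℓ m 1≤ℓ ℓ<m m<q (Sym-injective π∈)) (length-Sym≢0 m)
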